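{- Let $t\ge1$ be an integer and $g=2t+1$. Let $\omega\in\mathcal{DD}_{(g)}$ be a doubled distinct $g$-core, let $\mathbf{v}\in\mathbb{Z}^t$ be its $V_{g,t}$-coding, and set $r_i=v_i-g/2$ for $1\le i\le t$. Then $$|\omega| = \frac{1}{g}\sum_{i=1}^{t} r_i^2-\frac{(g-2)\lfloor g/2\rfloor}{12}.$$ Moreover, setting $\alpha_i(\omega)=\#\{s\in\omega\mid h_s=g-i,\ \varepsilon_s=1\}$, for any field $F$ and any function $\tau:\mathbb{Z}\to F^{\times}$, $$\prod_{s\in\omega}\frac{\tau(h_s-\varepsilon_s g)}{\tau(h_s)}=\prod_{i=1}^{g-1}\left(\frac{\tau(-i)}{\tau(i)}\right)^{\alpha_i(\omega)}\prod_{1\le i<j\le t} \frac{\tau(r_i-r_j)}{\tau(j-i)}\, \frac{\tau(r_i+r_j)}{\tau(g-i-j)}.$$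
   Context: For a partition $\lambda$, $h_s$ is the hook length of a box $s$, $d_\lambda=\max\{s:\lambda_s\ge s\}$, and $\varepsilon_s=-1$ if $s$ is strictly below the main diagonal of the Ferrers diagram (English convention), $\varepsilon_s=1$ otherwise. A $g$-core is a partition with no hook length divisible by $g$. $\mathcal{DD}$ is the set of partitions with $\lambda_i=\lambda'_i+1$ for $1\le i\le d_\lambda$ ($\lambda'$ the conjugate; the empty partition included), and $\mathcal{DD}_{(g)}$ is the set of $g$-cores in $\mathcal{DD}$. Word of a partition: $\psi(\lambda)=(c_k)_{k\in\mathbb{Z}}\in\{0,1\}^{\mathbb{Z}}$ encodes the border of the Ferrers diagram read from South-West to North-East ($0$ vertical step, $1$ horizontal step), indexed so that $\#\{k\le -1: c_k=1\}=\#\{k\ge 0: c_k=0\}$; equivalently $c_k=0$ iff $k=\lambda_i-i$ for some $i\ge1$ (with $\lambda_i=0$ beyond the length). $V_{g,t}$-coding: for $i\in\{0,\dots,g-1\}$ let $\beta_i=\max\{(k+1)g+i\mid k\in\mathbb{Z},\ c_{kg+i}=0\}$; the $V_{g,t}$-coding is $\mathbf{v}=(v_1>\dots>v_t)$, the $t$ largest of the distinct integers $\beta_0,\dots,\beta_{g-1}$ in decreasing order. (Here the $r_i$ are half-integers, and $r_i\pm r_j$ are integers.) -}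

module Defs where

import Level
open import Algebra.Apartness.Bundles using (HeytingField; module HeytingCommutativeRing)
open import Algebra.Bundles using (CommutativeRing)
import Algebra.Properties.Semiring.Exp as Exp
open import Data.Fin.Base as Fin using (Fin; toℕ)
import Data.Fin.Properties as Fin
open import Data.Integer.Base as ℤ using (ℤ; +_; -[1+_])
import Data.Integer.Properties as ℤ
import Data.Integer.Tactic.RingSolver as ℤ-Solver
open import Data.List.Base as List using (List; []; _∷_; length; filter; applyUpTo; concatMap; cartesianProduct; allFin)
open import Data.List.Membership.Propositional using (_∈_)
open import Data.List.Relation.Unary.All using (All)
open import Data.List.Relation.Unary.Linked using (Linked)
open import Data.Nat.Base using (ℕ; zero; suc; pred; _+_; _*_; _∸_; _⊔_; _≤_; _<_; _≥_)
open import Data.Nat.Divisibility using (_∣_)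
open import Data.Nat.ListAction using (sum)
import Data.Nat.Properties as ℕ
open import Data.Product.Base using (Σ-syntax; ∃-syntax; _×_; _,_; proj₁)
open import Data.Rational.Base as ℚ using (ℚ; 0ℚ; toℚᵘ)
import Data.Rational.Properties as ℚ
open import Data.Rational.Unnormalised.Base as ℚᵘ using (mkℚᵘ; *≡*)
import Data.Rational.Unnormalised.Properties as ℚᵘ
open import Data.Sum.Base using (_⊎_)
open import Data.Vec.Functional as Vector using (Vector)
open import Relation.Binary.PropositionalEquality using (_≡_)
open import Relation.Nullary using (¬_; yes; no; _×-dec_)

------------------------------------------------------------------------
-- Partitions and their Ferrers diagrams

record Partition : Set where
  field
    parts      : List ℕ
    decreasing : Linked _≥_ parts
    positive   : All (0 <_) parts

open Partition public

[1…_] : ℕ → List ℕ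
[1… n ] = applyUpTo suc n

size : Partition → ℕ
size μ = sum (parts μ)

nth : List ℕ → ℕ → ℕ
nth []       _       = 0
nth (x ∷ _)  zero    = x
nth (_ ∷ xs) (suc n) = nth xs n

-- The index i of μᵢ starts at 1, and μᵢ = 0 beyond the length; the value
-- at i = 0 is junk and is never used.
part : Partition → ℕ → ℕ
part μ i = nth (parts μ) (pred i)

-- μ′ⱼ for j ≥ 1: the length of the j-th column.
conj : Partition → ℕ → ℕ
conj μ j = length (filter (j ℕ.≤?_) (parts μ))

-- max { s : μₛ ≥ s }, with the maximum of the empty set read as 0.  Any
-- such s ≥ 1 is at most the number of parts.
durfee : Partition → ℕ
durfee μ = List.foldr _⊔_ 0
  (filter (λ s → s ℕ.≤? part μ s) [1… length (parts μ) ])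

-- A box is (row , column), both starting at 1, rows going downwards.
Box : Set
Box = ℕ × ℕ

boxes : Partition → List Box
boxes μ = concatMap (λ i → List.map (i ,_) [1… part μ i ]) [1… length (parts μ) ]

-- arm + leg + 1; the truncated subtractions are exact on boxes of μ.
hook : Partition → Box → ℕ
hook μ (i , j) = (part μ i ∸ j) + (conj μ j ∸ i) + 1

ε : Box → ℤ
ε (i , j) with j ℕ.<? i
... | yes _ = -[1+ 0 ]
... | no  _ = + 1

Core : ℕ → Partition → Set
Core g μ = ∀ s → s ∈ boxes μ → ¬ g ∣ hook μ s

DoubledDistinct : Partition → Set
DoubledDistinct μ = ∀ i → 1 ≤ i → i ≤ durfee μ → part μ i ≡ conj μ i + 1

α : ℕ → Partition → ℕ → ℕ
α g μ i = length
  (filter (λ s → (hook μ s ℕ.≟ g ∸ i) ×-dec (ε s ℤ.≟ + 1)) (boxes μ))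

------------------------------------------------------------------------
-- The word of a partition and its V-coding

-- WordZero μ k says that the k-th letter of the word of μ is 0; the letter
-- is 1 exactly when this fails.
WordZero : Partition → ℤ → Set
WordZero μ k = ∃[ i ] (1 ≤ i × k ≡ + part μ i ℤ.- + i)

IsMax : (ℤ → Set) → ℤ → Set
IsMax P m = P m × (∀ n → P n → n ℤ.≤ m)

-- The set { (k+1)g + i : k ∈ ℤ, c_{kg+i} = 0 } whose maximum is βᵢ.
βSet : ℕ → Partition → ℕ → ℤ → Set
βSet g μ i n = ∃[ k ] (WordZero μ (k ℤ.* + g ℤ.+ + i) × n ≡ (k ℤ.+ + 1) ℤ.* + g ℤ.+ + i)

record IsVCoding (g t : ℕ) (μ : Partition) (v : Vector ℤ t) : Set where
  field
    β          : Vector ℤ g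
    β-max      : ∀ i → IsMax (βSet g μ (toℕ i)) (β i)
    decreasing : ∀ i j → i Fin.< j → v j ℤ.< v i
    fromβ      : ∀ i → ∃[ k ] v i ≡ β k
    largest    : ∀ k → (∃[ i ] v i ≡ β k) ⊎ (∀ i → β k ℤ.< v i)

------------------------------------------------------------------------
-- The half-integers rᵢ

r : (g : ℕ) {t : ℕ} → Vector ℤ t → Vector ℚ t
r g v i = (v i ℚ./ 1) ℚ.- (+ g ℚ./ 2)

∑ : ∀ {t} → Vector ℚ t → ℚ
∑ = Vector.foldr ℚ._+_ 0ℚ

-- rᵢ - rⱼ and rᵢ + rⱼ as integers; r-diff-correct and r-sum-correct show
-- that these are the values of the rational expressions.
r-diff r-sum : (g : ℕ) {t : ℕ} → Vector ℤ t → Fin t → Fin t → ℤ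
r-diff g v i j = v i ℤ.- v j
r-sum  g v i j = v i ℤ.+ v j ℤ.- + g

private
  /≃ : ∀ n d → toℚᵘ (n ℚ./ suc d) ℚᵘ.≃ mkℚᵘ n d
  /≃ n d = ℚ.toℚᵘ-fromℚᵘ (mkℚᵘ n d)

  toℚᵘ-homo-sub : ∀ p q → toℚᵘ (p ℚ.- q) ℚᵘ.≃ toℚᵘ p ℚᵘ.- toℚᵘ q
  toℚᵘ-homo-sub p q = ℚᵘ.≃-trans (ℚ.toℚᵘ-homo-+ p (ℚ.- q))
    (ℚᵘ.+-congʳ (toℚᵘ p) (ℚ.toℚᵘ-homo‿- q))

  sub-cong : ∀ {p p′ q q′} → p ℚᵘ.≃ p′ → q ℚᵘ.≃ q′ → p ℚᵘ.- q ℚᵘ.≃ p′ ℚᵘ.- q′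
  sub-cong e f = ℚᵘ.+-cong e (ℚᵘ.-‿cong f)

  r≃ : ∀ g {t} (v : Vector ℤ t) i → toℚᵘ (r g v i) ℚᵘ.≃ mkℚᵘ (v i) 0 ℚᵘ.- mkℚᵘ (+ g) 1
  r≃ g v i = ℚᵘ.≃-trans (toℚᵘ-homo-sub (v i ℚ./ 1) (+ g ℚ./ 2))
    (sub-cong (/≃ (v i) 0) (/≃ (+ g) 1))

r-diff-correct : ∀ g {t} (v : Vector ℤ t) i j → r-diff g v i j ℚ./ 1 ≡ r g v i ℚ.- r g v j
r-diff-correct g v i j = ℚ.toℚᵘ-injective
  (ℚᵘ.≃-trans (/≃ (r-diff g v i j) 0)
  (ℚᵘ.≃-trans (*≡* (lemma (v i) (v j) (+ g)))
  (ℚᵘ.≃-sym (ℚᵘ.≃-trans (toℚᵘ-homo-sub (r g v i) (r g v j)) (sub-cong (r≃ g v i) (r≃ g v j))))))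
  where
  lemma : ∀ a b c →
    (a ℤ.- b) ℤ.* + 4 ≡
    ((a ℤ.* + 2 ℤ.+ ℤ.- c ℤ.* + 1) ℤ.* + 2 ℤ.+ ℤ.- (b ℤ.* + 2 ℤ.+ ℤ.- c ℤ.* + 1) ℤ.* + 2) ℤ.* + 1
  lemma = ℤ-Solver.solve-∀

r-sum-correct : ∀ g {t} (v : Vector ℤ t) i j → r-sum g v i j ℚ./ 1 ≡ r g v i ℚ.+ r g v j
r-sum-correct g v i j = ℚ.toℚᵘ-injective
  (ℚᵘ.≃-trans (/≃ (r-sum g v i j) 0)
  (ℚᵘ.≃-trans (*≡* (lemma (v i) (v j) (+ g)))
  (ℚᵘ.≃-sym (ℚᵘ.≃-trans (ℚ.toℚᵘ-homo-+ (r g v i) (r g v j)) (ℚᵘ.+-cong (r≃ g v i) (r≃ g v j))))))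
  where
  lemma : ∀ a b c →
    (a ℤ.+ b ℤ.- c) ℤ.* + 4 ≡
    ((a ℤ.* + 2 ℤ.+ ℤ.- c ℤ.* + 1) ℤ.* + 2 ℤ.+ (b ℤ.* + 2 ℤ.+ ℤ.- c ℤ.* + 1) ℤ.* + 2) ℤ.* + 1
  lemma = ℤ-Solver.solve-∀

-- The index of a coordinate, counted from 1.
idx : ∀ {t} → Fin t → ℤ
idx i = + suc (toℕ i)

pairs< : (t : ℕ) → List (Fin t × Fin t)
pairs< t = filter (λ (i , j) → i Fin.<? j) (cartesianProduct (allFin t) (allFin t))

------------------------------------------------------------------------
-- Products in a field

module FieldProducts {c ℓ₁ ℓ₂} (F : HeytingField c ℓ₁ ℓ₂) where

  open HeytingField F public
    using (Carrier; _≈_; _#_; 0#; 1#; #⇒invertible; heytingCommutativeRing)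
    renaming (_*_ to _·_)

  open Exp (CommutativeRing.semiring (HeytingCommutativeRing.commutativeRing heytingCommutativeRing))
    public using (_^_)

  -- In a Heyting field, being apart from 0 means being invertible; since #
  -- is tight, it is classically the same as being different from 0.
  Fˣ : Set (c Level.⊔ ℓ₂)
  Fˣ = Σ[ x ∈ Carrier ] x # 0#

  -- #⇒invertible inverts y - 0#, which is y up to ≈.
  infixl 7 _÷_
  _÷_ : Fˣ → Fˣ → Carrier
  (x , _) ÷ (_ , y#0) = x · proj₁ (#⇒invertible y#0)

  ∏ : ∀ {a} {A : Set a} → List A → (A → Carrier) → Carrier
  ∏ xs f = List.foldr (λ x y → f x · y) 1# xs

  infix 5 ∏
  syntax ∏ xs (λ x → e) = ∏[ x ∈ xs ] e

{-# OPTIONS --safe #-}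

-- Let X = { λᵢ - i } be the set of positions of the letter 0, with indicator
-- χ.  Boxes of the diagram are the pairs y < x with x ∈ X and y ∉ X, the hook
-- length being x - y.  Doubled distinctness says that 0 ∉ X and that exactly
-- one of z and -z lies in X for z ≠ 0; then ε = 1 exactly when x + y ≥ 0, and
-- (x , y) ↦ (-y , -x) reflects one kind of boxes into the other, so that the
-- numbers of hooks of length m of each kind follow from the autocorrelation
-- A(m) = ∑ₓ χ(x) (1 - χ(x - m)).  For a g-core, D(z) = χ(z - g) - χ(z) is the
-- indicator of {β₀ , … , β_{g-1}} = {0} ∪ {vᵢ} ∪ {g - vᵢ}, and summation by
-- parts gives A(m + g) - 2 A(m) + A(m - g) = ∑ₓ D(x) D(x - m), which counts
-- the differences of the β's, that is, the integers rᵢ ± rⱼ, each twice.  All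
-- remaining terms depend on g and m only, hence are determined by the case of
-- the empty partition, and the product formula follows by comparing
-- multiplicities of the arguments of τ.  Similarly |ω| is the sum of
-- (χ(z) - χ∅(z)) z, and 2 g z is the g-step difference of z² - g z.

module Submission where

open import Defs
open import Level using (Level)
open import Algebra.Apartness.Bundles using (HeytingField; module HeytingCommutativeRing)
open import Algebra.Bundles using (CommutativeMonoid; CommutativeRing)
import Algebra.Properties.AbelianGroup as AbelianGroup
import Algebra.Properties.CommutativeSemigroup as CommutativeSemigroup
import Algebra.Properties.Ring as Ring
open import Data.Fin.Base as Fin using (Fin; toℕ; fromℕ<)
import Data.Fin.Properties as Fin
open import Data.Integer.Base as ℤ using (ℤ; +_; -[1+_]; 0ℤ; 1ℤ; -1ℤ; ∣_∣)
import Data.Integer.DivMod as ℤ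
import Data.Integer.Properties as ℤ
import Data.Integer.Tactic.RingSolver as ℤ-Solver
open import Data.List.Base as List using (List; []; _∷_; _++_; map; length; filter; concatMap; cartesianProduct; replicate; applyUpTo; upTo; foldr; tabulate; allFin)
open import Data.List.Membership.Propositional using (_∈_; _∉_)
open import Data.List.Membership.Propositional.Properties
  using (∈-++⁺ˡ; ∈-++⁺ʳ; ∈-++⁻; ∈-∃++; ∈-map⁺; ∈-map⁻; ∈-concatMap⁺; ∈-filter⁺; ∈-filter⁻; ∈-tabulate⁺; ∈-tabulate⁻; ∈-allFin; ∈-applyUpTo⁺; ∈-applyUpTo⁻; ∈-upTo⁻)
import Data.List.Properties as List
open import Data.List.Relation.Binary.Permutation.Propositional as ↭ using (_↭_; ↭-sym; ↭-trans; ↭-refl; prep; ↭⇒↭ₛ)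
open import Data.List.Relation.Binary.Permutation.Propositional.Properties using (shift; ∈-resp-↭; ↭-length)
import Data.List.Relation.Binary.Permutation.Setoid.Properties as ↭ₛ
open import Data.List.Relation.Unary.All as All using ([]; _∷_)
open import Data.List.Relation.Unary.AllPairs using ([]; _∷_)
open import Data.List.Relation.Unary.Any as Any using (here; there)
open import Data.List.Relation.Unary.Linked as Linked using (Linked; []; [-]; _∷_)
open import Data.List.Relation.Unary.Unique.Propositional using (Unique)
import Data.List.Relation.Unary.Unique.Propositional.Properties as Unique
open import Data.Nat.Base as ℕ using (ℕ; zero; suc; s≤s; z≤n; _∸_; _⊔_; ⌊_/2⌋)
open import Data.Nat.Divisibility using (∣-reflexive)
open import Data.Nat.ListAction using (sum)
import Data.Nat.Properties as ℕ
open import Data.Product.Base using (_×_; _,_; proj₁; proj₂; ∃-syntax)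
open import Data.Rational.Base as ℚ using (ℚ; toℚᵘ)
import Data.Rational.Properties as ℚ
open import Data.Rational.Unnormalised.Base as ℚᵘ using (mkℚᵘ; *≡*)
import Data.Rational.Unnormalised.Properties as ℚᵘ
open import Data.Sum.Base as Sum using (_⊎_; inj₁; inj₂; [_,_]′)
open import Data.Vec.Functional using (Vector)
open import Function.Base using (_∘_; id)
open import Relation.Binary.Definitions using (tri<; tri≈; tri>)
open import Relation.Binary.PropositionalEquality using (_≡_; _≢_; refl; sym; trans; cong; cong₂; subst; setoid; module ≡-Reasoning)
import Relation.Binary.Reasoning.Setoid as ≈-Reasoning
open import Relation.Nullary using (¬_; Dec; yes; no; contradiction; _×-dec_)
open import Relation.Nullary.Decidable using (toSum)
open import Relation.Unary using (Pred; Decidable)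

-- The two kinds of hooks are only accessible through their sum, which is A(m), and their
-- difference, which counts the pairs left unmatched by the reflection: those with `y = 0` or
-- `x + y = 0`. So all counts appear doubled until the multiplicities are compared. The factor with
-- the αᵢ makes the second difference close up. A hook `h < g` with ε = 1 produces the negative
-- argument `h - g`; trading `τ (-i)` for `τ i` supplies the value of A at `m - g` when `m < g`, up
-- to a term that depends on g and m only, and leaves only positive arguments to compare. The
-- denominators `j - i` and `g - i - j` are the integers rᵢ ± rⱼ of the empty partition, and the
-- constant of the size formula is its value of (1/g) ∑ rᵢ². Since g is odd, `z ↦ g - z` pairs the
-- nonzero β's without fixed points, and the t largest β's take the larger one from each pair. Sums
-- over ℤ are replaced by sums over windows [-W , W] that leave enough room for every shift. No
-- quotient is simplified in the field: the lists of arguments are compared after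
-- cross-multiplication, so all that is used of τ is that its values are invertible.

module ℤ-Group = AbelianGroup ℤ.+-0-abelianGroup

private variable
  ℓ ℓ′ : Level
  A B : Set ℓ
  P : Set ℓ
  Q : Set ℓ′

-- Linear arithmetic over ℤ: an inequality is reduced to known ones by a
-- ring identity between differences.

≤-by : ∀ {i j k l} → k ℤ.≤ l → j ℤ.- i ≡ l ℤ.- k → i ℤ.≤ j
≤-by {i} {j} {k} {l} k≤l e = ℤ.0≤i-j⇒j≤i (subst (0ℤ ℤ.≤_) (sym e) (ℤ.i≤j⇒0≤j-i k≤l))

<⇒1+≤ : ∀ {i j} → i ℤ.< j → i ℤ.+ 1ℤ ℤ.≤ j
<⇒1+≤ {i} i<j = subst (ℤ._≤ _) (ℤ.+-comm 1ℤ i) (ℤ.i<j⇒suc[i]≤j i<j)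

1+≤⇒< : ∀ {i j} → i ℤ.+ 1ℤ ℤ.≤ j → i ℤ.< j
1+≤⇒< {i} i<j = ℤ.suc[i]≤j⇒i<j (subst (ℤ._≤ _) (ℤ.+-comm i 1ℤ) i<j)

<-by : ∀ {i j k l} → k ℤ.< l → j ℤ.- i ≡ l ℤ.- k → i ℤ.< j
<-by {i} {j} {k} {l} k<l e = 1+≤⇒< (≤-by (<⇒1+≤ k<l) (trans (shift₁ j i) (trans (cong (ℤ._- 1ℤ) e) (sym (shift₁ l k)))))
  where
  shift₁ : ∀ x y → x ℤ.- (y ℤ.+ 1ℤ) ≡ x ℤ.- y ℤ.- 1ℤ
  shift₁ = ℤ-Solver.solve-∀

-- Indicators and sums over lists

𝟙 : Dec P → ℤ
𝟙 (yes _) = 1ℤ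
𝟙 (no  _) = 0ℤ

𝟙-yes : (d : Dec P) → P → 𝟙 d ≡ 1ℤ
𝟙-yes (yes _) _ = refl
𝟙-yes (no ¬p) p = contradiction p ¬p

𝟙-no : (d : Dec P) → ¬ P → 𝟙 d ≡ 0ℤ
𝟙-no (yes p) ¬p = contradiction p ¬p
𝟙-no (no _)  _  = refl

𝟙-⇔ : (d : Dec P) (e : Dec Q) → (P → Q) → (Q → P) → 𝟙 d ≡ 𝟙 e
𝟙-⇔ (yes p) e to _    = sym (𝟙-yes e (to p))
𝟙-⇔ (no ¬p) e _  from = sym (𝟙-no e (¬p ∘ from))

𝟙-idem : (d : Dec P) → 𝟙 d ℤ.* 𝟙 d ≡ 𝟙 d
𝟙-idem (yes _) = refl
𝟙-idem (no  _) = refl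

⅀ : List A → (A → ℤ) → ℤ
⅀ []       f = 0ℤ
⅀ (x ∷ xs) f = f x ℤ.+ ⅀ xs f

infix 5 ⅀
syntax ⅀ xs (λ x → e) = ⅀[ x ∈ xs ] e

⅀-cong : (xs : List A) {f h : A → ℤ} → (∀ {x} → x ∈ xs → f x ≡ h x) → ⅀ xs f ≡ ⅀ xs h
⅀-cong []       _ = refl
⅀-cong (x ∷ xs) e = cong₂ ℤ._+_ (e (here refl)) (⅀-cong xs (e ∘ there))

⅀-ext : (xs : List A) {f h : A → ℤ} → (∀ x → f x ≡ h x) → ⅀ xs f ≡ ⅀ xs h
⅀-ext xs e = ⅀-cong xs (λ {x} _ → e x)

⅀-zero : (xs : List A) {f : A → ℤ} → (∀ {x} → x ∈ xs → f x ≡ 0ℤ) → ⅀ xs f ≡ 0ℤ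
⅀-zero []       _ = refl
⅀-zero (x ∷ xs) e = cong₂ ℤ._+_ (e (here refl)) (⅀-zero xs (e ∘ there))

⅀-+ : (xs : List A) (f h : A → ℤ) → ⅀[ x ∈ xs ] (f x ℤ.+ h x) ≡ ⅀ xs f ℤ.+ ⅀ xs h
⅀-+ []       f h = refl
⅀-+ (x ∷ xs) f h = trans (cong (ℤ._+_ (f x ℤ.+ h x)) (⅀-+ xs f h)) (interchange (f x) (h x) _ _)
  where open CommutativeSemigroup ℤ.+-commutativeSemigroup using (interchange)

⅀-*ˡ : (xs : List A) (c : ℤ) (f : A → ℤ) → ⅀[ x ∈ xs ] (c ℤ.* f x) ≡ c ℤ.* ⅀ xs f
⅀-*ˡ []       c f = sym (ℤ.*-zeroʳ c)
⅀-*ˡ (x ∷ xs) c f = trans (cong (ℤ._+_ (c ℤ.* f x)) (⅀-*ˡ xs c f)) (sym (ℤ.*-distribˡ-+ c (f x) _))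

⅀-*ʳ : (xs : List A) (f : A → ℤ) (c : ℤ) → ⅀[ x ∈ xs ] (f x ℤ.* c) ≡ ⅀ xs f ℤ.* c
⅀-*ʳ xs f c = trans (⅀-ext xs (λ x → ℤ.*-comm (f x) c)) (trans (⅀-*ˡ xs c f) (ℤ.*-comm c _))

⅀-neg : (xs : List A) (f : A → ℤ) → ⅀[ x ∈ xs ] (ℤ.- f x) ≡ ℤ.- ⅀ xs f
⅀-neg []       f = refl
⅀-neg (x ∷ xs) f = trans (cong (ℤ._+_ (ℤ.- f x)) (⅀-neg xs f)) (sym (ℤ.neg-distrib-+ (f x) _))

⅀-- : (xs : List A) (f h : A → ℤ) → ⅀[ x ∈ xs ] (f x ℤ.- h x) ≡ ⅀ xs f ℤ.- ⅀ xs h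
⅀-- xs f h = trans (⅀-+ xs f (λ x → ℤ.- h x)) (cong (ℤ._+_ (⅀ xs f)) (⅀-neg xs h))

⅀-++ : (xs ys : List A) (f : A → ℤ) → ⅀ (xs ++ ys) f ≡ ⅀ xs f ℤ.+ ⅀ ys f
⅀-++ []       ys f = sym (ℤ.+-identityˡ _)
⅀-++ (x ∷ xs) ys f = trans (cong (ℤ._+_ (f x)) (⅀-++ xs ys f)) (sym (ℤ.+-assoc (f x) _ _))

⅀-map : (xs : List A) (k : A → B) (f : B → ℤ) → ⅀ (map k xs) f ≡ ⅀ xs (f ∘ k)
⅀-map []       k f = refl
⅀-map (x ∷ xs) k f = cong (ℤ._+_ (f (k x))) (⅀-map xs k f)

⅀-concatMap : (xs : List A) (k : A → List B) (f : B → ℤ) → ⅀ (concatMap k xs) f ≡ ⅀[ x ∈ xs ] ⅀ (k x) f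
⅀-concatMap []       k f = refl
⅀-concatMap (x ∷ xs) k f = trans (⅀-++ (k x) _ f) (cong (ℤ._+_ (⅀ (k x) f)) (⅀-concatMap xs k f))

⅀-cartesianProduct : (xs : List A) (ys : List B) (f : A × B → ℤ) →
  ⅀ (cartesianProduct xs ys) f ≡ ⅀[ x ∈ xs ] ⅀[ y ∈ ys ] f (x , y)
⅀-cartesianProduct []       ys f = refl
⅀-cartesianProduct (x ∷ xs) ys f =
  trans (⅀-++ (map (x ,_) ys) _ f) (cong₂ ℤ._+_ (⅀-map ys (x ,_) f) (⅀-cartesianProduct xs ys f))

⅀-filter : {P : Pred A ℓ′} (P? : Decidable P) (xs : List A) (f : A → ℤ) →
  ⅀ (filter P? xs) f ≡ ⅀[ x ∈ xs ] 𝟙 (P? x) ℤ.* f x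
⅀-filter P? []       f = refl
⅀-filter P? (x ∷ xs) f with P? x
... | yes _ = cong₂ ℤ._+_ (sym (ℤ.*-identityˡ (f x))) (⅀-filter P? xs f)
... | no  _ = trans (⅀-filter P? xs f) (sym (ℤ.+-identityˡ _))

⅀-swap : (xs : List A) (ys : List B) (f : A → B → ℤ) →
  ⅀[ x ∈ xs ] ⅀[ y ∈ ys ] f x y ≡ ⅀[ y ∈ ys ] ⅀[ x ∈ xs ] f x y
⅀-swap []       ys f = sym (⅀-zero ys (λ _ → refl))
⅀-swap (x ∷ xs) ys f = trans (cong (ℤ._+_ (⅀ ys (f x))) (⅀-swap xs ys f)) (sym (⅀-+ ys (f x) _))

⅀-↭ : {xs ys : List A} (f : A → ℤ) → xs ↭ ys → ⅀ xs f ≡ ⅀ ys f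
⅀-↭ f ↭.refl         = refl
⅀-↭ f (↭.prep x π)   = cong (ℤ._+_ (f x)) (⅀-↭ f π)
⅀-↭ f (↭.swap x y π) = trans (cong (λ s → f x ℤ.+ (f y ℤ.+ s)) (⅀-↭ f π)) (swap₂ (f x) (f y) _)
  where
  swap₂ : ∀ a b c → a ℤ.+ (b ℤ.+ c) ≡ b ℤ.+ (a ℤ.+ c)
  swap₂ = ℤ-Solver.solve-∀
⅀-↭ f (↭.trans π ρ)  = trans (⅀-↭ f π) (⅀-↭ f ρ)

⅀-filter-length : {P : Pred A ℓ′} (P? : Decidable P) (xs : List A) →
  + length (filter P? xs) ≡ ⅀[ x ∈ xs ] 𝟙 (P? x)
⅀-filter-length P? []       = refl
⅀-filter-length P? (x ∷ xs) with P? x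
... | yes _ = cong (ℤ._+_ (1ℤ)) (⅀-filter-length P? xs)
... | no  _ = trans (⅀-filter-length P? xs) (sym (ℤ.+-identityˡ _))

⅀-replicate : ∀ n (x : A) (f : A → ℤ) → ⅀ (replicate n x) f ≡ + n ℤ.* f x
⅀-replicate zero    x f = refl
⅀-replicate (suc n) x f = trans (cong (ℤ._+_ (f x)) (⅀-replicate n x f)) (sym (ℤ.suc-* (+ n) (f x)))

-- Kronecker deltas, multiplicities and permutations of lists.

module _ (_≟_ : (x y : A) → Dec (x ≡ y)) where

  ⅀-δ-∉ : ∀ {xs : List A} {c} (f : A → ℤ) → c ∉ xs → ⅀[ x ∈ xs ] 𝟙 (x ≟ c) ℤ.* f x ≡ 0ℤ
  ⅀-δ-∉ {xs} {c} f c∉xs = ⅀-zero xs λ {x} x∈xs →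
    cong (ℤ._* f x) (𝟙-no (x ≟ c) (λ x≡c → c∉xs (subst (_∈ xs) x≡c x∈xs)))

  ⅀-δ-∈ : ∀ {xs : List A} {c} (f : A → ℤ) → Unique xs → c ∈ xs → ⅀[ x ∈ xs ] 𝟙 (x ≟ c) ℤ.* f x ≡ f c
  ⅀-δ-∈ {x ∷ xs} f u@(_ ∷ _) (here refl) =
    trans (cong₂ ℤ._+_ (trans (cong (ℤ._* f x) (𝟙-yes (x ≟ x) refl)) (ℤ.*-identityˡ (f x)))
                       (⅀-δ-∉ f (Unique.Unique[x∷xs]⇒x∉xs u)))
          (ℤ.+-identityʳ (f x))
  ⅀-δ-∈ {x ∷ xs} {c} f u@(_ ∷ uxs) (there c∈xs) =
    trans (cong₂ ℤ._+_ (cong (ℤ._* f x) (𝟙-no (x ≟ c) λ { refl → Unique.Unique[x∷xs]⇒x∉xs u c∈xs }))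
                       (⅀-δ-∈ f uxs c∈xs))
          (ℤ.+-identityˡ (f c))

  multiplicity : A → List A → ℤ
  multiplicity z xs = ⅀[ x ∈ xs ] 𝟙 (x ≟ z)

  multiplicity-∉ : ∀ {z xs} → z ∉ xs → multiplicity z xs ≡ 0ℤ
  multiplicity-∉ {z} {xs} z∉xs = trans (⅀-ext xs (λ x → sym (ℤ.*-identityʳ (𝟙 (x ≟ z))))) (⅀-δ-∉ (λ _ → 1ℤ) z∉xs)

  multiplicity-unique : ∀ {z xs} → Unique xs → z ∈ xs → multiplicity z xs ≡ 1ℤ
  multiplicity-unique {z} {xs} u z∈xs = trans (⅀-ext xs (λ x → sym (ℤ.*-identityʳ (𝟙 (x ≟ z))))) (⅀-δ-∈ (λ _ → 1ℤ) u z∈xs)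

  multiplicity-nonneg : ∀ z xs → 0ℤ ℤ.≤ multiplicity z xs
  multiplicity-nonneg z []       = ℤ.≤-refl
  multiplicity-nonneg z (x ∷ xs) with x ≟ z
  ... | yes _ = ℤ.+-mono-≤ {0ℤ} {1ℤ} (ℤ.+≤+ z≤n) (multiplicity-nonneg z xs)
  ... | no  _ = ℤ.+-mono-≤ {0ℤ} {0ℤ} ℤ.≤-refl (multiplicity-nonneg z xs)

  multiplicity-∈ : ∀ {z xs} → multiplicity z xs ≢ 0ℤ → z ∈ xs
  multiplicity-∈ {z} {[]}     ≢0 = contradiction refl ≢0
  multiplicity-∈ {z} {x ∷ xs} ≢0 with x ≟ z
  ... | yes refl = here refl
  ... | no  _    = there (multiplicity-∈ (≢0 ∘ trans (ℤ.+-identityˡ _)))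

  multiplicity-head : ∀ x xs → multiplicity x (x ∷ xs) ≢ 0ℤ
  multiplicity-head x xs e with x ≟ x
  ... | no x≢x = x≢x refl
  ... | yes _  = ℤ.<-irrefl (sym e) (ℤ.suc[i]≤j⇒i<j (ℤ.+-monoʳ-≤ 1ℤ (multiplicity-nonneg x xs)))

  -- The passage from arithmetic to products: an identity between integer counting functions becomes
  -- a rearrangement of factors.
  multiplicity⇒↭ : ∀ xs ys → (∀ z → multiplicity z xs ≡ multiplicity z ys) → xs ↭ ys
  multiplicity⇒↭ []       []       _ = ↭-refl
  multiplicity⇒↭ []       (y ∷ ys) e = contradiction (sym (e y)) (multiplicity-head y ys)
  multiplicity⇒↭ (x ∷ xs) ys       e
    with ∈-∃++ (multiplicity-∈ {x} {ys} (subst (_≢ 0ℤ) (e x) (multiplicity-head x xs)))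
  ... | as , bs , refl = ↭-trans (prep x (multiplicity⇒↭ xs (as ++ bs) rest)) (↭-sym (shift x as bs))
    where
    rest : ∀ z → multiplicity z xs ≡ multiplicity z (as ++ bs)
    rest z = ℤ-Group.∙-cancelˡ (𝟙 (x ≟ z)) _ _ (trans (e z) (⅀-↭ (λ y → 𝟙 (y ≟ z)) (shift x as bs)))

-- Pigeonhole: the length bound replaces the reverse inclusion. The conclusion also transfers
-- `Unique` from `xs` to `ys`.
Unique-⊆⇒↭ : ∀ {xs ys : List A} → Unique xs → (∀ {z} → z ∈ xs → z ∈ ys) → length ys ℕ.≤ length xs → xs ↭ ys
Unique-⊆⇒↭ {xs = []}     {[]}    _ _ _ = ↭-refl
Unique-⊆⇒↭ {xs = x ∷ xs} {ys}    u@(_ ∷ uxs) ⊆ys ≤ with ∈-∃++ (⊆ys (here refl))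
... | as , bs , refl = ↭-trans (prep x (Unique-⊆⇒↭ uxs sub len)) (↭-sym (shift x as bs))
  where
  x∉xs = Unique.Unique[x∷xs]⇒x∉xs u
  sub : ∀ {z} → z ∈ xs → z ∈ as ++ bs
  sub z∈xs with ∈-resp-↭ (shift x as bs) (⊆ys (there z∈xs))
  ... | here refl = contradiction z∈xs x∉xs
  ... | there z∈  = z∈
  len : length (as ++ bs) ℕ.≤ length xs
  len = ℕ.≤-pred (subst (ℕ._≤ suc (length xs)) (↭-length (shift x as bs)) ≤)

-- Sums over a symmetric window of integers, and their shifts.

-- The interval [-W , W], ordered so that its reflection is apparent.
window : ℕ → List ℤ
window zero    = 0ℤ ∷ []
window (suc W) = + suc W ∷ -[1+ W ] ∷ window W

window-length : ∀ W → length (window W) ≡ suc (W ℕ.+ W)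
window-length zero    = refl
window-length (suc W) = cong suc (trans (cong suc (window-length W)) (cong suc (sym (ℕ.+-suc W W))))

∈-window⁻ : ∀ {W z} → z ∈ window W → ∣ z ∣ ℕ.≤ W
∈-window⁻ {zero}  (here refl)         = z≤n
∈-window⁻ {suc W} (here refl)         = ℕ.≤-refl
∈-window⁻ {suc W} (there (here refl)) = ℕ.≤-refl
∈-window⁻ {suc W} (there (there z∈))  = ℕ.m≤n⇒m≤1+n (∈-window⁻ z∈)

∈-window⁺ : ∀ {W} z → ∣ z ∣ ℕ.≤ W → z ∈ window W
∈-window⁺ {zero}  (+ zero) z≤n = here refl
∈-window⁺ {suc W} z ≤ with ℕ.m≤n⇒m<n∨m≡n ≤
∈-window⁺ {suc W} z        ≤ | inj₁ (s≤s ≤W) = there (there (∈-window⁺ z ≤W))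
∈-window⁺ {suc W} (+ _)    ≤ | inj₂ refl      = here refl
∈-window⁺ {suc W} -[1+ _ ] ≤ | inj₂ refl      = there (here refl)

window-unique : ∀ W → Unique (window W)
window-unique zero    = [] ∷ []
window-unique (suc W) =
  ((λ ()) ∷ All.tabulate (outside (+ suc W) refl)) ∷ All.tabulate (outside -[1+ W ] refl) ∷ window-unique W
  where
  outside : ∀ x → ∣ x ∣ ≡ suc W → ∀ {z} → z ∈ window W → x ≢ z
  outside x e z∈ refl = ℕ.1+n≰n (subst (ℕ._≤ W) e (∈-window⁻ z∈))

⅀-reflect : ∀ (F : ℤ → ℤ) W → ⅀ (window W) (F ∘ ℤ.-_) ≡ ⅀ (window W) F
⅀-reflect F zero    = refl
⅀-reflect F (suc W) = trans (cong (λ s → F -[1+ W ] ℤ.+ (F (+ suc W) ℤ.+ s)) (⅀-reflect F W))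
                          (exchange (F -[1+ W ]) (F (+ suc W)) _)
  where
  exchange : ∀ a b c → a ℤ.+ (b ℤ.+ c) ≡ b ℤ.+ (a ℤ.+ c)
  exchange = ℤ-Solver.solve-∀

-- The window moves one place down: `-W-1` enters and `W` leaves.
⅀-shift₁ : ∀ (F : ℤ → ℤ) W → ⅀[ z ∈ window W ] F (z ℤ.- 1ℤ) ≡ ⅀ (window W) F ℤ.+ (F -[1+ W ] ℤ.- F (+ W))
⅀-shift₁ F zero    = lemma (F -[1+ 0 ]) (F 0ℤ)
  where
  lemma : ∀ a b → a ℤ.+ 0ℤ ≡ b ℤ.+ 0ℤ ℤ.+ (a ℤ.- b)
  lemma = ℤ-Solver.solve-∀
-- `-[1+ W ] - 1` computes to `-[1+ suc (W + 0) ]`.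
⅀-shift₁ F (suc W) rewrite ℕ.+-identityʳ W =
  trans (cong (λ s → F (+ W) ℤ.+ (F -[1+ suc W ] ℤ.+ s)) (⅀-shift₁ F W))
        (lemma (F (+ W)) (F -[1+ suc W ]) _ (F -[1+ W ]) (F (+ suc W)))
  where
  lemma : ∀ a b s c d → a ℤ.+ (b ℤ.+ (s ℤ.+ (c ℤ.- a))) ≡ d ℤ.+ (c ℤ.+ s) ℤ.+ (b ℤ.- d)
  lemma = ℤ-Solver.solve-∀

-- The boundary terms of a shift are F at -W-1, …, -W-n and W, …, W-n+1.
⅀-shift-by : ∀ (F : ℤ → ℤ) W n →
  (a b : ℤ) → (∀ k → k ℕ.< n → F (-[1+ W ] ℤ.- + k) ≡ a) → (∀ k → k ℕ.< n → F (+ W ℤ.- + k) ≡ b) →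
  ⅀[ z ∈ window W ] F (z ℤ.- + n) ≡ ⅀ (window W) F ℤ.+ + n ℤ.* (a ℤ.- b)
⅀-shift-by F W zero a b _ _ = trans (⅀-ext (window W) (λ z → cong F (ℤ.+-identityʳ z)))
  (lemma _ (a ℤ.- b))
  where
  lemma : ∀ s c → s ≡ s ℤ.+ 0ℤ ℤ.* c
  lemma = ℤ-Solver.solve-∀
⅀-shift-by F W (suc n) a b ea eb = begin
  ⅀[ z ∈ window W ] F (z ℤ.- + suc n)             ≡⟨ ⅀-ext (window W) (λ z → cong F (assoc z (+ n))) ⟩
  ⅀[ z ∈ window W ] F (z ℤ.- 1ℤ ℤ.- + n)          ≡⟨ ⅀-shiftₙ W ⟩
  (⅀[ z ∈ window W ] F (z ℤ.- + n)) ℤ.+ _         ≡⟨ cong₂ ℤ._+_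
    (⅀-shift-by F W n a b (λ k k<n → ea k (ℕ.m≤n⇒m≤1+n k<n)) (λ k k<n → eb k (ℕ.m≤n⇒m≤1+n k<n)))
    (cong₂ ℤ._-_ (ea n ℕ.≤-refl) (eb n ℕ.≤-refl)) ⟩
  ⅀ (window W) F ℤ.+ + n ℤ.* (a ℤ.- b) ℤ.+ (a ℤ.- b) ≡⟨ lemma (⅀ (window W) F) (+ n) (a ℤ.- b) ⟩
  ⅀ (window W) F ℤ.+ + suc n ℤ.* (a ℤ.- b)        ∎
  where
  open ≡-Reasoning
  assoc : ∀ z n → z ℤ.- (1ℤ ℤ.+ n) ≡ z ℤ.- 1ℤ ℤ.- n
  assoc = ℤ-Solver.solve-∀
  lemma : ∀ s n c → s ℤ.+ n ℤ.* c ℤ.+ c ≡ s ℤ.+ (1ℤ ℤ.+ n) ℤ.* c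
  lemma = ℤ-Solver.solve-∀
  ⅀-shiftₙ : ∀ W → ⅀[ z ∈ window W ] F (z ℤ.- 1ℤ ℤ.- + n) ≡
    (⅀[ z ∈ window W ] F (z ℤ.- + n)) ℤ.+ (F (-[1+ W ] ℤ.- + n) ℤ.- F (+ W ℤ.- + n))
  ⅀-shiftₙ = ⅀-shift₁ (λ z → F (z ℤ.- + n))

data FarFrom0 (K : ℕ) (z : ℤ) : Set where
  above : + K ℤ.≤ z → FarFrom0 K z
  below : z ℤ.≤ ℤ.- + K → FarFrom0 K z

Supported : ℕ → (ℤ → ℤ) → Set
Supported K F = ∀ z → FarFrom0 K z → F z ≡ 0ℤ

Supported-≤ : ∀ {K L F} → K ℕ.≤ L → Supported K F → Supported L F
Supported-≤ K≤L F≡0 z (above L≤z)  = F≡0 z (above (ℤ.≤-trans (ℤ.+≤+ K≤L) L≤z))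
Supported-≤ K≤L F≡0 z (below z≤-L) = F≡0 z (below (ℤ.≤-trans z≤-L (ℤ.neg-mono-≤ (ℤ.+≤+ K≤L))))

-- Translation invariance of a finite sum over ℤ; the window needs a margin of `n` around the
-- support.
⅀-shift⁻ : ∀ {K} F → Supported K F → ∀ n {W} → K ℕ.+ n ℕ.≤ W →
  ⅀[ z ∈ window W ] F (z ℤ.- + n) ≡ ⅀ (window W) F
⅀-shift⁻ {K} F F≡0 n {W} K+n≤W = trans
  (⅀-shift-by F W n 0ℤ 0ℤ
    (λ k _ → F≡0 _ (below (≤-by (ℤ.+-mono-≤ K≤W (ℤ.+≤+ (z≤n {suc k}))) (lemma₁ (+ K) (+ W) (+ k)))))
    (λ k k<n → F≡0 _ (above (≤-by (ℤ.+≤+ (ℕ.≤-trans (ℕ.+-monoʳ-≤ K (ℕ.<⇒≤ k<n)) K+n≤W)) (lemma₂ (+ K) (+ W) (+ k))))))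
  (lemma₃ _ (+ n))
  where
  K≤W : + K ℤ.≤ + W
  K≤W = ℤ.+≤+ (ℕ.m+n≤o⇒m≤o K K+n≤W)
  lemma₁ : ∀ K W k → ℤ.- K ℤ.- (ℤ.- (1ℤ ℤ.+ W) ℤ.- k) ≡ W ℤ.+ (1ℤ ℤ.+ k) ℤ.- (K ℤ.+ 0ℤ)
  lemma₁ = ℤ-Solver.solve-∀
  lemma₂ : ∀ K W k → W ℤ.- k ℤ.- K ≡ W ℤ.- (K ℤ.+ k)
  lemma₂ = ℤ-Solver.solve-∀
  lemma₃ : ∀ s n → s ℤ.+ n ℤ.* 0ℤ ≡ s
  lemma₃ = ℤ-Solver.solve-∀

⅀-window-δ : ∀ {W} c (F : ℤ → ℤ) → (∣ c ∣ ℕ.> W → F c ≡ 0ℤ) → ⅀[ z ∈ window W ] 𝟙 (z ℤ.≟ c) ℤ.* F z ≡ F c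
⅀-window-δ {W} c F outside with ∣ c ∣ ℕ.≤? W
... | yes ≤W = ⅀-δ-∈ ℤ._≟_ F (window-unique W) (∈-window⁺ c ≤W)
... | no  ≰W = trans (⅀-δ-∉ ℤ._≟_ F (≰W ∘ ∈-window⁻)) (sym (outside (ℕ.≰⇒> ≰W)))

-- The shift of a step function lets `n` ones enter at the lower end and drops only zeros at the
-- upper end.
⅀-charge : ∀ {K} χ → (∀ z → + K ℤ.≤ z → χ z ≡ 0ℤ) → (∀ z → z ℤ.≤ ℤ.- + K → χ z ≡ 1ℤ) →
  ∀ n {W} → K ℕ.+ n ℕ.≤ W → ⅀[ z ∈ window W ] (χ z ℤ.- χ (z ℤ.- + n)) ≡ ℤ.- + n
⅀-charge {K} χ hi lo n {W} K+n≤W = begin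
  ⅀[ z ∈ window W ] (χ z ℤ.- χ (z ℤ.- + n))                 ≡⟨ ⅀-- (window W) χ (λ z → χ (z ℤ.- + n)) ⟩
  ⅀ (window W) χ ℤ.- (⅀[ z ∈ window W ] χ (z ℤ.- + n))      ≡⟨ cong (ℤ._-_ (⅀ (window W) χ)) (⅀-shift-by χ W n 1ℤ 0ℤ
    (λ k _ → lo _ (≤-by (ℤ.+-mono-≤ K≤W (ℤ.+≤+ (z≤n {suc k}))) (lemma₁ (+ K) (+ W) (+ k))))
    (λ k k<n → hi _ (≤-by (ℤ.+≤+ (ℕ.≤-trans (ℕ.+-monoʳ-≤ K (ℕ.<⇒≤ k<n)) K+n≤W)) (lemma₂ (+ K) (+ W) (+ k))))) ⟩
  ⅀ (window W) χ ℤ.- (⅀ (window W) χ ℤ.+ + n ℤ.* (1ℤ ℤ.- 0ℤ)) ≡⟨ lemma₃ (⅀ (window W) χ) (+ n) ⟩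
  ℤ.- + n                                                   ∎
  where
  open ≡-Reasoning
  K≤W : + K ℤ.≤ + W
  K≤W = ℤ.+≤+ (ℕ.m+n≤o⇒m≤o K K+n≤W)
  lemma₁ : ∀ K W k → ℤ.- K ℤ.- (ℤ.- (1ℤ ℤ.+ W) ℤ.- k) ≡ W ℤ.+ (1ℤ ℤ.+ k) ℤ.- (K ℤ.+ 0ℤ)
  lemma₁ = ℤ-Solver.solve-∀
  lemma₂ : ∀ K W k → W ℤ.- k ℤ.- K ≡ W ℤ.- (K ℤ.+ k)
  lemma₂ = ℤ-Solver.solve-∀
  lemma₃ : ∀ s n → s ℤ.- (s ℤ.+ n ℤ.* (1ℤ ℤ.- 0ℤ)) ≡ ℤ.- n
  lemma₃ = ℤ-Solver.solve-∀

-- Pairs of a zero and a one of the word at a given distance.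

-- The part of 2 × (the multiplicity of m) that does not depend on the
-- partition; k stands for g - m.
correction : ℕ → ℤ → ℤ
correction W (+ zero)    = 0ℤ
correction W (+ suc n)   = ℤ.- + suc n ℤ.+ (⅀[ x ∈ window W ] (𝟙 (x ℤ.≟ + suc n) ℤ.+ 𝟙 (x ℤ.+ x ℤ.≟ + suc n)))
correction W -[1+ n ]    = 0ℤ

module Counting
  (χ : ℤ → ℤ) {K : ℕ} (0<K : 0 ℕ.< K)
  (χ-above : ∀ z → + K ℤ.≤ z → χ z ≡ 0ℤ) (χ-below : ∀ z → z ℤ.≤ ℤ.- + K → χ z ≡ 1ℤ)
  (χ-idem : ∀ z → χ z ℤ.* χ z ≡ χ z)
  (χ-zero : χ 0ℤ ≡ 0ℤ) (χ-reflect : ∀ z → z ≢ 0ℤ → χ (ℤ.- z) ≡ 1ℤ ℤ.- χ z)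
  (W : ℕ) where

  χ̄ : ℤ → ℤ
  χ̄ z = 1ℤ ℤ.- χ z

  -- With `y = x - c`, the test `c ≤ x + x` reads `0 ≤ x + y`. The indicators in `diagonal` stand
  -- for `y = 0` and `x + y = 0`; in both cases `χ x = 1` already forces `χ̄ y = 1`, so that factor
  -- is left out.
  pairs pairs⁺ pairs⁻ diagonal : ℤ → ℤ
  pairs    c = ⅀[ x ∈ window W ] χ x ℤ.* χ̄ (x ℤ.- c)
  pairs⁺   c = ⅀[ x ∈ window W ] χ x ℤ.* χ̄ (x ℤ.- c) ℤ.* 𝟙 (c ℤ.≤? x ℤ.+ x)
  pairs⁻   c = ⅀[ x ∈ window W ] χ x ℤ.* χ̄ (x ℤ.- c) ℤ.* 𝟙 (x ℤ.+ x ℤ.<? c)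
  diagonal c = ⅀[ x ∈ window W ] χ x ℤ.* (𝟙 (x ℤ.≟ c) ℤ.+ 𝟙 (x ℤ.+ x ℤ.≟ c))

  χ̄-below : ∀ z → z ℤ.≤ ℤ.- + K → χ̄ z ≡ 0ℤ
  χ̄-below z z≤ = cong (ℤ._-_ 1ℤ) (χ-below z z≤)

  pairs-split : ∀ c → pairs c ≡ pairs⁺ c ℤ.+ pairs⁻ c
  pairs-split c = trans (⅀-ext (window W) pointwise) (⅀-+ (window W) _ _)
    where
    lemma₁ : ∀ a → a ≡ a ℤ.* 1ℤ ℤ.+ a ℤ.* 0ℤ
    lemma₁ = ℤ-Solver.solve-∀
    lemma₂ : ∀ a → a ≡ a ℤ.* 0ℤ ℤ.+ a ℤ.* 1ℤ
    lemma₂ = ℤ-Solver.solve-∀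
    pointwise : ∀ x → χ x ℤ.* χ̄ (x ℤ.- c) ≡
      χ x ℤ.* χ̄ (x ℤ.- c) ℤ.* 𝟙 (c ℤ.≤? x ℤ.+ x) ℤ.+ χ x ℤ.* χ̄ (x ℤ.- c) ℤ.* 𝟙 (x ℤ.+ x ℤ.<? c)
    pointwise x with c ℤ.≤? x ℤ.+ x
    ... | yes c≤ rewrite 𝟙-no (x ℤ.+ x ℤ.<? c) (ℤ.≤⇒≯ c≤) = lemma₁ _
    ... | no  c≰ rewrite 𝟙-yes (x ℤ.+ x ℤ.<? c) (ℤ.≰⇒> c≰) = lemma₂ _

  -- The reflection (x , y) ↦ (-y , -x) exchanges the two kinds of pairs
  -- except for those with y = 0 or x + y = 0.
  pairs⁺≡pairs⁻+diagonal : ∀ n → 0 ℕ.< n → K ℕ.+ n ℕ.+ n ℕ.≤ W →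
    pairs⁺ (+ n) ≡ pairs⁻ (+ n) ℤ.+ diagonal (+ n)
  pairs⁺≡pairs⁻+diagonal n 0<n bound = begin
    pairs⁺ c                                                 ≡⟨ ⅀-ext (window W) pointwise ⟩
    ⅀[ x ∈ window W ] (F (ℤ.- (x ℤ.- c)) ℤ.+ E x)            ≡⟨ ⅀-+ (window W) _ E ⟩
    (⅀[ x ∈ window W ] F (ℤ.- (x ℤ.- c))) ℤ.+ diagonal c     ≡⟨ cong (ℤ._+ diagonal c)
      (⅀-shift⁻ (F ∘ ℤ.-_) support n bound) ⟩
    (⅀[ x ∈ window W ] F (ℤ.- x)) ℤ.+ diagonal c             ≡⟨ cong (ℤ._+ diagonal c) (⅀-reflect F W) ⟩
    pairs⁻ c ℤ.+ diagonal c                                  ∎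
    where
    open ≡-Reasoning
    c : ℤ
    c = + n
    F E : ℤ → ℤ
    F x = χ x ℤ.* χ̄ (x ℤ.- c) ℤ.* 𝟙 (x ℤ.+ x ℤ.<? c)
    E x = χ x ℤ.* (𝟙 (x ℤ.≟ c) ℤ.+ 𝟙 (x ℤ.+ x ℤ.≟ c))
    0<c : 0ℤ ℤ.< c
    0<c = ℤ.+<+ 0<n

    above-shift : ∀ K c z → ℤ.- K ℤ.- (ℤ.- z ℤ.- c) ≡ z ℤ.+ (c ℤ.+ c) ℤ.- (K ℤ.+ c ℤ.+ 0ℤ)
    above-shift = ℤ-Solver.solve-∀
    below-shift : ∀ K c z → ℤ.- z ℤ.- K ≡ ℤ.- (K ℤ.+ c) ℤ.+ c ℤ.- (z ℤ.+ 0ℤ)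
    below-shift = ℤ-Solver.solve-∀
    zero-middle : ∀ a b → a ℤ.* 0ℤ ℤ.* b ≡ 0ℤ
    zero-middle = ℤ-Solver.solve-∀

    support : Supported (K ℕ.+ n) (F ∘ ℤ.-_)
    support z (above ≤z) rewrite χ̄-below (ℤ.- z ℤ.- c)
      (≤-by (ℤ.+-mono-≤ ≤z (ℤ.+≤+ (z≤n {n ℕ.+ n}))) (above-shift (+ K) c z)) = zero-middle (χ (ℤ.- z)) _
    support z (below z≤) rewrite χ-above (ℤ.- z)
      (≤-by (ℤ.+-mono-≤ z≤ (ℤ.+≤+ (z≤n {n}))) (below-shift (+ K) c z)) = refl

    flip₁ : ∀ x c → c ℤ.- (ℤ.- (x ℤ.- c) ℤ.+ ℤ.- (x ℤ.- c)) ≡ x ℤ.+ x ℤ.- c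
    flip₁ = ℤ-Solver.solve-∀
    double : ∀ c → c ℤ.+ c ℤ.- c ≡ c ℤ.- 0ℤ
    double = ℤ-Solver.solve-∀
    negate : ∀ x c → ℤ.- (x ℤ.- c) ℤ.- c ≡ ℤ.- x
    negate = ℤ-Solver.solve-∀

    cancel : ∀ x → x ℤ.- (x ℤ.+ x) ≡ ℤ.- x
    cancel = ℤ-Solver.solve-∀

    flipped : ∀ x → 𝟙 (ℤ.- (x ℤ.- c) ℤ.+ ℤ.- (x ℤ.- c) ℤ.<? c) ≡ 𝟙 (c ℤ.<? x ℤ.+ x)
    flipped x = 𝟙-⇔ (_ ℤ.<? _) (_ ℤ.<? _) (λ p → <-by p (sym (flip₁ x c))) (λ p → <-by p (flip₁ x c))

    pointwise : ∀ x → χ x ℤ.* χ̄ (x ℤ.- c) ℤ.* 𝟙 (c ℤ.≤? x ℤ.+ x) ≡ F (ℤ.- (x ℤ.- c)) ℤ.+ E x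
    pointwise x rewrite negate x c | flipped x with x ℤ.≟ 0ℤ | x ℤ.≟ c
    ... | yes refl | _ rewrite χ-zero | 𝟙-no (c ℤ.<? 0ℤ) (ℤ.<-asym 0<c) = lemma (χ (ℤ.- (0ℤ ℤ.- c)))
      where
      lemma : ∀ a → 0ℤ ≡ a ℤ.* (1ℤ ℤ.- 0ℤ) ℤ.* 0ℤ ℤ.+ 0ℤ
      lemma = ℤ-Solver.solve-∀
    ... | no _ | yes refl rewrite ℤ.+-inverseʳ c | χ-zero
        | 𝟙-yes (c ℤ.≤? c ℤ.+ c) (≤-by (ℤ.<⇒≤ 0<c) (double c))
        | 𝟙-no (c ℤ.+ c ℤ.≟ c) (λ e → ℤ.<-irrefl (sym e) (<-by 0<c (double c))) = lemma (χ c)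
      where
      lemma : ∀ a → a ℤ.* (1ℤ ℤ.- 0ℤ) ℤ.* 1ℤ ≡ 0ℤ ℤ.+ a ℤ.* (1ℤ ℤ.+ 0ℤ)
      lemma = ℤ-Solver.solve-∀
    ... | no x≢0 | no x≢c rewrite χ-reflect (x ℤ.- c) (x≢c ∘ ℤ.i-j≡0⇒i≡j x c) | χ-reflect x x≢0
      with ℤ.<-cmp c (x ℤ.+ x)
    ... | tri< c< ¬≡ _ rewrite 𝟙-yes (c ℤ.≤? x ℤ.+ x) (ℤ.<⇒≤ c<) | 𝟙-yes (c ℤ.<? x ℤ.+ x) c<
        | 𝟙-no (x ℤ.+ x ℤ.≟ c) (¬≡ ∘ sym) = lemma (χ x) (χ (x ℤ.- c))
      where
      lemma : ∀ a b → a ℤ.* (1ℤ ℤ.- b) ℤ.* 1ℤ ≡ (1ℤ ℤ.- b) ℤ.* (1ℤ ℤ.- (1ℤ ℤ.- a)) ℤ.* 1ℤ ℤ.+ a ℤ.* (0ℤ ℤ.+ 0ℤ)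
      lemma = ℤ-Solver.solve-∀
    -- A fixed point of the reflection: the non-strict test of `pairs⁺` counts it, the strict one of
    -- `pairs⁻` does not.
    ... | tri≈ ¬< c≡ _ rewrite 𝟙-yes (c ℤ.≤? x ℤ.+ x) (ℤ.≤-reflexive c≡) | 𝟙-no (c ℤ.<? x ℤ.+ x) ¬<
        | 𝟙-yes (x ℤ.+ x ℤ.≟ c) (sym c≡) | trans (cong (ℤ._-_ x) c≡) (cancel x) | χ-reflect x x≢0 =
      trans (lemma (χ x)) (trans (χ-idem x) (lemma′ (χ x)))
      where
      lemma : ∀ a → a ℤ.* (1ℤ ℤ.- (1ℤ ℤ.- a)) ℤ.* 1ℤ ≡ a ℤ.* a
      lemma = ℤ-Solver.solve-∀
      lemma′ : ∀ a → a ≡ (1ℤ ℤ.- (1ℤ ℤ.- a)) ℤ.* (1ℤ ℤ.- (1ℤ ℤ.- a)) ℤ.* 0ℤ ℤ.+ a ℤ.* (0ℤ ℤ.+ 1ℤ)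
      lemma′ = ℤ-Solver.solve-∀
    ... | tri> ¬< ¬≡ >c rewrite 𝟙-no (c ℤ.≤? x ℤ.+ x) (ℤ.<⇒≱ >c) | 𝟙-no (c ℤ.<? x ℤ.+ x) ¬<
        | 𝟙-no (x ℤ.+ x ℤ.≟ c) (¬≡ ∘ sym) = lemma (χ x) (χ (x ℤ.- c))
      where
      lemma : ∀ a b → a ℤ.* (1ℤ ℤ.- b) ℤ.* 0ℤ ≡ (1ℤ ℤ.- b) ℤ.* (1ℤ ℤ.- (1ℤ ℤ.- a)) ℤ.* 0ℤ ℤ.+ a ℤ.* (0ℤ ℤ.+ 0ℤ)
      lemma = ℤ-Solver.solve-∀

  -∣c∣≤c : ∀ c → ℤ.- + ∣ c ∣ ℤ.≤ c
  -∣c∣≤c (+ n)    = ℤ.neg-≤-pos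
  -∣c∣≤c -[1+ n ] = ℤ.≤-refl

  above-K : ∀ {z} c → + (K ℕ.+ ∣ c ∣) ℤ.≤ z → + K ℤ.≤ z
  above-K c = ℤ.≤-trans (ℤ.+≤+ (ℕ.m≤m+n K ∣ c ∣))

  private
    rearrange : ∀ K d c z → ℤ.- K ℤ.- (z ℤ.- c) ≡ ℤ.- (K ℤ.+ d) ℤ.+ c ℤ.- (z ℤ.+ ℤ.- d)
    rearrange = ℤ-Solver.solve-∀

  -- Far above the factor `χ` vanishes, far below the factor `χ̄`. This makes the sum finite
  -- although `χ` itself has infinite support.
  pairs-support : ∀ c → Supported (K ℕ.+ ∣ c ∣) (λ x → χ x ℤ.* χ̄ (x ℤ.- c))
  pairs-support c z (above ≤z) rewrite χ-above z (above-K c ≤z) = refl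
  pairs-support c z (below z≤) rewrite χ̄-below (z ℤ.- c)
    (≤-by (ℤ.+-mono-≤ z≤ (-∣c∣≤c c)) (rearrange (+ K) (+ ∣ c ∣) c z)) = ℤ.*-zeroʳ (χ z)

  diagonal-support : ∀ c → Supported (K ℕ.+ ∣ c ∣) (λ x → χ x ℤ.* (𝟙 (x ℤ.≟ c) ℤ.+ 𝟙 (x ℤ.+ x ℤ.≟ c)))
  diagonal-support c z (above ≤z) rewrite χ-above z (above-K c ≤z) = refl
  diagonal-support c z (below z≤) =
    trans (cong (ℤ._*_ (χ z)) (cong₂ ℤ._+_ (𝟙-no (z ℤ.≟ c) (λ e → ℤ.<-irrefl e z<c))
                                           (𝟙-no (z ℤ.+ z ℤ.≟ c) (λ e → ℤ.<-irrefl e (ℤ.≤-<-trans z+z≤z z<c)))))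
          (ℤ.*-zeroʳ (χ z))
    where
    lemma₁ : ∀ K d c z → c ℤ.- z ≡ (ℤ.- (K ℤ.+ d) ℤ.+ c ℤ.+ K) ℤ.- (z ℤ.+ ℤ.- d ℤ.+ 0ℤ)
    lemma₁ = ℤ-Solver.solve-∀
    lemma₂ : ∀ z → z ℤ.- (z ℤ.+ z) ≡ 0ℤ ℤ.- z
    lemma₂ = ℤ-Solver.solve-∀
    z<c : z ℤ.< c
    z<c = <-by (ℤ.+-mono-≤-< (ℤ.+-mono-≤ z≤ (-∣c∣≤c c)) (ℤ.+<+ 0<K)) (lemma₁ (+ K) (+ ∣ c ∣) c z)
    z+z≤z : z ℤ.+ z ℤ.≤ z
    z+z≤z = ≤-by (ℤ.≤-trans z≤ ℤ.neg-≤-pos) (lemma₂ z)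

  -- Exchanging the two positions turns `χ x * (1 - χ y)` into `χ y * (1 - χ x)`. These differ by
  -- `χ x - χ y`, whose sum is the charge.
  pairs-neg : ∀ n → K ℕ.+ n ℕ.+ n ℕ.≤ W → pairs (+ n) ≡ pairs (ℤ.- + n) ℤ.- + n
  pairs-neg n bound = begin
    pairs c                                                      ≡⟨ ⅀-ext (window W) pointwise ⟩
    ⅀[ x ∈ window W ] (F (x ℤ.- c) ℤ.+ (χ x ℤ.- χ (x ℤ.- c)))    ≡⟨ ⅀-+ (window W) _ _ ⟩
    (⅀[ x ∈ window W ] F (x ℤ.- c)) ℤ.+ _                        ≡⟨ cong₂ ℤ._+_
      (⅀-shift⁻ F support n bound)
      (⅀-charge χ χ-above χ-below n (ℕ.≤-trans (ℕ.m≤m+n _ n) bound)) ⟩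
    pairs (ℤ.- c) ℤ.- c                                          ∎
    where
    open ≡-Reasoning
    c : ℤ
    c = + n
    F : ℤ → ℤ
    F x = χ x ℤ.* χ̄ (x ℤ.- ℤ.- c)
    support : Supported (K ℕ.+ n) F
    support = subst (λ d → Supported (K ℕ.+ d) F) (ℤ.∣-i∣≡∣i∣ c) (pairs-support (ℤ.- c))
    cancel : ∀ x c → x ℤ.- c ℤ.- ℤ.- c ≡ x
    cancel = ℤ-Solver.solve-∀
    lemma : ∀ a b → a ℤ.* (1ℤ ℤ.- b) ≡ b ℤ.* (1ℤ ℤ.- a) ℤ.+ (a ℤ.- b)
    lemma = ℤ-Solver.solve-∀
    pointwise : ∀ x → χ x ℤ.* χ̄ (x ℤ.- c) ≡ F (x ℤ.- c) ℤ.+ (χ x ℤ.- χ (x ℤ.- c))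
    pointwise x rewrite cancel x c = lemma (χ x) (χ (x ℤ.- c))

  -- After reflecting the second sum, `χ x` and `χ (- x) = 1 - χ x` add up to 1, so the dependence
  -- on the partition disappears. The exceptional `x = 0` is not hit because `n > 0`.
  diagonal-neg : ∀ n → 0 ℕ.< n →
    diagonal (+ n) ℤ.+ diagonal (ℤ.- + n) ≡ ⅀[ x ∈ window W ] (𝟙 (x ℤ.≟ + n) ℤ.+ 𝟙 (x ℤ.+ x ℤ.≟ + n))
  diagonal-neg n 0<n = begin
    diagonal c ℤ.+ diagonal (ℤ.- c)                     ≡⟨ cong (ℤ._+_ (diagonal c)) (⅀-reflect E W) ⟨
    diagonal c ℤ.+ (⅀[ x ∈ window W ] E (ℤ.- x))        ≡⟨ ⅀-+ (window W) _ (E ∘ ℤ.-_) ⟨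
    ⅀[ x ∈ window W ] (χ x ℤ.* I x ℤ.+ E (ℤ.- x))       ≡⟨ ⅀-ext (window W) pointwise ⟩
    ⅀ (window W) I                                      ∎
    where
    open ≡-Reasoning
    c : ℤ
    c = + n
    I E : ℤ → ℤ
    I x = 𝟙 (x ℤ.≟ c) ℤ.+ 𝟙 (x ℤ.+ x ℤ.≟ c)
    E x = χ x ℤ.* (𝟙 (x ℤ.≟ ℤ.- c) ℤ.+ 𝟙 (x ℤ.+ x ℤ.≟ ℤ.- c))
    0≢c : 0ℤ ≢ c
    0≢c e = ℤ.<-irrefl e (ℤ.+<+ 0<n)
    neg² : ∀ x → ℤ.- x ℤ.+ ℤ.- x ≡ ℤ.- (x ℤ.+ x)
    neg² = ℤ-Solver.solve-∀
    lemma : ∀ a i → a ℤ.* i ℤ.+ (1ℤ ℤ.- a) ℤ.* i ≡ i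
    lemma = ℤ-Solver.solve-∀
    flip₁ : ∀ x → 𝟙 (ℤ.- x ℤ.≟ ℤ.- c) ≡ 𝟙 (x ℤ.≟ c)
    flip₁ x = 𝟙-⇔ (_ ℤ.≟ _) (_ ℤ.≟ _) ℤ.neg-injective (cong (λ i → ℤ.- i))
    flip₂ : ∀ x → 𝟙 (ℤ.- x ℤ.+ ℤ.- x ℤ.≟ ℤ.- c) ≡ 𝟙 (x ℤ.+ x ℤ.≟ c)
    flip₂ x = 𝟙-⇔ (_ ℤ.≟ _) (_ ℤ.≟ _) (λ e → ℤ.neg-injective (trans (sym (neg² x)) e)) (λ e → trans (neg² x) (cong (λ i → ℤ.- i) e))
    pointwise : ∀ x → χ x ℤ.* I x ℤ.+ E (ℤ.- x) ≡ I x
    pointwise x with x ℤ.≟ 0ℤ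
    ... | yes refl rewrite χ-zero | 𝟙-no (0ℤ ℤ.≟ c) 0≢c = refl
    ... | no  x≢0  rewrite flip₁ x | flip₂ x | χ-reflect x x≢0 = lemma (χ x) (I x)

  diagonal-zero : diagonal 0ℤ ≡ 0ℤ
  diagonal-zero = ⅀-zero (window W) λ {x} _ → pointwise x
    where
    twice : ∀ x → x ℤ.+ x ≡ + 2 ℤ.* x
    twice = ℤ-Solver.solve-∀
    x+x≢0 : ∀ {x} → x ≢ 0ℤ → x ℤ.+ x ≢ 0ℤ
    x+x≢0 {x} x≢0 e = x≢0 (ℤ.*-cancelˡ-≡ (+ 2) x 0ℤ (trans (sym (twice x)) e))
    pointwise : ∀ x → χ x ℤ.* (𝟙 (x ℤ.≟ 0ℤ) ℤ.+ 𝟙 (x ℤ.+ x ℤ.≟ 0ℤ)) ≡ 0ℤ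
    pointwise x with x ℤ.≟ 0ℤ
    ... | yes refl rewrite χ-zero = refl
    ... | no  x≢0  rewrite 𝟙-no (x ℤ.+ x ℤ.≟ 0ℤ) (x+x≢0 x≢0) = ℤ.*-zeroʳ (χ x)

  pairs-zero : pairs 0ℤ ≡ 0ℤ
  pairs-zero = ⅀-zero (window W) λ {x} _ → pointwise x
    where
    lemma : ∀ a → a ℤ.* (1ℤ ℤ.- a) ≡ a ℤ.- a ℤ.* a
    lemma = ℤ-Solver.solve-∀
    pointwise : ∀ x → χ x ℤ.* χ̄ (x ℤ.- 0ℤ) ≡ 0ℤ
    pointwise x rewrite ℤ.+-identityʳ x =
      trans (lemma (χ x)) (trans (cong (ℤ._-_ (χ x)) (χ-idem x)) (ℤ.+-inverseʳ (χ x)))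

  D : ℕ → ℤ → ℤ
  D g z = χ (z ℤ.- + g) ℤ.- χ z

  -- Summation by parts.
  pairs-second-difference : ∀ (c : ℤ) g → K ℕ.+ ∣ c ∣ ℕ.+ g ℕ.+ g ℕ.≤ W →
    pairs (c ℤ.+ + g) ℤ.+ pairs (c ℤ.- + g) ℤ.- (pairs c ℤ.+ pairs c) ≡
    ⅀[ x ∈ window W ] D g x ℤ.* D g (x ℤ.- c)
  pairs-second-difference c g bound = begin
    pairs (c ℤ.+ + g) ℤ.+ pairs (c ℤ.- + g) ℤ.- (pairs c ℤ.+ pairs c)
      ≡⟨ cong₂ (λ s t → pairs (c ℤ.+ + g) ℤ.+ s ℤ.- (pairs c ℤ.+ t))
         (⅀-shift⁻ (F (c ℤ.- + g)) (support (c ℤ.- + g) ∣c-g∣≤) g bound)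
         (⅀-shift⁻ (F c) (support c (ℕ.m≤m+n ∣ c ∣ g)) g bound) ⟨
    pairs (c ℤ.+ + g) ℤ.+ (⅀[ x ∈ window W ] F (c ℤ.- + g) (x ℤ.- + g)) ℤ.-
      (pairs c ℤ.+ (⅀[ x ∈ window W ] F c (x ℤ.- + g)))
      ≡⟨ cong₂ ℤ._-_ (⅀-+ (window W) _ _) (⅀-+ (window W) _ _) ⟨
    (⅀[ x ∈ window W ] (F (c ℤ.+ + g) x ℤ.+ F (c ℤ.- + g) (x ℤ.- + g))) ℤ.-
      (⅀[ x ∈ window W ] (F c x ℤ.+ F c (x ℤ.- + g)))
      ≡⟨ ⅀-- (window W) _ _ ⟨
    ⅀[ x ∈ window W ] (F (c ℤ.+ + g) x ℤ.+ F (c ℤ.- + g) (x ℤ.- + g) ℤ.- (F c x ℤ.+ F c (x ℤ.- + g)))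
      ≡⟨ ⅀-ext (window W) pointwise ⟩
    ⅀[ x ∈ window W ] D g x ℤ.* D g (x ℤ.- c) ∎
    where
    open ≡-Reasoning
    F : ℤ → ℤ → ℤ
    F c x = χ x ℤ.* χ̄ (x ℤ.- c)
    ∣c-g∣≤ : ∣ c ℤ.- + g ∣ ℕ.≤ ∣ c ∣ ℕ.+ g
    ∣c-g∣≤ = ℤ.∣i-j∣≤∣i∣+∣j∣ c (+ g)
    support : ∀ d → ∣ d ∣ ℕ.≤ ∣ c ∣ ℕ.+ g → Supported (K ℕ.+ ∣ c ∣ ℕ.+ g) (F d)
    support d ∣d∣≤ = Supported-≤ (subst (K ℕ.+ ∣ d ∣ ℕ.≤_) (sym (ℕ.+-assoc K _ g)) (ℕ.+-monoʳ-≤ K ∣d∣≤)) (pairs-support d)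
    e₁ : ∀ x c g → x ℤ.- (c ℤ.+ g) ≡ x ℤ.- c ℤ.- g
    e₁ = ℤ-Solver.solve-∀
    e₂ : ∀ x c g → x ℤ.- g ℤ.- (c ℤ.- g) ≡ x ℤ.- c
    e₂ = ℤ-Solver.solve-∀
    e₃ : ∀ x c g → x ℤ.- g ℤ.- c ≡ x ℤ.- c ℤ.- g
    e₃ = ℤ-Solver.solve-∀
    lemma : ∀ a a′ b b′ → a ℤ.* (1ℤ ℤ.- b′) ℤ.+ a′ ℤ.* (1ℤ ℤ.- b) ℤ.- (a ℤ.* (1ℤ ℤ.- b) ℤ.+ a′ ℤ.* (1ℤ ℤ.- b′)) ≡
      (a′ ℤ.- a) ℤ.* (b′ ℤ.- b)
    lemma = ℤ-Solver.solve-∀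
    pointwise : ∀ x → F (c ℤ.+ + g) x ℤ.+ F (c ℤ.- + g) (x ℤ.- + g) ℤ.- (F c x ℤ.+ F c (x ℤ.- + g)) ≡
      D g x ℤ.* D g (x ℤ.- c)
    pointwise x rewrite e₁ x c (+ g) | e₂ x c (+ g) | e₃ x c (+ g) =
      lemma (χ x) (χ (x ℤ.- + g)) (χ (x ℤ.- c)) (χ (x ℤ.- c ℤ.- + g))

  -- After a shift by `g` in the first sum, both terms with `x + x` carry the condition
  -- `x + x = c + g` and combine into `D g`. The others give `χ (c - g) - χ (c + g)`, a difference
  -- with step `2g`; adding and subtracting `χ c`, which is the sum of `G`, splits it into
  -- `D g c + D g (c + g)`.
  diagonal-difference : ∀ (c : ℤ) g → K ℕ.+ ∣ c ∣ ℕ.+ g ℕ.+ g ℕ.≤ W →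
    diagonal (c ℤ.- + g) ℤ.- diagonal (c ℤ.+ + g) ≡
    ⅀[ x ∈ window W ] D g x ℤ.* (𝟙 (x ℤ.≟ c) ℤ.+ 𝟙 (x ℤ.≟ c ℤ.+ + g) ℤ.+ 𝟙 (x ℤ.+ x ℤ.≟ c ℤ.+ + g))
  diagonal-difference c g bound = begin
    diagonal (c ℤ.- + g) ℤ.- diagonal (c ℤ.+ + g)
      ≡⟨ add-cancel (diagonal (c ℤ.- + g)) (diagonal (c ℤ.+ + g)) (⅀ (window W) G) ⟩
    diagonal (c ℤ.- + g) ℤ.+ ⅀ (window W) G ℤ.- (diagonal (c ℤ.+ + g) ℤ.+ ⅀ (window W) G)
      ≡⟨ cong₂ (λ s t → s ℤ.+ t ℤ.- (diagonal (c ℤ.+ + g) ℤ.+ ⅀ (window W) G))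
         (⅀-shift⁻ (E (c ℤ.- + g)) (Supported-≤ (wide (c ℤ.- + g) ∣c-g∣≤) (diagonal-support (c ℤ.- + g))) g bound)
         (⅀-shift⁻ G (Supported-≤ (wide c (ℕ.m≤m+n ∣ c ∣ g)) G-support) g bound) ⟨
    (⅀[ x ∈ window W ] E (c ℤ.- + g) (x ℤ.- + g)) ℤ.+ (⅀[ x ∈ window W ] G (x ℤ.- + g)) ℤ.-
      (diagonal (c ℤ.+ + g) ℤ.+ ⅀ (window W) G)
      ≡⟨ cong₂ ℤ._-_ (⅀-+ (window W) _ _) (⅀-+ (window W) _ _) ⟨
    (⅀[ x ∈ window W ] (E (c ℤ.- + g) (x ℤ.- + g) ℤ.+ G (x ℤ.- + g))) ℤ.-
      (⅀[ x ∈ window W ] (E (c ℤ.+ + g) x ℤ.+ G x))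
      ≡⟨ ⅀-- (window W) _ _ ⟨
    ⅀[ x ∈ window W ] (E (c ℤ.- + g) (x ℤ.- + g) ℤ.+ G (x ℤ.- + g) ℤ.- (E (c ℤ.+ + g) x ℤ.+ G x))
      ≡⟨ ⅀-ext (window W) pointwise ⟩
    ⅀[ x ∈ window W ] D g x ℤ.* (𝟙 (x ℤ.≟ c) ℤ.+ 𝟙 (x ℤ.≟ c ℤ.+ + g) ℤ.+ 𝟙 (x ℤ.+ x ℤ.≟ c ℤ.+ + g)) ∎
    where
    open ≡-Reasoning
    E : ℤ → ℤ → ℤ
    E c x = χ x ℤ.* (𝟙 (x ℤ.≟ c) ℤ.+ 𝟙 (x ℤ.+ x ℤ.≟ c))
    G : ℤ → ℤ
    G x = χ x ℤ.* 𝟙 (x ℤ.≟ c)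
    add-cancel : ∀ a b s → a ℤ.- b ≡ a ℤ.+ s ℤ.- (b ℤ.+ s)
    add-cancel = ℤ-Solver.solve-∀
    ∣c-g∣≤ : ∣ c ℤ.- + g ∣ ℕ.≤ ∣ c ∣ ℕ.+ g
    ∣c-g∣≤ = ℤ.∣i-j∣≤∣i∣+∣j∣ c (+ g)
    wide : ∀ d → ∣ d ∣ ℕ.≤ ∣ c ∣ ℕ.+ g → K ℕ.+ ∣ d ∣ ℕ.≤ K ℕ.+ ∣ c ∣ ℕ.+ g
    wide d ∣d∣≤ = subst (K ℕ.+ ∣ d ∣ ℕ.≤_) (sym (ℕ.+-assoc K _ g)) (ℕ.+-monoʳ-≤ K ∣d∣≤)
    G-support : Supported (K ℕ.+ ∣ c ∣) G
    G-support z far with z ℤ.≟ c | diagonal-support c z far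
    ... | no  _ | _ = ℤ.*-zeroʳ (χ z)
    ... | yes _ | e with z ℤ.+ z ℤ.≟ c
    ...   | no  _ = e
    ...   | yes _ = trans (ℤ.*-identityʳ (χ z)) (ℤ.*-cancelʳ-≡ (χ z) 0ℤ (+ 2) e)
    move₁ : ∀ x → 𝟙 (x ℤ.- + g ℤ.≟ c ℤ.- + g) ≡ 𝟙 (x ℤ.≟ c)
    move₁ x = 𝟙-⇔ (_ ℤ.≟ _) (_ ℤ.≟ _) (ℤ-Group.∙-cancelʳ (ℤ.- + g) x c) (cong (ℤ._- + g))
    move₂ : ∀ x → 𝟙 (x ℤ.- + g ℤ.+ (x ℤ.- + g) ℤ.≟ c ℤ.- + g) ≡ 𝟙 (x ℤ.+ x ℤ.≟ c ℤ.+ + g)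
    move₂ x = 𝟙-⇔ (_ ℤ.≟ _) (_ ℤ.≟ _)
      (λ e → trans (there₁ x (+ g)) (trans (cong (λ s → s ℤ.+ (+ g ℤ.+ + g)) e) (there₂ c (+ g))))
      (λ e → trans (back₁ x (+ g)) (trans (cong (ℤ._- (+ g ℤ.+ + g)) e) (back₂ c (+ g))))
      where
      there₁ : ∀ x g → x ℤ.+ x ≡ x ℤ.- g ℤ.+ (x ℤ.- g) ℤ.+ (g ℤ.+ g)
      there₁ = ℤ-Solver.solve-∀
      there₂ : ∀ c g → c ℤ.- g ℤ.+ (g ℤ.+ g) ≡ c ℤ.+ g
      there₂ = ℤ-Solver.solve-∀
      back₁ : ∀ x g → x ℤ.- g ℤ.+ (x ℤ.- g) ≡ x ℤ.+ x ℤ.- (g ℤ.+ g)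
      back₁ = ℤ-Solver.solve-∀
      back₂ : ∀ c g → c ℤ.+ g ℤ.- (g ℤ.+ g) ≡ c ℤ.- g
      back₂ = ℤ-Solver.solve-∀
    move₃ : ∀ x → 𝟙 (x ℤ.- + g ℤ.≟ c) ≡ 𝟙 (x ℤ.≟ c ℤ.+ + g)
    move₃ x = 𝟙-⇔ (_ ℤ.≟ _) (_ ℤ.≟ _)
      (λ e → trans (there₁ x (+ g)) (cong (λ s → s ℤ.+ + g) e)) (λ e → trans (cong (ℤ._- + g) e) (back₁ c (+ g)))
      where
      there₁ : ∀ x g → x ≡ x ℤ.- g ℤ.+ g
      there₁ = ℤ-Solver.solve-∀
      back₁ : ∀ c g → c ℤ.+ g ℤ.- g ≡ c
      back₁ = ℤ-Solver.solve-∀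
    lemma : ∀ a a′ i j k → a′ ℤ.* (i ℤ.+ j) ℤ.+ a′ ℤ.* k ℤ.- (a ℤ.* (k ℤ.+ j) ℤ.+ a ℤ.* i) ≡
      (a′ ℤ.- a) ℤ.* (i ℤ.+ k ℤ.+ j)
    lemma = ℤ-Solver.solve-∀
    pointwise : ∀ x → E (c ℤ.- + g) (x ℤ.- + g) ℤ.+ G (x ℤ.- + g) ℤ.- (E (c ℤ.+ + g) x ℤ.+ G x) ≡
      D g x ℤ.* (𝟙 (x ℤ.≟ c) ℤ.+ 𝟙 (x ℤ.≟ c ℤ.+ + g) ℤ.+ 𝟙 (x ℤ.+ x ℤ.≟ c ℤ.+ + g))
    pointwise x rewrite move₁ x | move₂ x | move₃ x =
      lemma (χ x) (χ (x ℤ.- + g)) (𝟙 (x ℤ.≟ c)) (𝟙 (x ℤ.+ x ℤ.≟ c ℤ.+ + g)) (𝟙 (x ℤ.≟ c ℤ.+ + g))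

  -- `P⁺` and `P⁻` stand for the numbers of hooks of each kind. Unlike `pairs⁺` and `pairs⁻` they
  -- vanish at nonpositive arguments and do not refer to a window.
  module _ (P⁺ P⁻ : ℤ → ℤ) (bound : ℕ)
    (P⁺≡0 : ∀ z → z ℤ.≤ 0ℤ → P⁺ z ≡ 0ℤ) (P⁻≡0 : ∀ z → z ℤ.≤ 0ℤ → P⁻ z ≡ 0ℤ)
    (P⁺≡pairs⁺ : ∀ n → 0 ℕ.< n → n ℕ.≤ bound → P⁺ (+ n) ≡ pairs⁺ (+ n))
    (P⁻≡pairs⁻ : ∀ n → 0 ℕ.< n → n ℕ.≤ bound → P⁻ (+ n) ≡ pairs⁻ (+ n))
    (bound≤W : K ℕ.+ bound ℕ.+ bound ℕ.≤ W) where

    private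
      ≤W : ∀ {n} → n ℕ.≤ bound → K ℕ.+ n ℕ.+ n ℕ.≤ W
      ≤W n≤ = ℕ.≤-trans (ℕ.+-mono-≤ (ℕ.+-monoʳ-≤ K n≤) n≤) bound≤W

    -- `pairs` is the sum of the two kinds and `diagonal` their difference; hence the factor 2 in
    -- all identities that follow.
    twice-P⁺ : ∀ n → 0 ℕ.< n → n ℕ.≤ bound → P⁺ (+ n) ℤ.+ P⁺ (+ n) ≡ pairs (+ n) ℤ.+ diagonal (+ n)
    twice-P⁺ n 0<n n≤ rewrite P⁺≡pairs⁺ n 0<n n≤ | pairs-split (+ n) =
      trans (cong (ℤ._+_ (pairs⁺ (+ n))) (pairs⁺≡pairs⁻+diagonal n 0<n (≤W n≤)))
            (sym (ℤ.+-assoc (pairs⁺ (+ n)) (pairs⁻ (+ n)) (diagonal (+ n))))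

    twice-P⁻ : ∀ n → 0 ℕ.< n → n ℕ.≤ bound → P⁻ (+ n) ℤ.+ P⁻ (+ n) ≡ pairs (+ n) ℤ.- diagonal (+ n)
    twice-P⁻ n 0<n n≤ rewrite P⁻≡pairs⁻ n 0<n n≤ | pairs-split (+ n) | pairs⁺≡pairs⁻+diagonal n 0<n (≤W n≤) =
      lemma (pairs⁻ (+ n)) (diagonal (+ n))
      where
      lemma : ∀ a d → a ℤ.+ a ≡ a ℤ.+ d ℤ.+ a ℤ.- d
      lemma = ℤ-Solver.solve-∀

    -- According to the sign of `k`, one of `P⁺ k` and `P⁻ (- k)` is zero. For `k < 0` the formula
    -- is `twice-P⁻`. For `k > 0`, passing from `k` to `- k` in `twice-P⁺` costs the charge `- k`
    -- and the sum `diagonal k + diagonal (- k)`; together these are `correction`.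
    P-around-zero : ∀ k → ∣ k ∣ ℕ.≤ bound →
      P⁺ k ℤ.+ P⁺ k ℤ.+ (P⁻ (ℤ.- k) ℤ.+ P⁻ (ℤ.- k)) ≡
      pairs (ℤ.- k) ℤ.- diagonal (ℤ.- k) ℤ.+ correction W k
    P-around-zero (+ zero) _ rewrite P⁺≡0 0ℤ ℤ.≤-refl | P⁻≡0 0ℤ ℤ.≤-refl | pairs-zero | diagonal-zero = refl
    P-around-zero (+ suc n) n≤
      rewrite P⁻≡0 -[1+ n ] ℤ.-≤+ | twice-P⁺ (suc n) (s≤s z≤n) n≤ | pairs-neg (suc n) (≤W n≤)
      | sym (diagonal-neg (suc n) (s≤s z≤n)) =
      lemma (pairs -[1+ n ]) (diagonal (+ suc n)) (diagonal -[1+ n ]) (+ suc n)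
      where
      lemma : ∀ a d d′ n → a ℤ.- n ℤ.+ d ℤ.+ 0ℤ ≡ a ℤ.- d′ ℤ.+ (ℤ.- n ℤ.+ (d ℤ.+ d′))
      lemma = ℤ-Solver.solve-∀
    P-around-zero -[1+ n ] n≤ rewrite P⁺≡0 -[1+ n ] ℤ.-≤+ | twice-P⁻ (suc n) (s≤s z≤n) n≤ =
      lemma (pairs (+ suc n) ℤ.- diagonal (+ suc n))
      where
      lemma : ∀ a → 0ℤ ℤ.+ a ≡ a ℤ.+ 0ℤ
      lemma = ℤ-Solver.solve-∀

    -- The terms `pairs` at `m + g`, `m`, `m - g` occur with weights 1, -2, 1. At `m` the two
    -- diagonals cancel, so only a first difference of `diagonal` with step `2g` is left.
    twice-multiplicity : ∀ m g → 0 ℕ.< m → m ℕ.+ g ℕ.≤ bound →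
      let N = P⁺ (+ m ℤ.+ + g) ℤ.+ P⁻ (+ m ℤ.- + g) ℤ.+ P⁺ (+ g ℤ.- + m) ℤ.- P⁺ (+ m) ℤ.- P⁻ (+ m) in
      N ℤ.+ N ≡
      (⅀[ x ∈ window W ] D g x ℤ.* D g (x ℤ.- + m)) ℤ.-
      (⅀[ x ∈ window W ] D g x ℤ.* (𝟙 (x ℤ.≟ + m) ℤ.+ 𝟙 (x ℤ.≟ + m ℤ.+ + g) ℤ.+ 𝟙 (x ℤ.+ x ℤ.≟ + m ℤ.+ + g)))
      ℤ.+ correction W (+ g ℤ.- + m)
    twice-multiplicity m g 0<m m+g≤ = begin
      _ ≡⟨ regroup (P⁺ (+ m ℤ.+ + g)) (P⁻ (+ m ℤ.- + g)) (P⁺ (+ g ℤ.- + m)) (P⁺ (+ m)) (P⁻ (+ m)) ⟩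
      (P⁺ (+ m ℤ.+ + g) ℤ.+ P⁺ (+ m ℤ.+ + g)) ℤ.+
        (P⁺ (+ g ℤ.- + m) ℤ.+ P⁺ (+ g ℤ.- + m) ℤ.+ (P⁻ (+ m ℤ.- + g) ℤ.+ P⁻ (+ m ℤ.- + g))) ℤ.-
        (P⁺ (+ m) ℤ.+ P⁺ (+ m) ℤ.+ (P⁻ (+ m) ℤ.+ P⁻ (+ m)))
        ≡⟨ cong₂ ℤ._-_ (cong₂ ℤ._+_ (twice-P⁺ (m ℕ.+ g) (ℕ.≤-trans 0<m (ℕ.m≤m+n m g)) m+g≤) around)
                       (cong₂ ℤ._+_ (twice-P⁺ m 0<m m≤) (twice-P⁻ m 0<m m≤)) ⟩
      (pairs (+ m ℤ.+ + g) ℤ.+ diagonal (+ m ℤ.+ + g)) ℤ.+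
        (pairs (+ m ℤ.- + g) ℤ.- diagonal (+ m ℤ.- + g) ℤ.+ C) ℤ.-
        (pairs (+ m) ℤ.+ diagonal (+ m) ℤ.+ (pairs (+ m) ℤ.- diagonal (+ m)))
        ≡⟨ collect (pairs (+ m ℤ.+ + g)) (diagonal (+ m ℤ.+ + g)) (pairs (+ m ℤ.- + g))
                   (diagonal (+ m ℤ.- + g)) C (pairs (+ m)) (diagonal (+ m)) ⟩
      pairs (+ m ℤ.+ + g) ℤ.+ pairs (+ m ℤ.- + g) ℤ.- (pairs (+ m) ℤ.+ pairs (+ m)) ℤ.-
        (diagonal (+ m ℤ.- + g) ℤ.- diagonal (+ m ℤ.+ + g)) ℤ.+ C
        ≡⟨ cong₂ (λ s t → s ℤ.- t ℤ.+ C) (pairs-second-difference (+ m) g wide) (diagonal-difference (+ m) g wide) ⟩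
      _ ∎
      where
      open ≡-Reasoning
      C : ℤ
      C = correction W (+ g ℤ.- + m)
      m≤ : m ℕ.≤ bound
      m≤ = ℕ.≤-trans (ℕ.m≤m+n m g) m+g≤
      wide : K ℕ.+ m ℕ.+ g ℕ.+ g ℕ.≤ W
      wide = ℕ.≤-trans (ℕ.+-mono-≤ (ℕ.≤-reflexive (ℕ.+-assoc K m g)) (ℕ.m≤n+m g m)) (≤W m+g≤)
      around : P⁺ (+ g ℤ.- + m) ℤ.+ P⁺ (+ g ℤ.- + m) ℤ.+ (P⁻ (+ m ℤ.- + g) ℤ.+ P⁻ (+ m ℤ.- + g)) ≡
        pairs (+ m ℤ.- + g) ℤ.- diagonal (+ m ℤ.- + g) ℤ.+ C
      around = subst (λ k → P⁺ (+ g ℤ.- + m) ℤ.+ P⁺ (+ g ℤ.- + m) ℤ.+ (P⁻ k ℤ.+ P⁻ k) ≡ pairs k ℤ.- diagonal k ℤ.+ C)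
        (swap (+ g) (+ m))
        (P-around-zero (+ g ℤ.- + m) (ℕ.≤-trans (ℤ.∣i-j∣≤∣i∣+∣j∣ (+ g) (+ m)) (subst (ℕ._≤ bound) (ℕ.+-comm m g) m+g≤)))
        where
        swap : ∀ g m → ℤ.- (g ℤ.- m) ≡ m ℤ.- g
        swap = ℤ-Solver.solve-∀
      regroup : ∀ a b c d e → a ℤ.+ b ℤ.+ c ℤ.- d ℤ.- e ℤ.+ (a ℤ.+ b ℤ.+ c ℤ.- d ℤ.- e) ≡
        (a ℤ.+ a) ℤ.+ (c ℤ.+ c ℤ.+ (b ℤ.+ b)) ℤ.- (d ℤ.+ d ℤ.+ (e ℤ.+ e))
      regroup = ℤ-Solver.solve-∀
      collect : ∀ a b c d e p q → (a ℤ.+ b) ℤ.+ (c ℤ.- d ℤ.+ e) ℤ.- (p ℤ.+ q ℤ.+ (p ℤ.- q)) ≡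
        a ℤ.+ c ℤ.- (p ℤ.+ p) ℤ.- (d ℤ.- b) ℤ.+ e
      collect = ℤ-Solver.solve-∀

-- Sums over initial segments; rows and columns of a decreasing list.

⅀-applyUpTo : ∀ {A B : Set} (h : ℕ → A) (k : ℕ → B) n {f : A → ℤ} {f′ : B → ℤ} → (∀ i → f (h i) ≡ f′ (k i)) →
  ⅀ (applyUpTo h n) f ≡ ⅀ (applyUpTo k n) f′
⅀-applyUpTo h k zero    e = refl
⅀-applyUpTo h k (suc n) e = cong₂ ℤ._+_ (e 0) (⅀-applyUpTo (h ∘ suc) (k ∘ suc) n (e ∘ suc))

⅀-applyUpTo-extend : ∀ {A : Set} (h : ℕ → A) {n N} (f : A → ℤ) → n ℕ.≤ N → (∀ i → n ℕ.≤ i → f (h i) ≡ 0ℤ) →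
  ⅀ (applyUpTo h n) f ≡ ⅀ (applyUpTo h N) f
⅀-applyUpTo-extend h {N = N} f z≤n e = sym (⅀-zero (applyUpTo h N) λ x∈ → vanish x∈)
  where
  vanish : ∀ {x} → x ∈ applyUpTo h N → f x ≡ 0ℤ
  vanish x∈ with ∈-applyUpTo⁻ h x∈
  ... | i , _ , refl = e i z≤n
⅀-applyUpTo-extend h f (s≤s n≤N) e = cong (ℤ._+_ (f (h 0))) (⅀-applyUpTo-extend (h ∘ suc) f n≤N (λ i n≤i → e (suc i) (s≤s n≤i)))

⅀-upTo-< : ∀ {n N} (f : ℕ → ℤ) → n ℕ.≤ N → ⅀ (upTo n) f ≡ ⅀[ i ∈ upTo N ] 𝟙 (i ℕ.<? n) ℤ.* f i
⅀-upTo-< {n} {N} f n≤N = trans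
  (⅀-cong (upTo n) (λ {i} i∈ → sym (trans (cong (ℤ._* f i) (𝟙-yes (i ℕ.<? n) (∈-upTo⁻ i∈))) (ℤ.*-identityˡ (f i)))))
  (⅀-applyUpTo-extend id _ n≤N (λ i n≤i → cong (ℤ._* f i) (𝟙-no (i ℕ.<? n) (ℕ.≤⇒≯ n≤i))))

+-∸ : ∀ {m n} → n ℕ.≤ m → + (m ∸ n) ≡ + m ℤ.- + n
+-∸ {m} {n} n≤m = trans (sym (ℤ.⊖-≥ n≤m)) (sym (ℤ.m-n≡m⊖n m n))

nth-antitone : ∀ {xs} → Linked ℕ._≥_ xs → ∀ {m n} → m ℕ.≤ n → nth xs n ℕ.≤ nth xs m
nth-antitone []       _                          = z≤n
nth-antitone {x ∷ xs} _       {zero}  {zero}  _  = ℕ.≤-refl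
nth-antitone [-]      {zero}  {suc n} _          = z≤n
nth-antitone (x≥y ∷ l) {zero}  {suc n} _         = ℕ.≤-trans (nth-antitone l (z≤n {n})) x≥y
nth-antitone {x ∷ xs} l       {suc m} {suc n} (s≤s m≤n) = nth-antitone (Linked.tail l) m≤n

nth-overflow : ∀ xs {n} → length xs ℕ.≤ n → nth xs n ≡ 0
nth-overflow []       _        = refl
nth-overflow (x ∷ xs) (s≤s ≤n) = nth-overflow xs ≤n

sum-nth : ∀ xs {N} → length xs ℕ.≤ N → + sum xs ≡ ⅀[ n ∈ upTo N ] + nth xs n
sum-nth xs {N} ≤N = trans (exact xs) (⅀-applyUpTo-extend id (+_ ∘ nth xs) ≤N (λ i ≤i → cong +_ (nth-overflow xs ≤i)))
  where
  exact : ∀ xs → + sum xs ≡ ⅀[ n ∈ upTo (length xs) ] + nth xs n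
  exact []       = refl
  exact (x ∷ xs) = cong (ℤ._+_ (+ x)) (trans (exact xs) (⅀-applyUpTo id suc (length xs) (λ _ → refl)))

count : ℕ → List ℕ → ℕ
count j xs = length (filter (j ℕ.≤?_) xs)

count-accept : ∀ {j x} xs → j ℕ.≤ x → count j (x ∷ xs) ≡ suc (count j xs)
count-accept {j} xs j≤x = cong length (List.filter-accept (j ℕ.≤?_) j≤x)

count-reject : ∀ {j x} xs → ¬ j ℕ.≤ x → count j (x ∷ xs) ≡ count j xs
count-reject {j} xs j≰x = cong length (List.filter-reject (j ℕ.≤?_) j≰x)

-- In a decreasing list the entries that are at least `j` form a prefix: nothing after a rejected
-- head can be accepted.
count-<⁻ : ∀ {xs} → Linked ℕ._≥_ xs → ∀ j {n} → n ℕ.< count j xs → j ℕ.≤ nth xs n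
count-<⁻ {x ∷ xs} l j {n} n< = [ accept n n< , reject n< ]′ (toSum (j ℕ.≤? x))
  where
  accept : ∀ n → n ℕ.< count j (x ∷ xs) → j ℕ.≤ x → j ℕ.≤ nth (x ∷ xs) n
  accept zero    _  j≤x = j≤x
  accept (suc n) n< j≤x = count-<⁻ (Linked.tail l) j (ℕ.≤-pred (subst (suc n ℕ.<_) (count-accept xs j≤x) n<))
  reject : n ℕ.< count j (x ∷ xs) → ¬ j ℕ.≤ x → j ℕ.≤ nth (x ∷ xs) n
  reject n< j≰x = contradiction
    (ℕ.≤-trans (count-<⁻ (Linked.tail l) j (subst (n ℕ.<_) (count-reject xs j≰x) n<)) (nth-antitone l (z≤n {suc n}))) j≰x

-- `0 < j` excludes the default value 0 that `nth` takes beyond the end.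
count-<⁺ : ∀ {xs} → Linked ℕ._≥_ xs → ∀ j {n} → 0 ℕ.< j → j ℕ.≤ nth xs n → n ℕ.< count j xs
count-<⁺ {[]}     l j     0<j j≤0 = contradiction (ℕ.<-≤-trans 0<j j≤0) λ ()
count-<⁺ {x ∷ xs} l j {n} 0<j j≤  = accept n j≤ (ℕ.≤-trans j≤ (nth-antitone l (z≤n {n})))
  where
  accept : ∀ n → j ℕ.≤ nth (x ∷ xs) n → j ℕ.≤ x → n ℕ.< count j (x ∷ xs)
  accept zero    _  j≤x = subst (0 ℕ.<_) (sym (count-accept xs j≤x)) (s≤s z≤n)
  accept (suc n) j≤ j≤x = subst (suc n ℕ.<_) (sym (count-accept xs j≤x)) (s≤s (count-<⁺ (Linked.tail l) j 0<j j≤))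

∈⇒≤foldr-⊔ : ∀ {x} xs → x ∈ xs → x ℕ.≤ foldr _⊔_ 0 xs
∈⇒≤foldr-⊔ (x ∷ xs) (here refl) = ℕ.m≤m⊔n x _
∈⇒≤foldr-⊔ (y ∷ xs) (there x∈)  = ℕ.≤-trans (∈⇒≤foldr-⊔ xs x∈) (ℕ.m≤n⊔m y _)

-- The Ferrers diagram read off from the word.

module Diagram (μ : Partition) where

  private
    len : ℕ
    len = length (parts μ)
    width : ℕ
    width = part μ 1

  row col : ℕ → ℕ
  row i = part μ (suc i)
  col j = conj μ (suc j)

  -- The positions of the letters 0 and 1 of the word: X i is the position of
  -- the vertical step that ends row i + 1, and Y j that of the horizontal
  -- step below column j + 1.
  X Y : ℕ → ℤ
  X i = + row i ℤ.- + suc i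
  Y j = + j ℤ.- + col j

  row-antitone : ∀ {i i′} → i ℕ.≤ i′ → row i′ ℕ.≤ row i
  row-antitone = nth-antitone (decreasing μ)

  row>⇒col> : ∀ {i j} → j ℕ.< row i → i ℕ.< col j
  row>⇒col> {i} {j} = count-<⁺ (decreasing μ) (suc j) {i} (s≤s z≤n)

  col>⇒row> : ∀ {i j} → i ℕ.< col j → j ℕ.< row i
  col>⇒row> {i} {j} = count-<⁻ (decreasing μ) (suc j) {i}

  col-antitone : ∀ {j j′} → j ℕ.≤ j′ → col j′ ℕ.≤ col j
  col-antitone {j} {j′} j≤j′ = ℕ.≮⇒≥ λ col< →
    ℕ.<-irrefl refl (row>⇒col> (ℕ.≤-<-trans j≤j′ (col>⇒row> {col j} {j′} col<)))

  row-beyond : ∀ {i} → len ℕ.≤ i → row i ≡ 0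
  row-beyond = nth-overflow (parts μ)

  col≤len : ∀ j → col j ℕ.≤ len
  col≤len j = List.length-filter (suc j ℕ.≤?_) (parts μ)

  row≤width : ∀ i → row i ℕ.≤ width
  row≤width i = row-antitone {0} {i} z≤n

  ≤durfee⁺ : ∀ {i} → suc i ℕ.≤ row i → suc i ℕ.≤ durfee μ
  ≤durfee⁺ {i} i<row = ∈⇒≤foldr-⊔ _ (∈-filter⁺ (λ s → s ℕ.≤? part μ s) {xs = [1… len ]}
    (∈-applyUpTo⁺ suc (ℕ.≰⇒> λ len≤i → ℕ.1+n≰n (ℕ.≤-trans (ℕ.≤-trans (s≤s z≤n) i<row) (ℕ.≤-reflexive (row-beyond len≤i))))) i<row)

  private
    split : ∀ r i j c → r ℤ.- (1ℤ ℤ.+ i) ℤ.- (j ℤ.- c) ≡ (r ℤ.+ c) ℤ.- ((1ℤ ℤ.+ j) ℤ.+ i)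
    split = ℤ-Solver.solve-∀

  -- `X i - Y j` equals `(row i - (j + 1)) + (col j - i)`. A box lies within its row exactly when it
  -- lies within its column, so the two terms never work against each other: on a box they are at
  -- least 0 and 1, off the diagram at most -1 and 0.
  box⇒Y<X : ∀ {i j} → j ℕ.< row i → Y j ℤ.< X i
  box⇒Y<X {i} {j} j<row = <-by
    (ℤ.+<+ (ℕ.+-mono-≤-< j<row (row>⇒col> {i} {j} j<row))) (split (+ row i) (+ i) (+ j) (+ col j))

  nonbox⇒X<Y : ∀ {i j} → ¬ j ℕ.< row i → X i ℤ.< Y j
  nonbox⇒X<Y {i} {j} ¬box = <-by
    (ℤ.+<+ (s≤s (ℕ.+-mono-≤ (ℕ.≮⇒≥ ¬box) (ℕ.≮⇒≥ (¬box ∘ col>⇒row> {i} {j}))))) (lemma (+ row i) (+ i) (+ j) (+ col j))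
    where
    lemma : ∀ r i j c → (j ℤ.- c) ℤ.- (r ℤ.- (1ℤ ℤ.+ i)) ≡ 1ℤ ℤ.+ (j ℤ.+ i) ℤ.- (r ℤ.+ c)
    lemma = ℤ-Solver.solve-∀

  Y<X⇒box : ∀ {i j} → Y j ℤ.< X i → j ℕ.< row i
  Y<X⇒box {i} {j} Y<X with j ℕ.<? row i
  ... | yes box = box
  ... | no ¬box = contradiction (nonbox⇒X<Y {i} {j} ¬box) (ℤ.<-asym Y<X)

  X≢Y : ∀ i j → X i ≢ Y j
  X≢Y i j e with j ℕ.<? row i
  ... | yes box = ℤ.<-irrefl (sym e) (box⇒Y<X {i} {j} box)
  ... | no ¬box = ℤ.<-irrefl e (nonbox⇒X<Y {i} {j} ¬box)

  hook≡X-Y : ∀ {i j} → j ℕ.< row i → + hook μ (suc i , suc j) ≡ X i ℤ.- Y j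
  hook≡X-Y {i} {j} box = begin
    + (row i ∸ suc j) ℤ.+ + (col j ∸ suc i) ℤ.+ 1ℤ
      ≡⟨ cong₂ (λ a l → a ℤ.+ l ℤ.+ 1ℤ) (+-∸ box) (+-∸ (row>⇒col> {i} {j} box)) ⟩
    + row i ℤ.- + suc j ℤ.+ (+ col j ℤ.- + suc i) ℤ.+ 1ℤ
      ≡⟨ lemma (+ row i) (+ i) (+ j) (+ col j) ⟩
    X i ℤ.- Y j ∎
    where
    open ≡-Reasoning
    lemma : ∀ r i j c → r ℤ.- (1ℤ ℤ.+ j) ℤ.+ (c ℤ.- (1ℤ ℤ.+ i)) ℤ.+ 1ℤ ≡ r ℤ.- (1ℤ ℤ.+ i) ℤ.- (j ℤ.- c)
    lemma = ℤ-Solver.solve-∀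

  X-decreasing : ∀ {i i′} → i ℕ.< i′ → X i′ ℤ.< X i
  X-decreasing {i} {i′} i<i′ = <-by (ℤ.+<+ (ℕ.+-mono-≤-< (row-antitone (ℕ.<⇒≤ i<i′)) i<i′))
    (lemma (+ row i) (+ row i′) (+ i) (+ i′))
    where
    lemma : ∀ r r′ i i′ → r ℤ.- (1ℤ ℤ.+ i) ℤ.- (r′ ℤ.- (1ℤ ℤ.+ i′)) ≡ (r ℤ.+ i′) ℤ.- (r′ ℤ.+ i)
    lemma = ℤ-Solver.solve-∀

  Y-increasing : ∀ {j j′} → j ℕ.< j′ → Y j ℤ.< Y j′
  Y-increasing {j} {j′} j<j′ = <-by (ℤ.+<+ (ℕ.+-mono-<-≤ j<j′ (col-antitone (ℕ.<⇒≤ j<j′))))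
    (lemma (+ col j) (+ col j′) (+ j) (+ j′))
    where
    lemma : ∀ c c′ j j′ → j′ ℤ.- c′ ℤ.- (j ℤ.- c) ≡ (j′ ℤ.+ c) ℤ.- (j ℤ.+ c′)
    lemma = ℤ-Solver.solve-∀

  -- Beyond this bound the word is constant on either side.
  bound : ℕ
  bound = suc (len ℕ.+ width)

  private
    len≤bound : len ℕ.≤ bound
    len≤bound = ℕ.m≤n⇒m≤1+n (ℕ.m≤m+n len width)
    width≤bound : width ℕ.≤ bound
    width≤bound = ℕ.m≤n⇒m≤1+n (ℕ.m≤n+m width len)

  ∣+-+∣≤ : ∀ {m n W} → m ℕ.≤ W → n ℕ.≤ W → ∣ + m ℤ.- + n ∣ ℕ.≤ W
  ∣+-+∣≤ {m} {n} m≤W n≤W = ℕ.≤-trans (ℕ.≤-reflexive (cong ∣_∣ (ℤ.m-n≡m⊖n m n)))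
    (ℕ.≤-trans (ℤ.∣m⊝n∣≤m⊔n m n) (ℕ.⊔-lub m≤W n≤W))

  -- The positions `X i` with `i < W` and `Y j` with `j ≤ W` are `2W + 1` distinct members of a
  -- window of that length. For the empty partition they are `-1 , … , -W` and `0 , … , W`.
  letters↭window : ∀ {W} → bound ℕ.≤ W → applyUpTo X W ++ applyUpTo Y (suc W) ↭ window W
  letters↭window {W} bound≤W = Unique-⊆⇒↭
    (Unique.++⁺ (Unique.applyUpTo⁺₁ X W (λ i<i′ _ e → ℤ.<-irrefl (sym e) (X-decreasing i<i′)))
                (Unique.applyUpTo⁺₁ Y (suc W) (λ j<j′ _ e → ℤ.<-irrefl e (Y-increasing j<j′)))
                disjoint)
    ⊆window
    (ℕ.≤-reflexive (begin
      length (window W)                              ≡⟨ window-length W ⟩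
      suc (W ℕ.+ W)                                  ≡⟨ ℕ.+-suc W W ⟨
      W ℕ.+ suc W                                    ≡⟨ cong₂ ℕ._+_ (List.length-applyUpTo X W) (List.length-applyUpTo Y (suc W)) ⟨
      length (applyUpTo X W) ℕ.+ length (applyUpTo Y (suc W)) ≡⟨ List.length-++ (applyUpTo X W) ⟨
      length (applyUpTo X W ++ applyUpTo Y (suc W))  ∎))
    where
    open ≡-Reasoning
    disjoint : ∀ {z} → ¬ (z ∈ applyUpTo X W × z ∈ applyUpTo Y (suc W))
    disjoint (z∈X , z∈Y) with ∈-applyUpTo⁻ X z∈X | ∈-applyUpTo⁻ Y z∈Y
    ... | i , _ , refl | j , _ , e = X≢Y i j e
    ⊆window : ∀ {z} → z ∈ applyUpTo X W ++ applyUpTo Y (suc W) → z ∈ window W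
    ⊆window z∈ with ∈-++⁻ (applyUpTo X W) z∈
    ⊆window z∈ | inj₁ z∈X with ∈-applyUpTo⁻ X z∈X
    ... | i , i<W , refl = ∈-window⁺ (X i) (∣+-+∣≤ (ℕ.≤-trans (row≤width i) (ℕ.≤-trans width≤bound bound≤W)) i<W)
    ⊆window z∈ | inj₂ z∈Y with ∈-applyUpTo⁻ Y z∈Y
    ... | j , s≤s j≤W , refl = ∈-window⁺ (Y j) (∣+-+∣≤ j≤W (ℕ.≤-trans (col≤len j) (ℕ.≤-trans len≤bound bound≤W)))

  abstract
    -- Every integer lies in some large window, whose members are all accounted for. The
    -- decidability of `WordZero`, an unbounded existential, rests on this.
    letter : ∀ z → (∃[ i ] z ≡ X i) ⊎ (∃[ j ] z ≡ Y j)
    letter z = Sum.map (λ z∈ → let i , _ , e = ∈-applyUpTo⁻ X z∈ in i , e)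
                       (λ z∈ → let j , _ , e = ∈-applyUpTo⁻ Y z∈ in j , e)
      (∈-++⁻ (applyUpTo X W) (∈-resp-↭ (↭-sym (letters↭window (ℕ.m≤m+n bound ∣ z ∣))) (∈-window⁺ z (ℕ.m≤n+m ∣ z ∣ bound))))
      where
      W : ℕ
      W = bound ℕ.+ ∣ z ∣

  WordZero-X : ∀ i → WordZero μ (X i)
  WordZero-X i = suc i , s≤s z≤n , refl

  ¬WordZero-Y : ∀ j → ¬ WordZero μ (Y j)
  ¬WordZero-Y j (suc i , _ , e) = X≢Y i j (sym e)

  WordZero⇒X : ∀ {z} → WordZero μ z → ∃[ i ] z ≡ X i
  WordZero⇒X (suc i , _ , e) = i , e

  abstract
    WordZero? : ∀ z → Dec (WordZero μ z)
    WordZero? z = [ (λ (i , z≡X) → yes (subst (WordZero μ) (sym z≡X) (WordZero-X i)))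
                  , (λ (j , z≡Y) → no (subst (λ z → ¬ WordZero μ z) (sym z≡Y) (¬WordZero-Y j))) ]′ (letter z)

  χ : ℤ → ℤ
  χ z = 𝟙 (WordZero? z)

  χ-X : ∀ i → χ (X i) ≡ 1ℤ
  χ-X i = 𝟙-yes (WordZero? (X i)) (WordZero-X i)

  χ-Y : ∀ j → χ (Y j) ≡ 0ℤ
  χ-Y j = 𝟙-no (WordZero? (Y j)) (¬WordZero-Y j)

  χ-idem : ∀ z → χ z ℤ.* χ z ≡ χ z
  χ-idem z = 𝟙-idem (WordZero? z)

  χ-above : ∀ {K} → bound ℕ.≤ K → ∀ z → + K ℤ.≤ z → χ z ≡ 0ℤ
  χ-above {K} bound≤K z K≤z = 𝟙-no (WordZero? z) ¬letter₀
    where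
    lemma : ∀ r i → r ℤ.- (r ℤ.- (1ℤ ℤ.+ i)) ≡ 1ℤ ℤ.+ i ℤ.- 0ℤ
    lemma = ℤ-Solver.solve-∀
    ¬letter₀ : ¬ WordZero μ z
    ¬letter₀ letter₀ with WordZero⇒X letter₀
    ... | i , refl = ℤ.<-irrefl refl (ℤ.<-≤-trans (<-by (ℤ.+<+ (s≤s (z≤n {i}))) (lemma (+ row i) (+ i)))
      (ℤ.≤-trans (ℤ.+≤+ (ℕ.≤-trans (row≤width i) (ℕ.≤-trans width≤bound bound≤K))) K≤z))

  χ-below : ∀ {K} → bound ℕ.≤ K → ∀ z → z ℤ.≤ ℤ.- + K → χ z ≡ 1ℤ
  χ-below {suc K} (s≤s bound≤K) (+ n) ()
  χ-below {suc K} (s≤s bound≤K) -[1+ n ] (ℤ.-≤- K≤n) = trans (cong χ -[1+n]≡X) (χ-X n)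
    where
    -[1+n]≡X : -[1+ n ] ≡ X n
    -[1+n]≡X rewrite row-beyond {n} (ℕ.≤-trans (ℕ.≤-trans (ℕ.m≤m+n len width) bound≤K) K≤n) = refl

  ⅀-χ : ∀ {W} → bound ℕ.≤ W → (F : ℤ → ℤ) → ⅀[ z ∈ window W ] χ z ℤ.* F z ≡ ⅀[ i ∈ upTo W ] F (X i)
  ⅀-χ {W} bound≤W F = begin
    ⅀ (window W) G                              ≡⟨ ⅀-↭ G (letters↭window bound≤W) ⟨
    ⅀ (applyUpTo X W ++ applyUpTo Y (suc W)) G  ≡⟨ ⅀-++ (applyUpTo X W) _ G ⟩
    ⅀ (applyUpTo X W) G ℤ.+ ⅀ (applyUpTo Y (suc W)) G ≡⟨ cong₂ ℤ._+_
      (⅀-applyUpTo X id W (λ i → trans (cong (ℤ._* F (X i)) (χ-X i)) (ℤ.*-identityˡ (F (X i)))))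
      (trans (⅀-applyUpTo Y id (suc W) {G} {λ _ → 0ℤ} (λ j → cong (ℤ._* F (Y j)) (χ-Y j))) (⅀-zero (upTo (suc W)) (λ _ → refl))) ⟩
    (⅀[ i ∈ upTo W ] F (X i)) ℤ.+ 0ℤ            ≡⟨ ℤ.+-identityʳ _ ⟩
    ⅀[ i ∈ upTo W ] F (X i)                     ∎
    where
    open ≡-Reasoning
    G : ℤ → ℤ
    G z = χ z ℤ.* F z

  ⅀-χ̄ : ∀ {W} → bound ℕ.≤ W → (F : ℤ → ℤ) → ⅀[ z ∈ window W ] (1ℤ ℤ.- χ z) ℤ.* F z ≡ ⅀[ j ∈ upTo (suc W) ] F (Y j)
  ⅀-χ̄ {W} bound≤W F = begin
    ⅀ (window W) G                              ≡⟨ ⅀-↭ G (letters↭window bound≤W) ⟨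
    ⅀ (applyUpTo X W ++ applyUpTo Y (suc W)) G  ≡⟨ ⅀-++ (applyUpTo X W) _ G ⟩
    ⅀ (applyUpTo X W) G ℤ.+ ⅀ (applyUpTo Y (suc W)) G ≡⟨ cong₂ ℤ._+_
      (trans (⅀-applyUpTo X id W (λ i → cong (λ s → (1ℤ ℤ.- s) ℤ.* F (X i)) (χ-X i))) (⅀-zero (upTo W) (λ _ → refl)))
      (⅀-applyUpTo Y id (suc W) {G} {F ∘ Y} (λ j → trans (cong (λ s → (1ℤ ℤ.- s) ℤ.* F (Y j)) (χ-Y j)) (ℤ.*-identityˡ (F (Y j))))) ⟩
    0ℤ ℤ.+ (⅀[ j ∈ upTo (suc W) ] F (Y j))      ≡⟨ ℤ.+-identityˡ _ ⟩
    ⅀[ j ∈ upTo (suc W) ] F (Y j)               ∎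
    where
    open ≡-Reasoning
    G : ℤ → ℤ
    G z = (1ℤ ℤ.- χ z) ℤ.* F z

  -- The test `y < x` marks the columns that reach row `i`, so the inner sum can run over a range
  -- that is independent of the row.
  ⅀-boxes : ∀ {W} → bound ℕ.≤ W → (F : Box → ℤ) (f : ℤ → ℤ → ℤ) →
    (∀ i j → j ℕ.< row i → F (suc i , suc j) ≡ f (X i) (Y j)) →
    ⅀ (boxes μ) F ≡ ⅀[ x ∈ window W ] χ x ℤ.* (⅀[ y ∈ window W ] (1ℤ ℤ.- χ y) ℤ.* (𝟙 (y ℤ.<? x) ℤ.* f x y))
  ⅀-boxes {W} bound≤W F f e = begin
    ⅀ (boxes μ) F
      ≡⟨ ⅀-concatMap [1… len ] _ F ⟩
    ⅀[ i ∈ [1… len ] ] ⅀ (map (i ,_) [1… part μ i ]) F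
      ≡⟨ ⅀-ext [1… len ] (λ i → ⅀-map [1… part μ i ] (i ,_) F) ⟩
    ⅀[ i ∈ [1… len ] ] ⅀[ j ∈ [1… part μ i ] ] F (i , j)
      ≡⟨ ⅀-applyUpTo suc id len (λ i → ⅀-applyUpTo suc id (row i) (λ j → refl)) ⟩
    ⅀[ i ∈ upTo len ] ⅀[ j ∈ upTo (row i) ] F (suc i , suc j)
      ≡⟨ ⅀-applyUpTo-extend id _ (ℕ.≤-trans len≤bound bound≤W) (λ i len≤i → cong (λ r → ⅀[ j ∈ upTo r ] F (suc i , suc j)) (row-beyond len≤i)) ⟩
    ⅀[ i ∈ upTo W ] ⅀[ j ∈ upTo (row i) ] F (suc i , suc j)
      ≡⟨ ⅀-ext (upTo W) inner ⟩
    ⅀[ i ∈ upTo W ] G (X i)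
      ≡⟨ ⅀-χ bound≤W G ⟨
    ⅀[ x ∈ window W ] χ x ℤ.* G x ∎
    where
    open ≡-Reasoning
    G : ℤ → ℤ
    G x = ⅀[ y ∈ window W ] (1ℤ ℤ.- χ y) ℤ.* (𝟙 (y ℤ.<? x) ℤ.* f x y)
    inner : ∀ i → ⅀[ j ∈ upTo (row i) ] F (suc i , suc j) ≡ G (X i)
    inner i = begin
      ⅀[ j ∈ upTo (row i) ] F (suc i , suc j)
        ≡⟨ ⅀-cong (upTo (row i)) (λ {j} j∈ → e i j (∈-upTo⁻ j∈)) ⟩
      ⅀[ j ∈ upTo (row i) ] f (X i) (Y j)
        ≡⟨ ⅀-upTo-< _ (ℕ.≤-trans (row≤width i) (ℕ.≤-trans width≤bound (ℕ.m≤n⇒m≤1+n bound≤W))) ⟩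
      ⅀[ j ∈ upTo (suc W) ] 𝟙 (j ℕ.<? row i) ℤ.* f (X i) (Y j)
        ≡⟨ ⅀-ext (upTo (suc W)) (λ j → cong (ℤ._* f (X i) (Y j))
           (𝟙-⇔ (j ℕ.<? row i) (Y j ℤ.<? X i) (box⇒Y<X {i} {j}) (Y<X⇒box {i} {j}))) ⟩
      ⅀[ j ∈ upTo (suc W) ] 𝟙 (Y j ℤ.<? X i) ℤ.* f (X i) (Y j)
        ≡⟨ ⅀-χ̄ bound≤W (λ y → 𝟙 (y ℤ.<? X i) ℤ.* f (X i) y) ⟨
      G (X i) ∎

  -- The last sum depends on `W` only, so it cancels against the same formula for the empty
  -- partition.
  size-χ : ∀ {W} → bound ℕ.≤ W → + size μ ≡ (⅀[ z ∈ window W ] χ z ℤ.* z) ℤ.+ (⅀[ i ∈ upTo W ] + suc i)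
  size-χ {W} bound≤W = begin
    + size μ                                          ≡⟨ sum-nth (parts μ) (ℕ.≤-trans len≤bound bound≤W) ⟩
    ⅀[ i ∈ upTo W ] + row i                           ≡⟨ ⅀-ext (upTo W) (λ i → lemma (+ row i) (+ suc i)) ⟩
    ⅀[ i ∈ upTo W ] (X i ℤ.+ + suc i)                 ≡⟨ ⅀-+ (upTo W) X _ ⟩
    ⅀ (upTo W) X ℤ.+ (⅀[ i ∈ upTo W ] + suc i)        ≡⟨ cong (λ s → s ℤ.+ (⅀[ i ∈ upTo W ] + suc i)) (⅀-χ bound≤W id) ⟨
    (⅀[ z ∈ window W ] χ z ℤ.* z) ℤ.+ (⅀[ i ∈ upTo W ] + suc i) ∎
    where
    open ≡-Reasoning
    lemma : ∀ r i → r ≡ r ℤ.- i ℤ.+ i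
    lemma = ℤ-Solver.solve-∀

  box∈boxes : ∀ {i j} → j ℕ.< row i → (suc i , suc j) ∈ boxes μ
  box∈boxes {i} {j} j<row = ∈-concatMap⁺ _ {xs = [1… len ]}
    (Any.map (λ {k} e → subst (λ k → (suc i , suc j) ∈ map (k ,_) [1… part μ k ]) e (∈-map⁺ (suc i ,_) (∈-applyUpTo⁺ suc j<row)))
             (∈-applyUpTo⁺ suc i<len))
    where
    i<len : i ℕ.< len
    i<len = ℕ.<-≤-trans (row>⇒col> {i} {j} j<row) (col≤len j)

  hook-positive : ∀ i j → 0 ℕ.< hook μ (i , j)
  hook-positive i j = ℕ.m≤n+m 1 (part μ i ∸ j ℕ.+ (conj μ j ∸ i))

-- The symmetry of the word of a doubled distinct partition.

module Doubled (μ : Partition) (dd : DoubledDistinct μ) where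

  open Diagram μ

  row≡col+1 : ∀ {i} → i ℕ.< row i → row i ≡ col i ℕ.+ 1
  row≡col+1 {i} i<row = dd (suc i) (s≤s z≤n) (≤durfee⁺ i<row)

  -- The defining condition of a doubled distinct partition, expressed in the word; the whole
  -- reflection symmetry comes from it.
  X≡-Y : ∀ {i} → i ℕ.< row i → X i ≡ ℤ.- Y i
  X≡-Y {i} i<row = trans (cong (λ r → + r ℤ.- + suc i) (row≡col+1 i<row)) (lemma (+ col i) (+ i))
    where
    lemma : ∀ c i → c ℤ.+ 1ℤ ℤ.- (1ℤ ℤ.+ i) ≡ ℤ.- (i ℤ.- c)
    lemma = ℤ-Solver.solve-∀

  0≤X⇒diagonal : ∀ {i} → 0ℤ ℤ.≤ X i → i ℕ.< row i
  0≤X⇒diagonal {i} 0≤X = ℤ.drop‿+≤+ (≤-by 0≤X (lemma (+ row i) (+ suc i)))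
    where
    lemma : ∀ r i → r ℤ.- i ≡ r ℤ.- i ℤ.- 0ℤ
    lemma = ℤ-Solver.solve-∀

  Y<0⇒diagonal : ∀ {j} → Y j ℤ.< 0ℤ → j ℕ.< row j
  Y<0⇒diagonal {j} Y<0 = col>⇒row> {j} {j} (ℤ.drop‿+<+ (<-by Y<0 (lemma (+ j) (+ col j))))
    where
    lemma : ∀ j c → c ℤ.- j ≡ 0ℤ ℤ.- (j ℤ.- c)
    lemma = ℤ-Solver.solve-∀

  -- If `X i` were 0, then `Y i = - X i` would be 0 as well, but no position carries both letters.
  ¬WordZero-0 : ¬ WordZero μ 0ℤ
  ¬WordZero-0 zero∈ with WordZero⇒X zero∈
  ... | i , 0≡X = X≢Y i i (trans (sym 0≡X) (trans (cong (λ z → ℤ.- z) (trans 0≡X (X≡-Y diagonal))) (ℤ.neg-involutive (Y i))))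
    where
    diagonal : i ℕ.< row i
    diagonal = 0≤X⇒diagonal (ℤ.≤-reflexive 0≡X)

  private
    ¬both-positive : ∀ {z} → 0ℤ ℤ.≤ z → WordZero μ z → ¬ WordZero μ (ℤ.- z)
    ¬both-positive {z} 0≤z z∈ -z∈ with WordZero⇒X z∈
    ... | i , refl = ¬WordZero-Y i (subst (WordZero μ) (trans (cong (λ z → ℤ.- z) (X≡-Y (0≤X⇒diagonal 0≤z))) (ℤ.neg-involutive (Y i))) -z∈)

    Y<0⇒reflection : ∀ {j z} → z ≡ Y j → z ℤ.< 0ℤ → WordZero μ (ℤ.- z)
    Y<0⇒reflection {j} refl z<0 = subst (WordZero μ) (X≡-Y (Y<0⇒diagonal z<0)) (WordZero-X j)

  -- The zeros at nonnegative positions and the ones at negative positions belong to diagonal boxes,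
  -- where `X i = - Y i` matches them. The remaining signs follow by applying this to `- z`.
  WordZero-reflect⁻ : ∀ z → WordZero μ z → ¬ WordZero μ (ℤ.- z)
  WordZero-reflect⁻ z z∈ -z∈ with ℤ.≤-total 0ℤ z
  ... | inj₁ 0≤z = ¬both-positive 0≤z z∈ -z∈
  ... | inj₂ z≤0 = ¬both-positive (ℤ.neg-mono-≤ z≤0) -z∈ (subst (WordZero μ) (sym (ℤ.neg-involutive z)) z∈)

  WordZero-reflect⁺ : ∀ z → z ≢ 0ℤ → ¬ WordZero μ z → WordZero μ (ℤ.- z)
  WordZero-reflect⁺ z z≢0 z∉ with ℤ.<-cmp z 0ℤ
  ... | tri≈ _ z≡0 _ = contradiction z≡0 z≢0
  ... | tri< z<0 _ _ with letter z
  ...   | inj₁ (i , refl) = contradiction (WordZero-X i) z∉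
  ...   | inj₂ (j , z≡Y)  = Y<0⇒reflection z≡Y z<0
  WordZero-reflect⁺ z z≢0 z∉ | tri> _ _ 0<z with letter (ℤ.- z)
  ...   | inj₁ (i , -z≡X) = subst (WordZero μ) (sym -z≡X) (WordZero-X i)
  ...   | inj₂ (j , -z≡Y) = contradiction
    (subst (WordZero μ) (ℤ.neg-involutive z) (Y<0⇒reflection -z≡Y (ℤ.neg-mono-< 0<z))) z∉

  χ-zero : χ 0ℤ ≡ 0ℤ
  χ-zero = 𝟙-no (WordZero? 0ℤ) ¬WordZero-0

  χ-reflect : ∀ z → z ≢ 0ℤ → χ (ℤ.- z) ≡ 1ℤ ℤ.- χ z
  χ-reflect z z≢0 with WordZero? z
  ... | yes z∈ = 𝟙-no (WordZero? (ℤ.- z)) (WordZero-reflect⁻ z z∈)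
  ... | no  z∉ = 𝟙-yes (WordZero? (ℤ.- z)) (WordZero-reflect⁺ z z≢0 z∉)

  -- Row `i` meets the diagonal, and `row i = col i + 1` turns the sum into
  -- `(col i - col j) + (j - i)`, with both terms nonnegative.
  0≤X+Y : ∀ {i j} → j ℕ.< row i → i ℕ.≤ j → 0ℤ ℤ.≤ X i ℤ.+ Y j
  0≤X+Y {i} {j} box i≤j = ≤-by (ℤ.+≤+ (ℕ.+-mono-≤ (col-antitone i≤j) i≤j))
    (trans (cong (λ r → + r ℤ.- + suc i ℤ.+ Y j ℤ.- 0ℤ) (row≡col+1 (ℕ.≤-<-trans i≤j box))) (lemma (+ col i) (+ col j) (+ i) (+ j)))
    where
    lemma : ∀ c c′ i j → c ℤ.+ 1ℤ ℤ.- (1ℤ ℤ.+ i) ℤ.+ (j ℤ.- c′) ℤ.- 0ℤ ≡ (c ℤ.+ j) ℤ.- (c′ ℤ.+ i)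
    lemma = ℤ-Solver.solve-∀

  -- Now column `j` meets the diagonal, and `col j = row j - 1` turns the sum into
  -- `(row i - row j) + (j - i)`, where the second term is negative.
  X+Y<0 : ∀ {i j} → j ℕ.< row i → j ℕ.< i → X i ℤ.+ Y j ℤ.< 0ℤ
  X+Y<0 {i} {j} box j<i = <-by (ℤ.+<+ (ℕ.+-mono-≤-< row≤ j<i))
    (trans (lemma (+ row i) (+ col j) (+ i) (+ j)) (cong (λ r → + r ℤ.+ + i ℤ.- (+ row i ℤ.+ + j)) (sym (row≡col+1 (ℕ.<-≤-trans box row≤)))))
    where
    row≤ : row i ℕ.≤ row j
    row≤ = row-antitone (ℕ.<⇒≤ j<i)
    lemma : ∀ r c i j → 0ℤ ℤ.- (r ℤ.- (1ℤ ℤ.+ i) ℤ.+ (j ℤ.- c)) ≡ (c ℤ.+ 1ℤ ℤ.+ i) ℤ.- (r ℤ.+ j)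
    lemma = ℤ-Solver.solve-∀

  ε≡+1 : ∀ {i j} → j ℕ.< row i → 𝟙 (ε (suc i , suc j) ℤ.≟ + 1) ≡ 𝟙 (0ℤ ℤ.≤? X i ℤ.+ Y j)
  ε≡+1 {i} {j} box with suc j ℕ.<? suc i
  ... | yes (s≤s j<i) = sym (𝟙-no (_ ℤ.≤? _) (ℤ.<⇒≱ (X+Y<0 box j<i)))
  ... | no  j≮i       = sym (𝟙-yes (_ ℤ.≤? _) (0≤X+Y box (ℕ.≤-pred (ℕ.≮⇒≥ j≮i))))

  ε≡-1 : ∀ {i j} → j ℕ.< row i → 𝟙 (ε (suc i , suc j) ℤ.≟ -1ℤ) ≡ 𝟙 (X i ℤ.+ Y j ℤ.<? 0ℤ)
  ε≡-1 {i} {j} box with suc j ℕ.<? suc i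
  ... | yes (s≤s j<i) = sym (𝟙-yes (_ ℤ.<? _) (X+Y<0 box j<i))
  ... | no  j≮i       = sym (𝟙-no (_ ℤ.<? _) (ℤ.≤⇒≯ (0≤X+Y box (ℕ.≤-pred (ℕ.≮⇒≥ j≮i)))))

  hooks⁺ hooks⁻ : ℤ → ℤ
  hooks⁺ c = ⅀[ s ∈ boxes μ ] 𝟙 (+ hook μ s ℤ.≟ c) ℤ.* 𝟙 (ε s ℤ.≟ + 1)
  hooks⁻ c = ⅀[ s ∈ boxes μ ] 𝟙 (+ hook μ s ℤ.≟ c) ℤ.* 𝟙 (ε s ℤ.≟ -1ℤ)

  private
    no-hook : ∀ c (f : Box → ℤ) → c ℤ.≤ 0ℤ → ⅀[ s ∈ boxes μ ] 𝟙 (+ hook μ s ℤ.≟ c) ℤ.* f s ≡ 0ℤ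
    no-hook c f c≤0 = ⅀-zero (boxes μ) λ {(i , j)} _ → cong (ℤ._* f (i , j)) (𝟙-no (_ ℤ.≟ c) λ e →
      ℤ.<-irrefl refl (ℤ.<-≤-trans (ℤ.+<+ (hook-positive i j)) (subst (ℤ._≤ 0ℤ) (sym e) c≤0)))

  hooks⁺-nonpositive : ∀ c → c ℤ.≤ 0ℤ → hooks⁺ c ≡ 0ℤ
  hooks⁺-nonpositive c = no-hook c _

  hooks⁻-nonpositive : ∀ c → c ℤ.≤ 0ℤ → hooks⁻ c ≡ 0ℤ
  hooks⁻-nonpositive c = no-hook c _

  private
    open module C {W} {K} (bound≤K : bound ℕ.≤ K) =
      Counting χ {K} (ℕ.≤-trans (s≤s z≤n) bound≤K) (χ-above bound≤K) (χ-below bound≤K) χ-idem χ-zero χ-reflect W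
      using (pairs⁺; pairs⁻; twice-multiplicity)

  module _ {W} (bound≤W : bound ℕ.≤ W) where

    private
      -- The length `n` and the end `x` of the row determine `y = x - n`, which collapses the double
      -- sum. If this `y` leaves the window, it does so at the lower end, where `1 - χ y` is 0.
      hooks-by-position : ∀ n (e : Box → ℤ) (σ : ℤ → ℤ) → 0 ℕ.< n →
        (∀ i j → j ℕ.< row i → e (suc i , suc j) ≡ σ (X i ℤ.+ Y j)) →
        ⅀[ s ∈ boxes μ ] 𝟙 (+ hook μ s ℤ.≟ + n) ℤ.* e s ≡
        ⅀[ x ∈ window W ] χ x ℤ.* (1ℤ ℤ.- χ (x ℤ.- + n)) ℤ.* σ (x ℤ.+ (x ℤ.- + n))
      hooks-by-position n e σ 0<n e≡σ = trans
        (⅀-boxes bound≤W _ (λ x y → 𝟙 (x ℤ.- y ℤ.≟ c) ℤ.* σ (x ℤ.+ y))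
          (λ i j box → cong₂ (λ h s → 𝟙 (h ℤ.≟ c) ℤ.* s) (hook≡X-Y {i} {j} box) (e≡σ i j box)))
        (⅀-cong (window W) (λ {x} x∈ → trans (cong (ℤ._*_ (χ x)) (inner x x∈)) (sym (ℤ.*-assoc (χ x) _ _))))
        where
        c : ℤ
        c = + n
        F : ℤ → ℤ → ℤ
        F x y = (1ℤ ℤ.- χ y) ℤ.* σ (x ℤ.+ y)
        position : ∀ x y → x ℤ.- (x ℤ.- y) ≡ y
        position = ℤ-Solver.solve-∀
        below-x : ∀ x c → x ℤ.- (x ℤ.- c) ≡ c ℤ.- 0ℤ
        below-x = ℤ-Solver.solve-∀
        lemma : ∀ a s → a ℤ.* (1ℤ ℤ.* (1ℤ ℤ.* s)) ≡ 1ℤ ℤ.* (a ℤ.* s)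
        lemma = ℤ-Solver.solve-∀
        zero-middle : ∀ a b s → a ℤ.* (b ℤ.* (0ℤ ℤ.* s)) ≡ 0ℤ ℤ.* (a ℤ.* s)
        zero-middle = ℤ-Solver.solve-∀
        pointwise : ∀ x y → (1ℤ ℤ.- χ y) ℤ.* (𝟙 (y ℤ.<? x) ℤ.* (𝟙 (x ℤ.- y ℤ.≟ c) ℤ.* σ (x ℤ.+ y))) ≡
          𝟙 (y ℤ.≟ x ℤ.- c) ℤ.* F x y
        pointwise x y with y ℤ.≟ x ℤ.- c
        ... | yes refl rewrite 𝟙-yes (x ℤ.- c ℤ.<? x) (<-by (ℤ.+<+ 0<n) (below-x x c))
            | 𝟙-yes (x ℤ.- (x ℤ.- c) ℤ.≟ c) (position x c) = lemma (1ℤ ℤ.- χ (x ℤ.- c)) _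
        ... | no y≢ rewrite 𝟙-no (x ℤ.- y ℤ.≟ c) (λ e → y≢ (trans (sym (position x y)) (cong (ℤ._-_ x) e))) =
          zero-middle (1ℤ ℤ.- χ y) (𝟙 (y ℤ.<? x)) (σ (x ℤ.+ y))
        inner : ∀ x → x ∈ window W →
          ⅀[ y ∈ window W ] (1ℤ ℤ.- χ y) ℤ.* (𝟙 (y ℤ.<? x) ℤ.* (𝟙 (x ℤ.- y ℤ.≟ c) ℤ.* σ (x ℤ.+ y))) ≡
          (1ℤ ℤ.- χ (x ℤ.- c)) ℤ.* σ (x ℤ.+ (x ℤ.- c))
        inner x x∈ = trans (⅀-ext (window W) (pointwise x)) (⅀-window-δ (x ℤ.- c) (F x) outside)
          where
          outside : ∣ x ℤ.- c ∣ ℕ.> W → F x (x ℤ.- c) ≡ 0ℤ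
          outside >W = cong (λ s → (1ℤ ℤ.- s) ℤ.* σ (x ℤ.+ (x ℤ.- c))) (χ-below bound≤W _ (far (x ℤ.- c) refl >W))
            where
            x≤W : x ℤ.≤ + W
            x≤W = ℤ.≤-trans (≤∣∣ x) (ℤ.+≤+ (∈-window⁻ x∈))
              where
              ≤∣∣ : ∀ z → z ℤ.≤ + ∣ z ∣
              ≤∣∣ (+ _)    = ℤ.≤-refl
              ≤∣∣ -[1+ _ ] = ℤ.-≤+
            far : ∀ z → z ≡ x ℤ.- c → ∣ z ∣ ℕ.> W → z ℤ.≤ ℤ.- + W
            far (+ m)    e >W = contradiction (ℤ.drop‿+≤+ (subst (ℤ._≤ + W) (sym e)
              (≤-by (ℤ.+-mono-≤ x≤W (ℤ.+≤+ (z≤n {n}))) (shuffle x c (+ W))))) (ℕ.<⇒≱ >W)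
              where
              shuffle : ∀ x c W → W ℤ.- (x ℤ.- c) ≡ W ℤ.+ c ℤ.- (x ℤ.+ 0ℤ)
              shuffle = ℤ-Solver.solve-∀
            far -[1+ m ] e >W = ℤ.neg-mono-≤ (ℤ.+≤+ (ℕ.<⇒≤ >W))

    hooks⁺≡pairs⁺ : ∀ {K} (bound≤K : bound ℕ.≤ K) n → 0 ℕ.< n → hooks⁺ (+ n) ≡ pairs⁺ {W} bound≤K (+ n)
    hooks⁺≡pairs⁺ _ n 0<n = trans
      (hooks-by-position n _ (λ s → 𝟙 (0ℤ ℤ.≤? s)) 0<n (λ i j → ε≡+1 {i} {j}))
      (⅀-ext (window W) (λ x → cong (ℤ._*_ (χ x ℤ.* (1ℤ ℤ.- χ (x ℤ.- + n))))
        (𝟙-⇔ (_ ℤ.≤? _) (_ ℤ.≤? _) (λ p → ≤-by p (sym (lemma x (+ n)))) (λ p → ≤-by p (lemma x (+ n))))))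
      where
      lemma : ∀ x c → x ℤ.+ (x ℤ.- c) ℤ.- 0ℤ ≡ x ℤ.+ x ℤ.- c
      lemma = ℤ-Solver.solve-∀

    hooks⁻≡pairs⁻ : ∀ {K} (bound≤K : bound ℕ.≤ K) n → 0 ℕ.< n → hooks⁻ (+ n) ≡ pairs⁻ {W} bound≤K (+ n)
    hooks⁻≡pairs⁻ _ n 0<n = trans
      (hooks-by-position n _ (λ s → 𝟙 (s ℤ.<? 0ℤ)) 0<n (λ i j → ε≡-1 {i} {j}))
      (⅀-ext (window W) (λ x → cong (ℤ._*_ (χ x ℤ.* (1ℤ ℤ.- χ (x ℤ.- + n))))
        (𝟙-⇔ (_ ℤ.<? _) (_ ℤ.<? _) (λ p → <-by p (sym (lemma x (+ n)))) (λ p → <-by p (lemma x (+ n))))))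
      where
      lemma : ∀ x c → 0ℤ ℤ.- (x ℤ.+ (x ℤ.- c)) ≡ c ℤ.- (x ℤ.+ x)
      lemma = ℤ-Solver.solve-∀

  -- For `m > 0`, the exponent of `τ m` in the hook product divided by the product of the α-powers;
  -- `hooks⁺ (g - m)` is α at `m`.
  hookDefect : ℕ → ℤ → ℤ
  hookDefect g m = hooks⁺ (m ℤ.+ + g) ℤ.+ hooks⁻ (m ℤ.- + g) ℤ.+ hooks⁺ (+ g ℤ.- m) ℤ.- hooks⁺ m ℤ.- hooks⁻ m

  D : ℕ → ℤ → ℤ
  D g z = χ (z ℤ.- + g) ℤ.- χ z

  twice-hookDefect : ∀ {K W} m g → bound ℕ.≤ K → 0 ℕ.< m → K ℕ.+ (m ℕ.+ g) ℕ.+ (m ℕ.+ g) ℕ.≤ W →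
    hookDefect g (+ m) ℤ.+ hookDefect g (+ m) ≡
    (⅀[ x ∈ window W ] D g x ℤ.* D g (x ℤ.- + m)) ℤ.-
    (⅀[ x ∈ window W ] D g x ℤ.* (𝟙 (x ℤ.≟ + m) ℤ.+ 𝟙 (x ℤ.≟ + m ℤ.+ + g) ℤ.+ 𝟙 (x ℤ.+ x ℤ.≟ + m ℤ.+ + g)))
    ℤ.+ correction W (+ g ℤ.- + m)
  twice-hookDefect {K} {W} m g bound≤K 0<m ≤W = twice-multiplicity bound≤K hooks⁺ hooks⁻ (m ℕ.+ g)
    hooks⁺-nonpositive hooks⁻-nonpositive
    (λ n 0<n _ → hooks⁺≡pairs⁺ bound≤W bound≤K n 0<n) (λ n 0<n _ → hooks⁻≡pairs⁻ bound≤W bound≤K n 0<n)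
    ≤W m g 0<m ℕ.≤-refl
    where
    bound≤W : bound ℕ.≤ W
    bound≤W = ℕ.≤-trans bound≤K (ℕ.≤-trans (ℕ.m≤m+n K _) (ℕ.≤-trans (ℕ.m≤m+n _ _) ≤W))

-- The β's of a doubled distinct core and its coding.

Unique-++⇒disjoint : ∀ {A : Set} (xs : List A) {ys z} → Unique (xs ++ ys) → z ∈ xs → z ∉ ys
Unique-++⇒disjoint (x ∷ xs) u       (here refl) z∈ys = Unique.Unique[x∷xs]⇒x∉xs u (∈-++⁺ʳ xs z∈ys)
Unique-++⇒disjoint (x ∷ xs) (_ ∷ u) (there z∈)  z∈ys = Unique-++⇒disjoint xs u z∈ z∈ys

module Coding (t : ℕ)
  (μ : Partition) (dd : DoubledDistinct μ) (core : Core (1 ℕ.+ 2 ℕ.* t) μ)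
  (v : Vector ℤ t) (coding : IsVCoding (1 ℕ.+ 2 ℕ.* t) t μ v) where

  private
    g : ℕ
    g = 1 ℕ.+ 2 ℕ.* t

  open Diagram μ
  open Doubled μ dd
  open IsVCoding coding renaming (decreasing to v-decreasing)

  0<g : 0ℤ ℤ.< + g
  0<g = ℤ.+<+ (s≤s z≤n)

  -- A one at distance `g` below a zero would give a box with hook length `g`.
  descend₁ : ∀ {z} → WordZero μ z → WordZero μ (z ℤ.- + g)
  descend₁ z∈ with WordZero⇒X z∈
  ... | i , refl with letter (X i ℤ.- + g)
  ...   | inj₁ (i′ , e) = subst (WordZero μ) (sym e) (WordZero-X i′)
  ...   | inj₂ (j , e)  = contradiction (∣-reflexive (sym (ℤ.+-injective hook≡g))) (core (suc i , suc j) (box∈boxes {i} {j} box))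
    where
    lemma : ∀ x g → x ℤ.- (x ℤ.- g) ≡ g
    lemma = ℤ-Solver.solve-∀
    box : j ℕ.< row i
    box = Y<X⇒box {i} {j} (<-by 0<g (trans (cong (ℤ._-_ (X i)) (sym e)) (trans (lemma (X i) (+ g)) (sym (ℤ.+-identityʳ (+ g))))))
    hook≡g : + hook μ (suc i , suc j) ≡ + g
    hook≡g = trans (hook≡X-Y {i} {j} box) (trans (cong (ℤ._-_ (X i)) (sym e)) (lemma (X i) (+ g)))

  descend : ∀ n {z} → WordZero μ z → WordZero μ (z ℤ.- + n ℤ.* + g)
  descend zero    {z} z∈ = subst (WordZero μ) (sym (ℤ.+-identityʳ z)) z∈
  descend (suc n) {z} z∈ = subst (WordZero μ) (lemma z (+ n) (+ g)) (descend₁ (descend n z∈))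
    where
    lemma : ∀ z n g → z ℤ.- n ℤ.* g ℤ.- g ≡ z ℤ.- (1ℤ ℤ.+ n) ℤ.* g
    lemma = ℤ-Solver.solve-∀

  -- The set {β₀, …, β_{g-1}}.
  Beta : ℤ → Set
  Beta z = WordZero μ (z ℤ.- + g) × ¬ WordZero μ z

  β∈Beta : ∀ k → Beta (β k)
  β∈Beta k with β-max k
  ... | (q , zero∈ , e) , max = subst (WordZero μ) (trans (sym (previous q (+ g) (+ toℕ k))) (cong (ℤ._- + g) (sym e))) zero∈ , ¬zero
    where
    previous : ∀ q g k → (q ℤ.+ 1ℤ) ℤ.* g ℤ.+ k ℤ.- g ≡ q ℤ.* g ℤ.+ k
    previous = ℤ-Solver.solve-∀
    next : ∀ q g k → (q ℤ.+ 1ℤ ℤ.+ 1ℤ) ℤ.* g ℤ.+ k ≡ (q ℤ.+ 1ℤ) ℤ.* g ℤ.+ k ℤ.+ g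
    next = ℤ-Solver.solve-∀
    cancel : ∀ b g → g ≡ b ℤ.+ g ℤ.- b
    cancel = ℤ-Solver.solve-∀
    ¬zero : ¬ WordZero μ (β k)
    ¬zero β-zero = ℤ.<-irrefl refl (ℤ.<-≤-trans
      (<-by 0<g (trans (sym (cancel (β k) (+ g))) (sym (ℤ.+-identityʳ (+ g)))))
      (max (β k ℤ.+ + g) (q ℤ.+ 1ℤ , subst (WordZero μ) e β-zero , trans (cong (ℤ._+ + g) e) (sym (next q (+ g) (+ toℕ k))))))

  blocks< : ∀ {p q} (k l : Fin g) → p ℤ.< q → p ℤ.* + g ℤ.+ + toℕ k ℤ.< q ℤ.* + g ℤ.+ + toℕ l
  blocks< {p} {q} k l p<q = <-by
    (ℤ.+-mono-≤-< (ℤ.*-monoʳ-≤-nonNeg (+ g) (<⇒1+≤ p<q)) (ℤ.+-mono-<-≤ (ℤ.+<+ (Fin.toℕ<n k)) (ℤ.+≤+ (z≤n {toℕ l}))))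
    (lemma p q (+ g) (+ toℕ k) (+ toℕ l))
    where
    lemma : ∀ p q g k l → q ℤ.* g ℤ.+ l ℤ.- (p ℤ.* g ℤ.+ k) ≡ q ℤ.* g ℤ.+ (g ℤ.+ l) ℤ.- ((p ℤ.+ 1ℤ) ℤ.* g ℤ.+ (k ℤ.+ 0ℤ))
    lemma = ℤ-Solver.solve-∀

  -- By descent the zeros of a residue class form a lower ray, so a one sits `g` above a zero at a
  -- single place. A `z` above the maximum contradicts `β-max`; below it, descent from the last zero
  -- would make `z` a zero.
  Beta⇒β : ∀ {z} → Beta z → ∃[ k ] z ≡ β k
  Beta⇒β {z} (zero∈ , z∉) = k , z≡β
    where
    p : ℤ
    p = (z ℤ.- + g) ℤ./ℕ g
    k<g : (z ℤ.- + g) ℤ.%ℕ g ℕ.< g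
    k<g = ℤ.n%ℕd<d (z ℤ.- + g) g
    k : Fin g
    k = fromℕ< k<g
    z-g≡ : z ℤ.- + g ≡ p ℤ.* + g ℤ.+ + toℕ k
    z-g≡ = trans (ℤ.a≡a%ℕn+[a/ℕn]*n (z ℤ.- + g) g) (trans (ℤ.+-comm _ (p ℤ.* + g)) (cong (λ r → p ℤ.* + g ℤ.+ + r) (sym (Fin.toℕ-fromℕ< k<g))))
    z≡ : z ≡ (p ℤ.+ 1ℤ) ℤ.* + g ℤ.+ + toℕ k
    z≡ = trans (lemma₁ z (+ g)) (trans (cong (ℤ._+ + g) z-g≡) (lemma₂ p (+ g) (+ toℕ k)))
      where
      lemma₁ : ∀ z g → z ≡ z ℤ.- g ℤ.+ g
      lemma₁ = ℤ-Solver.solve-∀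
      lemma₂ : ∀ p g k → p ℤ.* g ℤ.+ k ℤ.+ g ≡ (p ℤ.+ 1ℤ) ℤ.* g ℤ.+ k
      lemma₂ = ℤ-Solver.solve-∀
    z≤β : z ℤ.≤ β k
    z≤β = proj₂ (β-max k) z (p , subst (WordZero μ) z-g≡ zero∈ , z≡)
    z≡β : z ≡ β k
    z≡β with β-max k
    ... | (q , qg+k∈ , β≡) , _ with ℤ.<-cmp p q
    ...   | tri≈ _ refl _ = trans z≡ (sym β≡)
    ...   | tri> _ _ q<p = contradiction z≤β (ℤ.<⇒≱ (subst (ℤ._< z) (sym β≡)
      (subst ((q ℤ.+ 1ℤ) ℤ.* + g ℤ.+ + toℕ k ℤ.<_) (sym z≡) (blocks< k k (ℤ.+-monoˡ-< 1ℤ q<p)))))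
    ...   | tri< p<q _ _ = contradiction
      (subst (WordZero μ) below≡z (descend ∣ q ℤ.- (p ℤ.+ 1ℤ) ∣ qg+k∈)) z∉
      where
      lemma : ∀ p q g k → q ℤ.* g ℤ.+ k ℤ.- (q ℤ.- (p ℤ.+ 1ℤ)) ℤ.* g ≡ (p ℤ.+ 1ℤ) ℤ.* g ℤ.+ k
      lemma = ℤ-Solver.solve-∀
      below≡z : q ℤ.* + g ℤ.+ + toℕ k ℤ.- + ∣ q ℤ.- (p ℤ.+ 1ℤ) ∣ ℤ.* + g ≡ z
      below≡z = trans (cong (λ n → q ℤ.* + g ℤ.+ + toℕ k ℤ.- n ℤ.* + g) (ℤ.0≤i⇒+∣i∣≡i (ℤ.i≤j⇒0≤j-i (<⇒1+≤ p<q))))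
        (trans (lemma p q (+ g) (+ toℕ k)) (sym z≡))

  β-injective : ∀ {k l} → β k ≡ β l → k ≡ l
  β-injective {k} {l} β≡ with β-max k | β-max l
  ... | (p , _ , βk≡) , _ | (q , _ , βl≡) , _ with ℤ.<-cmp (p ℤ.+ 1ℤ) (q ℤ.+ 1ℤ)
  ... | tri< p<q _ _ = contradiction (trans (sym βk≡) (trans β≡ βl≡)) (ℤ.<⇒≢ (blocks< k l p<q))
  ... | tri> _ _ q<p = contradiction (trans (sym βl≡) (trans (sym β≡) βk≡)) (ℤ.<⇒≢ (blocks< l k q<p))
  ... | tri≈ _ p≡q _ = Fin.toℕ-injective (ℤ.+-injective (ℤ-Group.∙-cancelˡ ((p ℤ.+ 1ℤ) ℤ.* + g) (+ toℕ k) (+ toℕ l)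
    (trans (sym βk≡) (trans β≡ (trans βl≡ (cong (λ p → p ℤ.* + g ℤ.+ + toℕ l) (sym p≡q)))))))

  g∉Beta : ¬ Beta (+ g)
  g∉Beta (zero∈ , _) = ¬WordZero-0 (subst (WordZero μ) (ℤ.+-inverseʳ (+ g)) zero∈)

  0∈Beta : Beta 0ℤ
  0∈Beta = subst (WordZero μ) (sym (ℤ.+-identityˡ (ℤ.- + g))) (WordZero-reflect⁺ (+ g) (λ ()) g∉) , ¬WordZero-0
    where
    g∉ : ¬ WordZero μ (+ g)
    g∉ g∈ = ¬WordZero-0 (subst (WordZero μ) (ℤ.+-inverseʳ (+ g)) (descend₁ g∈))

  -- Negation exchanges zeros and ones, hence exchanges the two conditions in `Beta`. The β at 0 is
  -- an exception: its partner `g` is not in `Beta`.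
  Beta-reflect : ∀ {z} → z ≢ 0ℤ → Beta z → Beta (+ g ℤ.- z)
  Beta-reflect {z} z≢0 (z-g∈ , z∉) =
    subst (WordZero μ) (lemma₁ z (+ g)) (WordZero-reflect⁺ z z≢0 z∉) ,
    subst (λ w → ¬ WordZero μ w) (lemma₂ z (+ g)) (WordZero-reflect⁻ (z ℤ.- + g) z-g∈)
    where
    lemma₁ : ∀ z g → ℤ.- z ≡ g ℤ.- z ℤ.- g
    lemma₁ = ℤ-Solver.solve-∀
    lemma₂ : ∀ z g → ℤ.- (z ℤ.- g) ≡ g ℤ.- z
    lemma₂ = ℤ-Solver.solve-∀

  v∈Beta : ∀ i → Beta (v i)
  v∈Beta i with fromβ i
  ... | k , e = subst Beta (sym e) (β∈Beta k)

  v-injective : ∀ {i j} → v i ≡ v j → i ≡ j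
  v-injective {i} {j} e with Fin.<-cmp i j
  ... | tri< i<j _ _ = contradiction (sym e) (ℤ.<⇒≢ (v-decreasing i j i<j))
  ... | tri≈ _ i≡j _ = i≡j
  ... | tri> _ _ j<i = contradiction e (ℤ.<⇒≢ (v-decreasing j i j<i))

  vs βs letters : List ℤ
  vs      = tabulate v
  βs      = tabulate β
  letters = 0ℤ ∷ vs ++ map (λ z → + g ℤ.- z) vs

  private
    reflect² : ∀ z → + g ℤ.- (+ g ℤ.- z) ≡ z
    reflect² z = lemma (+ g) z
      where
      lemma : ∀ g z → g ℤ.- (g ℤ.- z) ≡ z
      lemma = ℤ-Solver.solve-∀

    βs-unique : Unique βs
    βs-unique = Unique.tabulate⁺ β-injective

    length-βs : length βs ≡ length letters
    length-βs = begin
      length βs                              ≡⟨ List.length-tabulate β ⟩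
      suc (t ℕ.+ (t ℕ.+ 0))                  ≡⟨ cong (λ n → suc (t ℕ.+ n)) (ℕ.+-identityʳ t) ⟩
      suc (t ℕ.+ t)                          ≡⟨ cong suc (cong₂ ℕ._+_ (List.length-tabulate v)
                                                  (trans (List.length-map _ vs) (List.length-tabulate v))) ⟨
      suc (length vs ℕ.+ length (map _ vs))  ≡⟨ cong suc (List.length-++ vs) ⟨
      length letters                         ∎
      where open ≡-Reasoning

    -- `z ↦ g - z` has no fixed point, so every β lies strictly on one side of g/2.
    g-odd : ∀ z → z ℤ.+ z ≢ + g
    g-odd (+ n) e with ℕ.≤-<-connex n t
    ... | inj₁ n≤t = ℕ.<-irrefl (ℤ.+-injective e) (s≤s (ℕ.+-mono-≤ n≤t (ℕ.≤-trans n≤t (ℕ.m≤m+n t 0))))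
    ... | inj₂ t<n = ℕ.<-irrefl (sym (ℤ.+-injective e)) (ℕ.+-mono-≤-< t<n (ℕ.≤-<-trans (ℕ.≤-reflexive (ℕ.+-identityʳ t)) t<n))

    small : ∀ {z} → ¬ + g ℤ.< z ℤ.+ z → z ℤ.+ z ℤ.< + g
    small {z} ≮ with ℤ.<-cmp (+ g) (z ℤ.+ z)
    ... | tri< < _ _ = contradiction < ≮
    ... | tri≈ _ e _ = contradiction (sym e) (g-odd z)
    ... | tri> _ _ > = >

    reflect-small : ∀ {z} → z ℤ.+ z ℤ.< + g → + g ℤ.< (+ g ℤ.- z) ℤ.+ (+ g ℤ.- z)
    reflect-small {z} z< = <-by z< (lemma (+ g) z)
      where
      lemma : ∀ g z → g ℤ.- z ℤ.+ (g ℤ.- z) ℤ.- g ≡ g ℤ.- (z ℤ.+ z)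
      lemma = ℤ-Solver.solve-∀

    -- If some vᵢ were less than g/2, then every β would be 0, some vⱼ or some
    -- g - vⱼ, so that these integers were distinct; but g - vᵢ is among the vⱼ.
    module Small (i₀ : Fin t) (v< : v i₀ ℤ.+ v i₀ ℤ.< + g) where

      large∈vs : ∀ {z} → Beta z → + g ℤ.< z ℤ.+ z → z ∈ vs
      large∈vs {z} z∈ z> with Beta⇒β z∈
      ... | k , refl with largest k
      ...   | inj₁ (i , vi≡β) = subst (_∈ vs) vi≡β (∈-tabulate⁺ i)
      ...   | inj₂ β<         = contradiction (ℤ.<-trans v< z>) (ℤ.<-asym (ℤ.+-mono-< (β< i₀) (β< i₀)))

      βs⊆letters : ∀ {z} → z ∈ βs → z ∈ letters
      βs⊆letters {z} z∈ with ∈-tabulate⁻ {f = β} z∈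
      ... | k , refl with z ℤ.≟ 0ℤ | + g ℤ.<? z ℤ.+ z
      ...   | yes z≡0 | _      = here z≡0
      ...   | no _    | yes z> = there (∈-++⁺ˡ (large∈vs (β∈Beta k) z>))
      ...   | no z≢0  | no z≯  = there (∈-++⁺ʳ vs (subst (_∈ map _ vs) (reflect² z) (∈-map⁺ _
        (large∈vs (Beta-reflect z≢0 (β∈Beta k)) (reflect-small {z} (small {z} z≯))))))

      letters-unique : Unique letters
      letters-unique = ↭ₛ.Unique-resp-↭ (setoid ℤ) (↭⇒↭ₛ (Unique-⊆⇒↭ βs-unique βs⊆letters (ℕ.≤-reflexive (sym length-βs)))) βs-unique

      contradictory : ∀ {A : Set} → A
      contradictory with v i₀ ℤ.≟ 0ℤ | letters-unique
      ... | yes v≡0 | u       = contradiction (∈-++⁺ˡ (subst (_∈ vs) v≡0 (∈-tabulate⁺ i₀))) (Unique.Unique[x∷xs]⇒x∉xs u)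
      ... | no  v≢0 | (_ ∷ u) = contradiction
        (subst (_∈ map _ vs) (reflect² (v i₀)) (∈-map⁺ _ (large∈vs (Beta-reflect v≢0 (v∈Beta i₀)) (reflect-small {v i₀} v<))))
        (Unique-++⇒disjoint vs u (∈-tabulate⁺ i₀))

  -- In terms of the half-integers, every `rᵢ` is positive.
  g<2v : ∀ i → + g ℤ.< v i ℤ.+ v i
  g<2v i with + g ℤ.<? v i ℤ.+ v i
  ... | yes v> = v>
  ... | no  v≯ = Small.contradictory i (small {v i} v≯)

  0<v : ∀ i → 0ℤ ℤ.< v i
  0<v i = ℤ.≰⇒> λ v≤0 → ℤ.<-asym (g<2v i) (ℤ.≤-<-trans (ℤ.+-mono-≤ v≤0 v≤0) 0<g)

  g<v+v : ∀ i j → + g ℤ.< v i ℤ.+ v j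
  g<v+v i j with Fin.<-cmp i j
  ... | tri< i<j _ _ = ℤ.<-trans (g<2v j) (ℤ.+-monoˡ-< (v j) (v-decreasing i j i<j))
  ... | tri≈ _ refl _ = g<2v i
  ... | tri> _ _ j<i = ℤ.<-trans (g<2v i) (ℤ.+-monoʳ-< (v i) (v-decreasing j i j<i))

  letters⊆Beta : ∀ {z} → z ∈ letters → Beta z
  letters⊆Beta (here refl) = 0∈Beta
  letters⊆Beta (there z∈) with ∈-++⁻ vs z∈
  ... | inj₁ z∈vs with ∈-tabulate⁻ {f = v} z∈vs
  ...   | i , refl = v∈Beta i
  letters⊆Beta (there z∈) | inj₂ z∈map with ∈-map⁻ _ z∈map
  ...   | w , w∈vs , refl with ∈-tabulate⁻ {f = v} w∈vs
  ...     | i , refl = Beta-reflect (λ v≡0 → ℤ.<-irrefl (sym v≡0) (0<v i)) (v∈Beta i)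

  letters-unique : Unique letters
  letters-unique = All.tabulate 0≢ ∷ Unique.++⁺ vs-unique (Unique.map⁺ (λ {z} {w} e → trans (sym (reflect² z)) (trans (cong (ℤ._-_ (+ g)) e) (reflect² w))) vs-unique) disjoint
    where
    vs-unique : Unique vs
    vs-unique = Unique.tabulate⁺ v-injective
    0≢ : ∀ {z} → z ∈ vs ++ map (λ z → + g ℤ.- z) vs → 0ℤ ≢ z
    0≢ z∈ refl with ∈-++⁻ vs z∈
    ... | inj₁ z∈vs with ∈-tabulate⁻ {f = v} z∈vs
    ...   | i , e = ℤ.<-irrefl e (0<v i)
    0≢ z∈ refl | inj₂ z∈map with ∈-map⁻ _ z∈map
    ...   | w , w∈vs , e with ∈-tabulate⁻ {f = v} w∈vs
    ...     | i , refl = g∉Beta (subst Beta (sym (ℤ.i-j≡0⇒i≡j (+ g) (v i) (sym e))) (v∈Beta i))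
    disjoint : ∀ {z} → ¬ (z ∈ vs × z ∈ map (λ z → + g ℤ.- z) vs)
    disjoint (z∈vs , z∈map) with ∈-map⁻ _ z∈map
    ... | w , w∈vs , e with ∈-tabulate⁻ {f = v} z∈vs | ∈-tabulate⁻ {f = v} w∈vs
    ...   | i , refl | j , refl = ℤ.<-irrefl (sym (trans (cong (ℤ._+ v j) e) (lemma (+ g) (v j)))) (g<v+v i j)
      where
      lemma : ∀ g z → g ℤ.- z ℤ.+ z ≡ g
      lemma = ℤ-Solver.solve-∀

  Beta⇒letters : ∀ {z} → Beta z → z ∈ letters
  Beta⇒letters z∈ with Beta⇒β z∈
  ... | k , refl = ∈-resp-↭ (↭-sym letters↭βs) (∈-tabulate⁺ {f = β} k)
    where
    ⊆βs : ∀ {z} → z ∈ letters → z ∈ βs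
    ⊆βs z∈ with Beta⇒β (letters⊆Beta z∈)
    ... | k , refl = ∈-tabulate⁺ {f = β} k
    letters↭βs : letters ↭ βs
    letters↭βs = Unique-⊆⇒↭ letters-unique ⊆βs (ℕ.≤-reflexive length-βs)

  -- The value -1 would mean a zero at `z` and a one at `z - g`, which `descend₁` excludes.
  D≡multiplicity : ∀ z → D g z ≡ multiplicity ℤ._≟_ z letters
  D≡multiplicity z with WordZero? (z ℤ.- + g) | WordZero? z
  ... | yes z-g∈ | no z∉  = sym (multiplicity-unique ℤ._≟_ letters-unique (Beta⇒letters (z-g∈ , z∉)))
  ... | yes _    | yes z∈ = sym (multiplicity-∉ ℤ._≟_ {z} {letters} (λ z∈L → proj₂ (letters⊆Beta z∈L) z∈))
  ... | no  z-g∉ | no _   = sym (multiplicity-∉ ℤ._≟_ {z} {letters} (λ z∈L → z-g∉ (proj₁ (letters⊆Beta z∈L))))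
  ... | no  z-g∉ | yes z∈ = contradiction (descend₁ z∈) z-g∉

  ⅀-D : ∀ {K W} → bound ℕ.≤ K → K ℕ.+ g ℕ.≤ W → (F : ℤ → ℤ) → ⅀[ z ∈ window W ] D g z ℤ.* F z ≡ ⅀ letters F
  ⅀-D {K} {W} bound≤K K+g≤W F = begin
    ⅀[ z ∈ window W ] D g z ℤ.* F z                                  ≡⟨ ⅀-ext (window W) (λ z → sym (pointwise z)) ⟩
    ⅀[ z ∈ window W ] ⅀[ b ∈ letters ] 𝟙 (b ℤ.≟ z) ℤ.* F z           ≡⟨ ⅀-swap (window W) letters _ ⟩
    ⅀[ b ∈ letters ] ⅀[ z ∈ window W ] 𝟙 (b ℤ.≟ z) ℤ.* F z           ≡⟨ ⅀-cong letters once ⟩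
    ⅀ letters F                                                      ∎
    where
    open ≡-Reasoning
    Beta-bounded : ∀ {z} → Beta z → ∣ z ∣ ℕ.≤ W
    Beta-bounded {+ n} (z-g∈ , _) = ℕ.≮⇒≥ λ W<n → contradiction
      (trans (sym (𝟙-yes (WordZero? (+ n ℤ.- + g)) z-g∈))
        (χ-above bound≤K _ (≤-by (ℤ.+≤+ (ℕ.≤-trans K+g≤W (ℕ.<⇒≤ W<n))) (lemma (+ n) (+ g) (+ K))))) λ ()
      where
      lemma : ∀ n g K → n ℤ.- g ℤ.- K ≡ n ℤ.- (K ℤ.+ g)
      lemma = ℤ-Solver.solve-∀
    Beta-bounded { -[1+ n ]} (_ , z∉) = ℕ.≮⇒≥ λ W<n → contradiction
      (trans (sym (𝟙-no (WordZero? -[1+ n ]) z∉))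
        (χ-below bound≤K _ (ℤ.neg-mono-≤ (ℤ.+≤+ (ℕ.≤-trans (ℕ.≤-trans (ℕ.m≤m+n K g) K+g≤W) (ℕ.<⇒≤ W<n)))))) λ ()
    pointwise : ∀ z → ⅀[ b ∈ letters ] 𝟙 (b ℤ.≟ z) ℤ.* F z ≡ D g z ℤ.* F z
    pointwise z = trans (⅀-*ʳ letters (λ b → 𝟙 (b ℤ.≟ z)) (F z)) (cong (ℤ._* F z) (sym (D≡multiplicity z)))
    once : ∀ {b} → b ∈ letters → ⅀[ z ∈ window W ] 𝟙 (b ℤ.≟ z) ℤ.* F z ≡ F b
    once {b} b∈ = trans (⅀-ext (window W) (λ z → cong (ℤ._* F z) (𝟙-⇔ (b ℤ.≟ z) (z ℤ.≟ b) sym sym)))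
      (⅀-δ-∈ ℤ._≟_ F (window-unique W) (∈-window⁺ b (Beta-bounded (letters⊆Beta b∈))))

-- Counting the differences of the β's.

twice-injective : ∀ {i j} → i ℤ.+ i ≡ j ℤ.+ j → i ≡ j
twice-injective {i} {j} e = ℤ.*-cancelˡ-≡ (+ 2) i j (trans (lemma i) (trans e (sym (lemma j))))
  where
  lemma : ∀ i → + 2 ℤ.* i ≡ i ℤ.+ i
  lemma = ℤ-Solver.solve-∀

≟-by : ∀ i j k l → j ℤ.- i ≡ l ℤ.- k → 𝟙 (i ℤ.≟ j) ≡ 𝟙 (k ℤ.≟ l)
≟-by i j k l e = 𝟙-⇔ (i ℤ.≟ j) (k ℤ.≟ l) (to i j k l e) (to k l i j (sym e))
  where
  to : ∀ i j k l → j ℤ.- i ≡ l ℤ.- k → i ≡ j → k ≡ l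
  to i j k l e refl = sym (ℤ.i-j≡0⇒i≡j l k (trans (sym e) (ℤ.+-inverseʳ i)))

≟-sym-by : ∀ i j k l → j ℤ.- i ≡ k ℤ.- l → 𝟙 (i ℤ.≟ j) ≡ 𝟙 (k ℤ.≟ l)
≟-sym-by i j k l e = trans (≟-by i j l k e) (𝟙-⇔ (l ℤ.≟ k) (k ℤ.≟ l) sym sym)

⅀-tabulate : ∀ {A : Set} {n} (h : Fin n → A) (f : A → ℤ) → ⅀ (tabulate h) f ≡ ⅀[ i ∈ allFin n ] f (h i)
⅀-tabulate {n = n} h f = trans (cong (λ xs → ⅀ xs f) (sym (List.map-tabulate id h))) (⅀-map (allFin n) h f)

pairMultiplicity : ∀ g {t} → Vector ℤ t → ℤ → ℤ
pairMultiplicity g {t} v m = ⅀[ (i , j) ∈ pairs< t ] 𝟙 (r-diff g v i j ℤ.≟ m) ℤ.+ 𝟙 (r-sum g v i j ℤ.≟ m)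

module Differences (t : ℕ)
  (μ : Partition) (dd : DoubledDistinct μ) (core : Core (1 ℕ.+ 2 ℕ.* t) μ)
  (v : Vector ℤ t) (coding : IsVCoding (1 ℕ.+ 2 ℕ.* t) t μ v) where

  private
    g : ℕ
    g = 1 ℕ.+ 2 ℕ.* t

  open Diagram μ
  open Doubled μ dd
  open Coding t μ dd core v coding
  open IsVCoding coding using () renaming (decreasing to v-decreasing)

  ⅀-letters : ∀ F → ⅀ letters F ≡ F 0ℤ ℤ.+ (⅀[ i ∈ allFin t ] F (v i) ℤ.+ F (+ g ℤ.- v i))
  ⅀-letters F = cong (ℤ._+_ (F 0ℤ)) (begin
    ⅀ (vs ++ map (λ z → + g ℤ.- z) vs) F                 ≡⟨ ⅀-++ vs _ F ⟩
    ⅀ vs F ℤ.+ ⅀ (map (λ z → + g ℤ.- z) vs) F            ≡⟨ cong (ℤ._+_ (⅀ vs F)) (⅀-map vs _ F) ⟩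
    ⅀ vs F ℤ.+ (⅀[ z ∈ vs ] F (+ g ℤ.- z))               ≡⟨ cong₂ ℤ._+_ (⅀-tabulate v F) (⅀-tabulate v (λ z → F (+ g ℤ.- z))) ⟩
    (⅀[ i ∈ allFin t ] F (v i)) ℤ.+ (⅀[ i ∈ allFin t ] F (+ g ℤ.- v i)) ≡⟨ ⅀-+ (allFin t) _ _ ⟨
    ⅀[ i ∈ allFin t ] F (v i) ℤ.+ F (+ g ℤ.- v i)        ∎)
    where
    open ≡-Reasoning

  module _ (n : ℕ) where
    private
      m G : ℤ
      m = + suc n
      G = + g
      0<m : 0ℤ ℤ.< m
      0<m = ℤ.+<+ (s≤s z≤n)

      δ σ pairTerm : Fin t → Fin t → ℤ
      δ i j = 𝟙 (r-diff g v i j ℤ.≟ m)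
      σ i j = 𝟙 (r-sum g v i j ℤ.≟ m)
      pairTerm i j = 𝟙 (i Fin.<? j) ℤ.* (δ i j ℤ.+ σ i j)

      -- The contribution of a single β: once `⅀-D` has replaced the sums weighted by `D g` in
      -- `twice-hookDefect` by sums over `letters`, their difference is `⅀ letters f`.
      f : ℤ → ℤ
      f b = multiplicity ℤ._≟_ (b ℤ.- m) letters ℤ.- (𝟙 (b ℤ.≟ m) ℤ.+ 𝟙 (b ℤ.≟ m ℤ.+ G) ℤ.+ 𝟙 (b ℤ.+ b ℤ.≟ m ℤ.+ G))

      0<⇒≢0 : ∀ i j {k} → 0ℤ ℤ.< k → j ℤ.- i ≡ k → 𝟙 (i ℤ.≟ j) ≡ 0ℤ
      0<⇒≢0 i j 0<k e = 𝟙-no (i ℤ.≟ j) λ { refl → ℤ.<-irrefl (trans (sym (ℤ.+-inverseʳ i)) e) 0<k }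

      0<⇒≢0′ : ∀ i j {k} → 0ℤ ℤ.< k → i ℤ.- j ≡ k → 𝟙 (i ℤ.≟ j) ≡ 0ℤ
      0<⇒≢0′ i j 0<k e = trans (𝟙-⇔ (i ℤ.≟ j) (j ℤ.≟ i) sym sym) (0<⇒≢0 j i 0<k e)

      0<G : 0ℤ ℤ.< G
      0<G = 0<g
      0<+ : ∀ {i j} → 0ℤ ℤ.< i → 0ℤ ℤ.< j → 0ℤ ℤ.< i ℤ.+ j
      0<+ = ℤ.+-mono-<
      0<vv : ∀ i j → 0ℤ ℤ.< v i ℤ.+ v j ℤ.- G
      0<vv i j = <-by (g<v+v i j) (lemma (v i ℤ.+ v j) G)
        where
        lemma : ∀ s G → s ℤ.- G ℤ.- 0ℤ ≡ s ℤ.- G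
        lemma = ℤ-Solver.solve-∀

    -- The only positive differences that start from 0 are the `0 - (g - vᵢ)` with `vᵢ > g`.
    f-0 : f 0ℤ ≡ ⅀[ i ∈ allFin t ] 𝟙 (v i ℤ.≟ m ℤ.+ G)
    f-0 = begin
      f 0ℤ
        ≡⟨ cong₂ ℤ._-_ (⅀-letters (λ b → 𝟙 (b ℤ.≟ 0ℤ ℤ.- m)))
             (cong₂ ℤ._+_ (cong₂ ℤ._+_ (0<⇒≢0 0ℤ m 0<m (e₁ m)) (0<⇒≢0 0ℤ (m ℤ.+ G) (0<+ 0<m 0<G) (e₁ (m ℤ.+ G)))) (0<⇒≢0 (0ℤ ℤ.+ 0ℤ) (m ℤ.+ G) (0<+ 0<m 0<G) (e₂ (m ℤ.+ G)))) ⟩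
      𝟙 (0ℤ ℤ.≟ 0ℤ ℤ.- m) ℤ.+ (⅀[ i ∈ allFin t ] 𝟙 (v i ℤ.≟ 0ℤ ℤ.- m) ℤ.+ 𝟙 (G ℤ.- v i ℤ.≟ 0ℤ ℤ.- m)) ℤ.- 0ℤ
        ≡⟨ cong₂ (λ s u → s ℤ.+ u ℤ.- 0ℤ) (0<⇒≢0′ 0ℤ (0ℤ ℤ.- m) 0<m (e₃ m 0ℤ)) (⅀-ext (allFin t) (λ i →
             cong₂ ℤ._+_ (0<⇒≢0′ (v i) (0ℤ ℤ.- m) (0<+ (0<v i) 0<m) (e₄ m (v i))) (≟-sym-by (G ℤ.- v i) (0ℤ ℤ.- m) (v i) (m ℤ.+ G) (e₅ m G (v i))))) ⟩
      0ℤ ℤ.+ (⅀[ i ∈ allFin t ] 0ℤ ℤ.+ 𝟙 (v i ℤ.≟ m ℤ.+ G)) ℤ.- 0ℤ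
        ≡⟨ trans (e₆ (⅀[ i ∈ allFin t ] 0ℤ ℤ.+ 𝟙 (v i ℤ.≟ m ℤ.+ G))) (⅀-ext (allFin t) (λ i → ℤ.+-identityˡ (𝟙 (v i ℤ.≟ m ℤ.+ G)))) ⟩
      ⅀[ i ∈ allFin t ] 𝟙 (v i ℤ.≟ m ℤ.+ G) ∎
      where
      open ≡-Reasoning
      e₁ : ∀ m → m ℤ.- 0ℤ ≡ m
      e₁ = ℤ-Solver.solve-∀
      e₂ : ∀ m → m ℤ.- (0ℤ ℤ.+ 0ℤ) ≡ m
      e₂ = ℤ-Solver.solve-∀
      e₃ : ∀ m z → z ℤ.- (z ℤ.- m) ≡ m
      e₃ = ℤ-Solver.solve-∀
      e₄ : ∀ m v → v ℤ.- (0ℤ ℤ.- m) ≡ v ℤ.+ m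
      e₄ = ℤ-Solver.solve-∀
      e₅ : ∀ m G v → 0ℤ ℤ.- m ℤ.- (G ℤ.- v) ≡ v ℤ.- (m ℤ.+ G)
      e₅ = ℤ-Solver.solve-∀
      e₆ : ∀ s → 0ℤ ℤ.+ s ℤ.- 0ℤ ≡ s
      e₆ = ℤ-Solver.solve-∀

    -- The difference `vᵢ - 0` cancels the indicator of `b = m`; those with `vⱼ` and `g - vⱼ` are
    -- `rᵢ - rⱼ` and `rᵢ + rⱼ`. Of the two remaining corrections, one will cancel `f-0` and the
    -- other removes `rᵢ + rᵢ`.
    f-v : ∀ i → f (v i) ≡ (⅀[ j ∈ allFin t ] δ i j ℤ.+ σ i j) ℤ.- 𝟙 (v i ℤ.≟ m ℤ.+ G) ℤ.- σ i i
    f-v i = begin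
      f (v i)
        ≡⟨ cong (λ s → s ℤ.- (𝟙 (v i ℤ.≟ m) ℤ.+ 𝟙 (v i ℤ.≟ m ℤ.+ G) ℤ.+ 𝟙 (v i ℤ.+ v i ℤ.≟ m ℤ.+ G))) (⅀-letters (λ b → 𝟙 (b ℤ.≟ v i ℤ.- m))) ⟩
      𝟙 (0ℤ ℤ.≟ v i ℤ.- m) ℤ.+ (⅀[ j ∈ allFin t ] 𝟙 (v j ℤ.≟ v i ℤ.- m) ℤ.+ 𝟙 (G ℤ.- v j ℤ.≟ v i ℤ.- m)) ℤ.-
        (𝟙 (v i ℤ.≟ m) ℤ.+ 𝟙 (v i ℤ.≟ m ℤ.+ G) ℤ.+ 𝟙 (v i ℤ.+ v i ℤ.≟ m ℤ.+ G))
        ≡⟨ cong₂ (λ s u → s ℤ.- (𝟙 (v i ℤ.≟ m) ℤ.+ 𝟙 (v i ℤ.≟ m ℤ.+ G) ℤ.+ u))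
             (cong₂ ℤ._+_ (≟-sym-by 0ℤ (v i ℤ.- m) (v i) m (e₁ (v i) m))
               (⅀-ext (allFin t) (λ j → cong₂ ℤ._+_ (≟-sym-by (v j) (v i ℤ.- m) (r-diff g v i j) m (e₂ (v i) (v j) m)) (≟-sym-by (G ℤ.- v j) (v i ℤ.- m) (r-sum g v i j) m (e₃ (v i) (v j) m G)))))
             (≟-by (v i ℤ.+ v i) (m ℤ.+ G) (r-sum g v i i) m (e₄ (v i) m G)) ⟩
      𝟙 (v i ℤ.≟ m) ℤ.+ (⅀[ j ∈ allFin t ] δ i j ℤ.+ σ i j) ℤ.- (𝟙 (v i ℤ.≟ m) ℤ.+ 𝟙 (v i ℤ.≟ m ℤ.+ G) ℤ.+ σ i i)
        ≡⟨ cancel (𝟙 (v i ℤ.≟ m)) (⅀[ j ∈ allFin t ] δ i j ℤ.+ σ i j) (𝟙 (v i ℤ.≟ m ℤ.+ G)) (σ i i) ⟩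
      (⅀[ j ∈ allFin t ] δ i j ℤ.+ σ i j) ℤ.- 𝟙 (v i ℤ.≟ m ℤ.+ G) ℤ.- σ i i ∎
      where
      open ≡-Reasoning
      e₁ : ∀ v m → v ℤ.- m ℤ.- 0ℤ ≡ v ℤ.- m
      e₁ = ℤ-Solver.solve-∀
      e₂ : ∀ v w m → v ℤ.- m ℤ.- w ≡ v ℤ.- w ℤ.- m
      e₂ = ℤ-Solver.solve-∀
      e₃ : ∀ v w m G → v ℤ.- m ℤ.- (G ℤ.- w) ≡ v ℤ.+ w ℤ.- G ℤ.- m
      e₃ = ℤ-Solver.solve-∀
      e₄ : ∀ v m G → m ℤ.+ G ℤ.- (v ℤ.+ v) ≡ m ℤ.- (v ℤ.+ v ℤ.- G)
      e₄ = ℤ-Solver.solve-∀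
      cancel : ∀ a s b c → a ℤ.+ s ℤ.- (a ℤ.+ b ℤ.+ c) ≡ s ℤ.- b ℤ.- c
      cancel = ℤ-Solver.solve-∀

    -- The difference with 0 again cancels the indicator of `b = m`. Those with `vⱼ` are
    -- `- (rᵢ + rⱼ)`, hence negative, and those with `g - vⱼ` are `rⱼ - rᵢ`.
    f-g-v : ∀ i → f (G ℤ.- v i) ≡ ⅀[ j ∈ allFin t ] δ j i
    f-g-v i = begin
      f (G ℤ.- v i)
        ≡⟨ cong₂ ℤ._-_ (⅀-letters (λ b → 𝟙 (b ℤ.≟ G ℤ.- v i ℤ.- m)))
             (cong₂ ℤ._+_ (cong (ℤ._+_ (𝟙 (G ℤ.- v i ℤ.≟ m))) (0<⇒≢0 (G ℤ.- v i) (m ℤ.+ G) (0<+ 0<m (0<v i)) (e₁ (v i) m G)))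
                          (0<⇒≢0 (G ℤ.- v i ℤ.+ (G ℤ.- v i)) (m ℤ.+ G) (0<+ 0<m (0<vv i i)) (e₂ (v i) m G))) ⟩
      𝟙 (0ℤ ℤ.≟ G ℤ.- v i ℤ.- m) ℤ.+ (⅀[ j ∈ allFin t ] 𝟙 (v j ℤ.≟ G ℤ.- v i ℤ.- m) ℤ.+ 𝟙 (G ℤ.- v j ℤ.≟ G ℤ.- v i ℤ.- m)) ℤ.-
        (𝟙 (G ℤ.- v i ℤ.≟ m) ℤ.+ 0ℤ ℤ.+ 0ℤ)
        ≡⟨ cong₂ (λ s u → s ℤ.+ u ℤ.- (𝟙 (G ℤ.- v i ℤ.≟ m) ℤ.+ 0ℤ ℤ.+ 0ℤ)) (≟-sym-by 0ℤ (G ℤ.- v i ℤ.- m) (G ℤ.- v i) m (e₃ (v i) m G))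
             (⅀-ext (allFin t) (λ j → trans (cong₂ ℤ._+_ (0<⇒≢0′ (v j) (G ℤ.- v i ℤ.- m) (0<+ 0<m (0<vv i j)) (e₄ (v i) (v j) m G)) (≟-sym-by (G ℤ.- v j) (G ℤ.- v i ℤ.- m) (r-diff g v j i) m (e₅ (v i) (v j) m G))) (ℤ.+-identityˡ (δ j i)))) ⟩
      𝟙 (G ℤ.- v i ℤ.≟ m) ℤ.+ (⅀[ j ∈ allFin t ] δ j i) ℤ.- (𝟙 (G ℤ.- v i ℤ.≟ m) ℤ.+ 0ℤ ℤ.+ 0ℤ)
        ≡⟨ cancel (𝟙 (G ℤ.- v i ℤ.≟ m)) (⅀[ j ∈ allFin t ] δ j i) ⟩
      ⅀[ j ∈ allFin t ] δ j i ∎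
      where
      open ≡-Reasoning
      e₁ : ∀ v m G → m ℤ.+ G ℤ.- (G ℤ.- v) ≡ m ℤ.+ v
      e₁ = ℤ-Solver.solve-∀
      e₂ : ∀ v m G → m ℤ.+ G ℤ.- (G ℤ.- v ℤ.+ (G ℤ.- v)) ≡ m ℤ.+ (v ℤ.+ v ℤ.- G)
      e₂ = ℤ-Solver.solve-∀
      e₃ : ∀ v m G → G ℤ.- v ℤ.- m ℤ.- 0ℤ ≡ G ℤ.- v ℤ.- m
      e₃ = ℤ-Solver.solve-∀
      e₄ : ∀ v w m G → w ℤ.- (G ℤ.- v ℤ.- m) ≡ m ℤ.+ (v ℤ.+ w ℤ.- G)
      e₄ = ℤ-Solver.solve-∀
      e₅ : ∀ v w m G → G ℤ.- v ℤ.- m ℤ.- (G ℤ.- w) ≡ w ℤ.- v ℤ.- m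
      e₅ = ℤ-Solver.solve-∀
      cancel : ∀ a s → a ℤ.+ s ℤ.- (a ℤ.+ 0ℤ ℤ.+ 0ℤ) ≡ s
      cancel = ℤ-Solver.solve-∀

    private
      δ≡0 : ∀ {i j} → v i ℤ.≤ v j → δ i j ≡ 0ℤ
      δ≡0 {i} {j} vi≤vj = 𝟙-no (_ ℤ.≟ _) λ e → ℤ.<-irrefl refl (ℤ.<-≤-trans (subst (0ℤ ℤ.<_) (sym e) 0<m) (≤-by vi≤vj (lemma (v i) (v j))))
        where
        lemma : ∀ v w → 0ℤ ℤ.- (v ℤ.- w) ≡ w ℤ.- v
        lemma = ℤ-Solver.solve-∀

      σ-sym : ∀ i j → σ i j ≡ σ j i
      σ-sym i j = cong (λ s → 𝟙 (s ℤ.- G ℤ.≟ m)) (ℤ.+-comm (v i) (v j))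

      -- As `v` is decreasing, `δ i j` can be nonzero only for `i < j`; the symmetric `σ` is
      -- assigned to whichever order is increasing, and the case `i = j` is split off.
      split-pairs : ∀ i j → δ i j ℤ.+ σ i j ℤ.+ δ j i ≡ pairTerm i j ℤ.+ pairTerm j i ℤ.+ 𝟙 (j Fin.≟ i) ℤ.* σ i j
      split-pairs i j with Fin.<-cmp i j
      ... | tri< i<j i≢j j≮i
        rewrite δ≡0 {j} {i} (ℤ.<⇒≤ (v-decreasing i j i<j)) | 𝟙-yes (i Fin.<? j) i<j | 𝟙-no (j Fin.<? i) j≮i
        | 𝟙-no (j Fin.≟ i) (i≢j ∘ sym) = lemma (δ i j ℤ.+ σ i j)
        where
        lemma : ∀ a → a ℤ.+ 0ℤ ≡ 1ℤ ℤ.* a ℤ.+ 0ℤ ℤ.+ 0ℤ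
        lemma = ℤ-Solver.solve-∀
      ... | tri≈ i≮i refl _
        rewrite δ≡0 {i} {i} ℤ.≤-refl | 𝟙-no (i Fin.<? i) i≮i | 𝟙-yes (i Fin.≟ i) refl = lemma (σ i i)
        where
        lemma : ∀ a → 0ℤ ℤ.+ a ℤ.+ 0ℤ ≡ 0ℤ ℤ.+ 0ℤ ℤ.+ 1ℤ ℤ.* a
        lemma = ℤ-Solver.solve-∀
      ... | tri> i≮j i≢j j<i
        rewrite δ≡0 {i} {j} (ℤ.<⇒≤ (v-decreasing j i j<i)) | 𝟙-no (i Fin.<? j) i≮j | 𝟙-yes (j Fin.<? i) j<i
        | 𝟙-no (j Fin.≟ i) (i≢j ∘ sym) | σ-sym i j = lemma (σ j i) (δ j i)
        where
        lemma : ∀ a b → 0ℤ ℤ.+ a ℤ.+ b ≡ 0ℤ ℤ.+ 1ℤ ℤ.* (b ℤ.+ a) ℤ.+ 0ℤ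
        lemma = ℤ-Solver.solve-∀

      T : List (Fin t)
      T = allFin t

      pairMultiplicity≡ : pairMultiplicity g v m ≡ ⅀[ i ∈ T ] ⅀[ j ∈ T ] pairTerm i j
      pairMultiplicity≡ = trans (⅀-filter (λ (i , j) → i Fin.<? j) (cartesianProduct T T) _) (⅀-cartesianProduct T T _)

      diagonal-sum : ∀ i → ⅀[ j ∈ T ] 𝟙 (j Fin.≟ i) ℤ.* σ i j ≡ σ i i
      diagonal-sum i = ⅀-δ-∈ Fin._≟_ (σ i) (Unique.allFin⁺ t) (∈-allFin i)

    -- For `i < j` the integer `rᵢ - rⱼ` arises as `vᵢ - vⱼ` and as `(g - vⱼ) - (g - vᵢ)`, and
    -- `rᵢ + rⱼ` as `vᵢ - (g - vⱼ)` and as `vⱼ - (g - vᵢ)`. The subtracted indicators take away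
    -- precisely the differences that involve 0 and the `rᵢ + rᵢ`.
    ⅀-f : ⅀ letters f ≡ pairMultiplicity g v m ℤ.+ pairMultiplicity g v m
    ⅀-f = begin
      ⅀ letters f
        ≡⟨ ⅀-letters f ⟩
      f 0ℤ ℤ.+ (⅀[ i ∈ T ] f (v i) ℤ.+ f (G ℤ.- v i))
        ≡⟨ cong (λ s → s ℤ.+ (⅀[ i ∈ T ] f (v i) ℤ.+ f (G ℤ.- v i))) f-0 ⟩
      (⅀[ i ∈ T ] 𝟙 (v i ℤ.≟ m ℤ.+ G)) ℤ.+ (⅀[ i ∈ T ] f (v i) ℤ.+ f (G ℤ.- v i))
        ≡⟨ ⅀-+ T _ _ ⟨
      ⅀[ i ∈ T ] 𝟙 (v i ℤ.≟ m ℤ.+ G) ℤ.+ (f (v i) ℤ.+ f (G ℤ.- v i))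
        ≡⟨ ⅀-ext T (λ i → row-sum i) ⟩
      ⅀[ i ∈ T ] (⅀[ j ∈ T ] pairTerm i j ℤ.+ pairTerm j i)
        ≡⟨ ⅀-ext T (λ i → ⅀-+ T (pairTerm i) (λ j → pairTerm j i)) ⟩
      ⅀[ i ∈ T ] (⅀ T (pairTerm i) ℤ.+ (⅀[ j ∈ T ] pairTerm j i))
        ≡⟨ ⅀-+ T _ _ ⟩
      (⅀[ i ∈ T ] ⅀ T (pairTerm i)) ℤ.+ (⅀[ i ∈ T ] ⅀[ j ∈ T ] pairTerm j i)
        ≡⟨ cong₂ ℤ._+_ (sym pairMultiplicity≡) (trans (⅀-swap T T (λ i j → pairTerm j i)) (sym pairMultiplicity≡)) ⟩
      pairMultiplicity g v m ℤ.+ pairMultiplicity g v m ∎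
      where
      open ≡-Reasoning
      row-sum : ∀ i → 𝟙 (v i ℤ.≟ m ℤ.+ G) ℤ.+ (f (v i) ℤ.+ f (G ℤ.- v i)) ≡ ⅀[ j ∈ T ] pairTerm i j ℤ.+ pairTerm j i
      row-sum i = begin
        a ℤ.+ (f (v i) ℤ.+ f (G ℤ.- v i))
          ≡⟨ cong₂ (λ s u → a ℤ.+ (s ℤ.+ u)) (f-v i) (f-g-v i) ⟩
        a ℤ.+ (S₁ ℤ.- a ℤ.- σ i i ℤ.+ S₂)
          ≡⟨ lemma₁ a S₁ S₂ (σ i i) ⟩
        S₁ ℤ.+ S₂ ℤ.- σ i i
          ≡⟨ cong₂ ℤ._-_ (⅀-+ T _ _) (diagonal-sum i) ⟨
        (⅀[ j ∈ T ] δ i j ℤ.+ σ i j ℤ.+ δ j i) ℤ.- (⅀[ j ∈ T ] 𝟙 (j Fin.≟ i) ℤ.* σ i j)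
          ≡⟨ ⅀-- T _ _ ⟨
        ⅀[ j ∈ T ] δ i j ℤ.+ σ i j ℤ.+ δ j i ℤ.- 𝟙 (j Fin.≟ i) ℤ.* σ i j
          ≡⟨ ⅀-ext T (λ j → trans (cong (λ s → s ℤ.- 𝟙 (j Fin.≟ i) ℤ.* σ i j) (split-pairs i j)) (lemma₂ (pairTerm i j ℤ.+ pairTerm j i) (𝟙 (j Fin.≟ i) ℤ.* σ i j))) ⟩
        ⅀[ j ∈ T ] pairTerm i j ℤ.+ pairTerm j i ∎
        where
        a S₁ S₂ : ℤ
        a  = 𝟙 (v i ℤ.≟ m ℤ.+ G)
        S₁ = ⅀[ j ∈ T ] δ i j ℤ.+ σ i j
        S₂ = ⅀[ j ∈ T ] δ j i
        lemma₁ : ∀ a s u d → a ℤ.+ (s ℤ.- a ℤ.- d ℤ.+ u) ≡ s ℤ.+ u ℤ.- d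
        lemma₁ = ℤ-Solver.solve-∀
        lemma₂ : ∀ a b → a ℤ.+ b ℤ.- b ≡ a
        lemma₂ = ℤ-Solver.solve-∀

    twice-hookDefect≡ : ∀ {K W} → bound ℕ.≤ K → K ℕ.+ (suc n ℕ.+ g) ℕ.+ (suc n ℕ.+ g) ℕ.≤ W →
      hookDefect g m ℤ.+ hookDefect g m ≡
      pairMultiplicity g v m ℤ.+ pairMultiplicity g v m ℤ.+ correction W (G ℤ.- m)
    twice-hookDefect≡ {K} {W} bound≤K ≤W = trans (twice-hookDefect (suc n) g bound≤K (s≤s z≤n) ≤W)
      (cong (λ s → s ℤ.+ correction W (G ℤ.- m)) (begin
        (⅀[ x ∈ window W ] D g x ℤ.* D g (x ℤ.- m)) ℤ.- (⅀[ x ∈ window W ] D g x ℤ.* I x)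
          ≡⟨ cong₂ ℤ._-_ (⅀-D bound≤K K+g≤W (λ x → D g (x ℤ.- m))) (⅀-D bound≤K K+g≤W I) ⟩
        (⅀[ b ∈ letters ] D g (b ℤ.- m)) ℤ.- ⅀ letters I
          ≡⟨ ⅀-- letters (λ b → D g (b ℤ.- m)) I ⟨
        ⅀[ b ∈ letters ] D g (b ℤ.- m) ℤ.- I b
          ≡⟨ ⅀-ext letters (λ b → cong (λ s → s ℤ.- I b) (D≡multiplicity (b ℤ.- m))) ⟩
        ⅀ letters f
          ≡⟨ ⅀-f ⟩
        pairMultiplicity g v m ℤ.+ pairMultiplicity g v m ∎))
      where
      open ≡-Reasoning
      I : ℤ → ℤ
      I x = 𝟙 (x ℤ.≟ m) ℤ.+ 𝟙 (x ℤ.≟ m ℤ.+ G) ℤ.+ 𝟙 (x ℤ.+ x ℤ.≟ m ℤ.+ G)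
      K+g≤W : K ℕ.+ g ℕ.≤ W
      K+g≤W = ℕ.≤-trans (ℕ.+-monoʳ-≤ K (ℕ.m≤n+m g (suc n))) (ℕ.≤-trans (ℕ.m≤m+n _ _) ≤W)

  -- The `rᵢ` are positive and decreasing, so every `rᵢ ± rⱼ` with `i < j` is positive.
  pairMultiplicity-nonpositive : ∀ z → z ℤ.≤ 0ℤ → pairMultiplicity g v z ≡ 0ℤ
  pairMultiplicity-nonpositive z z≤0 = ⅀-zero (pairs< t) λ {(i , j)} ij∈ → cong₂ ℤ._+_
    (𝟙-no (r-diff g v i j ℤ.≟ z) λ e → ℤ.<-irrefl refl (ℤ.<-≤-trans (<-by (v-decreasing i j (proj₂ (∈-filter⁻ (λ (i , j) → i Fin.<? j) {xs = cartesianProduct (allFin t) (allFin t)} ij∈))) (lemma₁ (v i) (v j)))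
      (ℤ.≤-trans (ℤ.≤-reflexive e) z≤0)))
    (𝟙-no (r-sum g v i j ℤ.≟ z) λ e → ℤ.<-irrefl refl (ℤ.<-≤-trans (<-by (g<v+v i j) (lemma₂ (v i ℤ.+ v j) (+ g)))
      (ℤ.≤-trans (ℤ.≤-reflexive e) z≤0)))
    where
    lemma₁ : ∀ v w → v ℤ.- w ℤ.- 0ℤ ≡ v ℤ.- w
    lemma₁ = ℤ-Solver.solve-∀
    lemma₂ : ∀ s G → s ℤ.- G ℤ.- 0ℤ ≡ s ℤ.- G
    lemma₂ = ℤ-Solver.solve-∀

-- The empty partition as the case of comparison.

∅ : Partition
∅ = record { parts = []; decreasing = []; positive = [] }

∅-doubledDistinct : DoubledDistinct ∅
∅-doubledDistinct (suc _) _ ()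

∅-core : ∀ g → Core g ∅
∅-core _ _ ()

-- The β's of the empty partition are `0 , … , g - 1`. Here `rᵢ = g/2 - i`, so `rᵢ - rⱼ = j - i` and
-- `rᵢ + rⱼ = g - i - j`: the denominators of the product formula.
∅-coding : ∀ g t → Vector ℤ t
∅-coding g t i = + g ℤ.- idx i

module _ (t : ℕ) where
  private
    g : ℕ
    g = 1 ℕ.+ 2 ℕ.* t

    i<g : (i : Fin t) → suc (toℕ i) ℕ.≤ g
    i<g i = ℕ.m≤n⇒m≤1+n (ℕ.≤-trans (Fin.toℕ<n i) (ℕ.m≤m+n t (t ℕ.+ 0)))

  ∅-IsVCoding : IsVCoding g t ∅ (∅-coding g t)
  ∅-IsVCoding = record
    { β = λ k → + toℕ k
    ; β-max = λ k → (-1ℤ , (g ∸ toℕ k , ℕ.m<n⇒0<n∸m (Fin.toℕ<n k) , position k) , start (+ g) (+ toℕ k)) , λ n → maximal k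
    ; decreasing = λ i j i<j → ℤ.+-monoʳ-< (+ g) (ℤ.neg-mono-< (ℤ.+<+ (s≤s i<j)))
    ; fromβ = λ i → fromℕ< (g∸i<g i) , trans (sym (+-∸ (i<g i))) (cong +_ (sym (Fin.toℕ-fromℕ< (g∸i<g i))))
    ; largest = largest
    }
    where
    start : ∀ g k → k ≡ (-1ℤ ℤ.+ 1ℤ) ℤ.* g ℤ.+ k
    start = ℤ-Solver.solve-∀
    position : ∀ (k : Fin g) → -1ℤ ℤ.* + g ℤ.+ + toℕ k ≡ + 0 ℤ.- + (g ∸ toℕ k)
    position k = trans (lemma (+ g) (+ toℕ k)) (cong (ℤ._-_ 0ℤ) (sym (+-∸ (ℕ.<⇒≤ (Fin.toℕ<n k)))))
      where
      lemma : ∀ g k → -1ℤ ℤ.* g ℤ.+ k ≡ 0ℤ ℤ.- (g ℤ.- k)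
      lemma = ℤ-Solver.solve-∀
    maximal : ∀ (k : Fin g) {n} → βSet g ∅ (toℕ k) n → n ℤ.≤ + toℕ k
    -- The zeros of the empty word are the negative integers, so the block with quotient -1 is the
    -- last one that contains zeros.
    maximal k (+ q , (suc i , _ , e) , refl) with trans (sym e) (cong (λ s → s ℤ.+ + toℕ k) (sym (ℤ.pos-* q g)))
    ... | ()
    maximal k (-[1+ q ] , _ , refl) = ≤-by (ℤ.+≤+ (z≤n {q ℕ.* g})) (trans (lemma (+ q) (+ g) (+ toℕ k)) (cong (λ s → s ℤ.- 0ℤ) (sym (ℤ.pos-* q g))))
      where
      lemma : ∀ q g k → k ℤ.- ((ℤ.- (1ℤ ℤ.+ q) ℤ.+ 1ℤ) ℤ.* g ℤ.+ k) ≡ q ℤ.* g ℤ.- 0ℤ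
      lemma = ℤ-Solver.solve-∀
    g∸i<g : (i : Fin t) → g ∸ suc (toℕ i) ℕ.< g
    g∸i<g i = ℕ.∸-monoʳ-< {g} {suc (toℕ i)} {0} (s≤s z≤n) (i<g i)
    largest : ∀ (k : Fin g) → (∃[ i ] ∅-coding g t i ≡ + toℕ k) ⊎ (∀ i → + toℕ k ℤ.< ∅-coding g t i)
    largest k with toℕ k ℕ.≤? t
    -- The smallest entry of the coding is `g - t = t + 1`.
    ... | yes k≤t = inj₂ λ i → <-by (ℤ.+<+ (s≤s (ℕ.+-mono-≤ (Fin.toℕ<n i) k≤t))) (lemma (+ t) (+ toℕ i) (+ toℕ k))
      where
      lemma : ∀ t i k → 1ℤ ℤ.+ (t ℤ.+ (t ℤ.+ 0ℤ)) ℤ.- (1ℤ ℤ.+ i) ℤ.- k ≡ 1ℤ ℤ.+ (t ℤ.+ t) ℤ.- ((1ℤ ℤ.+ i) ℤ.+ k)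
      lemma = ℤ-Solver.solve-∀
    ... | no  k≰t = inj₁ (fromℕ< i<t , (begin
      + g ℤ.- + suc (toℕ (fromℕ< i<t))      ≡⟨ cong (λ i → + g ℤ.- + suc i) (Fin.toℕ-fromℕ< i<t) ⟩
      + g ℤ.- (1ℤ ℤ.+ + (g ∸ suc (toℕ k)))  ≡⟨ cong (λ s → + g ℤ.- (1ℤ ℤ.+ s)) (+-∸ (Fin.toℕ<n k)) ⟩
      + g ℤ.- (1ℤ ℤ.+ (+ g ℤ.- + suc (toℕ k))) ≡⟨ lemma (+ g) (+ toℕ k) ⟩
      + toℕ k                               ∎))
      where
      open ≡-Reasoning
      i<t : g ∸ suc (toℕ k) ℕ.< t
      i<t = ℕ.+-cancelʳ-< (suc (toℕ k)) _ t (subst (ℕ._< t ℕ.+ suc (toℕ k)) (sym (ℕ.m∸n+n≡m (Fin.toℕ<n k)))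
        (subst (ℕ._< t ℕ.+ suc (toℕ k)) (trans (ℕ.+-suc t t) (cong (λ n → suc (t ℕ.+ n)) (sym (ℕ.+-identityʳ t))))
          (ℕ.+-monoʳ-< t (s≤s (ℕ.≰⇒> k≰t)))))
      lemma : ∀ g k → g ℤ.- (1ℤ ℤ.+ (g ℤ.- (1ℤ ℤ.+ k))) ≡ k
      lemma = ℤ-Solver.solve-∀

-- Comparing the multiplicities of the arguments of τ.

module Identity (t : ℕ)
  (μ : Partition) (dd : DoubledDistinct μ) (core : Core (1 ℕ.+ 2 ℕ.* t) μ)
  (v : Vector ℤ t) (coding : IsVCoding (1 ℕ.+ 2 ℕ.* t) t μ v) where

  private
    g : ℕ
    g = 1 ℕ.+ 2 ℕ.* t

  open Diagram μ
  open Doubled μ dd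

  v∅ : Vector ℤ t
  v∅ = ∅-coding g t

  -- For the empty partition the left side is 0, so that comparing with it
  -- gets rid of the correction term.
  hookDefect≡ : ∀ n → hookDefect g (+ suc n) ≡ pairMultiplicity g v (+ suc n) ℤ.- pairMultiplicity g v∅ (+ suc n)
  hookDefect≡ n = twice-injective (begin
    hookDefect g m ℤ.+ hookDefect g m
      ≡⟨ Differences.twice-hookDefect≡ t μ dd core v coding n ℕ.≤-refl ℕ.≤-refl ⟩
    p ℤ.+ p ℤ.+ c
      ≡⟨ lemma p p∅ c ⟩
    p ℤ.- p∅ ℤ.+ (p ℤ.- p∅) ℤ.+ (p∅ ℤ.+ p∅ ℤ.+ c)
      ≡⟨ cong (ℤ._+_ (p ℤ.- p∅ ℤ.+ (p ℤ.- p∅)))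
         -- The correction depends on the window, so the empty partition is counted with the bound
         -- of `μ`.
         (sym (Differences.twice-hookDefect≡ t ∅ ∅-doubledDistinct (∅-core g) v∅ (∅-IsVCoding t) n {bound} (s≤s z≤n) ℕ.≤-refl)) ⟩
    p ℤ.- p∅ ℤ.+ (p ℤ.- p∅) ℤ.+ 0ℤ
      ≡⟨ ℤ.+-identityʳ (p ℤ.- p∅ ℤ.+ (p ℤ.- p∅)) ⟩
    p ℤ.- p∅ ℤ.+ (p ℤ.- p∅) ∎)
    where
    open ≡-Reasoning
    m p p∅ c : ℤ
    m  = + suc n
    p  = pairMultiplicity g v m
    p∅ = pairMultiplicity g v∅ m
    c  = correction (bound ℕ.+ (suc n ℕ.+ g) ℕ.+ (suc n ℕ.+ g)) (+ g ℤ.- m)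
    lemma : ∀ p q c → p ℤ.+ p ℤ.+ c ≡ p ℤ.- q ℤ.+ (p ℤ.- q) ℤ.+ (q ℤ.+ q ℤ.+ c)
    lemma = ℤ-Solver.solve-∀

  pairMultiplicity-∅ : ∀ z → pairMultiplicity g v∅ z ≡
    ⅀[ (i , j) ∈ pairs< t ] 𝟙 (idx j ℤ.- idx i ℤ.≟ z) ℤ.+ 𝟙 (+ g ℤ.- idx i ℤ.- idx j ℤ.≟ z)
  pairMultiplicity-∅ z = ⅀-ext (pairs< t) λ (i , j) →
    cong₂ (λ a b → 𝟙 (a ℤ.≟ z) ℤ.+ 𝟙 (b ℤ.≟ z)) (lemma₁ (+ g) (idx i) (idx j)) (lemma₂ (+ g) (idx i) (idx j))
    where
    lemma₁ : ∀ g i j → g ℤ.- i ℤ.- (g ℤ.- j) ≡ j ℤ.- i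
    lemma₁ = ℤ-Solver.solve-∀
    lemma₂ : ∀ g i j → g ℤ.- i ℤ.+ (g ℤ.- j) ℤ.- g ≡ g ℤ.- i ℤ.- j
    lemma₂ = ℤ-Solver.solve-∀

  -- This keeps 0 out of the arguments `h - ε g`, which vanish only for `h = g` and ε = 1.
  hooks⁺-g : hooks⁺ (+ g) ≡ 0ℤ
  hooks⁺-g = ⅀-zero (boxes μ) λ {s} s∈ → cong (ℤ._* 𝟙 (ε s ℤ.≟ + 1))
    (𝟙-no (+ hook μ s ℤ.≟ + g) λ e → core s s∈ (∣-reflexive (sym (ℤ.+-injective e))))

  private
    𝟙-× : ∀ {A B : Set} (d : Dec A) (e : Dec B) → 𝟙 (d ×-dec e) ≡ 𝟙 d ℤ.* 𝟙 e
    𝟙-× (yes _) (yes _) = refl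
    𝟙-× (yes _) (no  _) = refl
    𝟙-× (no  _) (yes _) = refl
    𝟙-× (no  _) (no  _) = refl

  α≡hooks⁺ : ∀ i → + α g μ i ≡ hooks⁺ (+ (g ∸ i))
  α≡hooks⁺ i = trans (⅀-filter-length (λ s → (hook μ s ℕ.≟ g ∸ i) ×-dec (ε s ℤ.≟ + 1)) (boxes μ)) (⅀-ext (boxes μ) λ s →
    trans (𝟙-× (hook μ s ℕ.≟ g ∸ i) (ε s ℤ.≟ + 1))
      (cong (ℤ._* 𝟙 (ε s ℤ.≟ + 1)) (𝟙-⇔ (hook μ s ℕ.≟ g ∸ i) (+ hook μ s ℤ.≟ + (g ∸ i)) (cong +_) ℤ.+-injective)))

  αMultiplicity : ℤ → ℤ
  αMultiplicity z = ⅀[ i ∈ [1… g ∸ 1 ] ] + α g μ i ℤ.* 𝟙 (+ i ℤ.≟ z)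

  private
    range : List ℤ
    range = map +_ [1… g ∸ 1 ]

    αMultiplicity≡ : ∀ z → αMultiplicity z ≡ ⅀[ y ∈ range ] 𝟙 (y ℤ.≟ z) ℤ.* hooks⁺ (+ g ℤ.- y)
    αMultiplicity≡ z = trans (⅀-cong [1… g ∸ 1 ] λ {i} i∈ → trans (ℤ.*-comm (+ α g μ i) (𝟙 (+ i ℤ.≟ z)))
      (cong (ℤ._*_ (𝟙 (+ i ℤ.≟ z))) (trans (α≡hooks⁺ i) (cong hooks⁺ (+-∸ (i≤g i∈))))))
      (sym (⅀-map [1… g ∸ 1 ] +_ _))
      where
      i≤g : ∀ {i} → i ∈ [1… g ∸ 1 ] → i ℕ.≤ g
      i≤g i∈ with ∈-applyUpTo⁻ suc i∈
      ... | _ , k<g , refl = ℕ.m≤n⇒m≤1+n k<g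

  αMultiplicity-positive : ∀ n → αMultiplicity (+ suc n) ≡ hooks⁺ (+ g ℤ.- + suc n)
  αMultiplicity-positive n with n ℕ.<? g ∸ 1
  ... | yes n< = trans (αMultiplicity≡ (+ suc n)) (⅀-δ-∈ ℤ._≟_ _
    (Unique.map⁺ ℤ.+-injective (Unique.applyUpTo⁺₁ suc (g ∸ 1) (λ i<j _ e → ℕ.<-irrefl (ℕ.suc-injective e) i<j)))
    (∈-map⁺ +_ (∈-applyUpTo⁺ suc n<)))
  ... | no  n≮ = trans (trans (αMultiplicity≡ (+ suc n)) (⅀-δ-∉ ℤ._≟_ {range} {+ suc n} _ outside))
    (sym (hooks⁺-nonpositive (+ g ℤ.- + suc n) (≤-by (ℤ.+≤+ (s≤s (ℕ.≮⇒≥ n≮))) (lemma (+ g) (+ suc n)))))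
    where
    lemma : ∀ g n → 0ℤ ℤ.- (g ℤ.- n) ≡ n ℤ.- g
    lemma = ℤ-Solver.solve-∀
    outside : + suc n ∉ range
    outside ∈range with ∈-map⁻ +_ ∈range
    ... | i , i∈ , refl with ∈-applyUpTo⁻ suc i∈
    ...   | _ , k< , refl = n≮ k<

  αMultiplicity-nonpositive : ∀ z → z ℤ.≤ 0ℤ → αMultiplicity z ≡ 0ℤ
  αMultiplicity-nonpositive z z≤0 = trans (αMultiplicity≡ z) (⅀-δ-∉ ℤ._≟_ {range} {z} _ outside)
    where
    outside : z ∉ range
    outside ∈range with ∈-map⁻ +_ ∈range
    ... | i , i∈ , e with ∈-applyUpTo⁻ suc i∈
    ...   | k , _ , refl = ℤ.<-irrefl refl (ℤ.<-≤-trans (ℤ.+<+ (s≤s z≤n)) (subst (ℤ._≤ 0ℤ) e z≤0))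

  hookMultiplicity : ∀ z → ⅀[ s ∈ boxes μ ] 𝟙 (+ hook μ s ℤ.≟ z) ≡ hooks⁺ z ℤ.+ hooks⁻ z
  hookMultiplicity z = trans (⅀-ext (boxes μ) pointwise) (⅀-+ (boxes μ) _ _)
    where
    pointwise : ∀ s → 𝟙 (+ hook μ s ℤ.≟ z) ≡
      𝟙 (+ hook μ s ℤ.≟ z) ℤ.* 𝟙 (ε s ℤ.≟ + 1) ℤ.+ 𝟙 (+ hook μ s ℤ.≟ z) ℤ.* 𝟙 (ε s ℤ.≟ -1ℤ)
    pointwise (i , j) with j ℕ.<? i
    ... | yes _ = lemma _
      where
      lemma : ∀ a → a ≡ a ℤ.* 0ℤ ℤ.+ a ℤ.* 1ℤ
      lemma = ℤ-Solver.solve-∀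
    ... | no  _ = lemma _
      where
      lemma : ∀ a → a ≡ a ℤ.* 1ℤ ℤ.+ a ℤ.* 0ℤ
      lemma = ℤ-Solver.solve-∀

  shiftedHookMultiplicity : ∀ z → ⅀[ s ∈ boxes μ ] 𝟙 (+ hook μ s ℤ.- ε s ℤ.* + g ℤ.≟ z) ≡ hooks⁺ (z ℤ.+ + g) ℤ.+ hooks⁻ (z ℤ.- + g)
  shiftedHookMultiplicity z = trans (⅀-ext (boxes μ) pointwise) (⅀-+ (boxes μ) _ _)
    where
    e₁ : ∀ h g z → z ℤ.- (h ℤ.- -1ℤ ℤ.* g) ≡ z ℤ.- g ℤ.- h
    e₁ = ℤ-Solver.solve-∀
    e₂ : ∀ h g z → z ℤ.- (h ℤ.- 1ℤ ℤ.* g) ≡ z ℤ.+ g ℤ.- h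
    e₂ = ℤ-Solver.solve-∀
    pointwise : ∀ s → 𝟙 (+ hook μ s ℤ.- ε s ℤ.* + g ℤ.≟ z) ≡
      𝟙 (+ hook μ s ℤ.≟ z ℤ.+ + g) ℤ.* 𝟙 (ε s ℤ.≟ + 1) ℤ.+ 𝟙 (+ hook μ s ℤ.≟ z ℤ.- + g) ℤ.* 𝟙 (ε s ℤ.≟ -1ℤ)
    pointwise (i , j) with j ℕ.<? i
    ... | yes _ = trans (≟-by _ z (+ hook μ (i , j)) (z ℤ.- + g) (e₁ (+ hook μ (i , j)) (+ g) z)) (lemma (𝟙 (+ hook μ (i , j) ℤ.≟ z ℤ.+ + g)) _)
      where
      lemma : ∀ a b → b ≡ a ℤ.* 0ℤ ℤ.+ b ℤ.* 1ℤ
      lemma = ℤ-Solver.solve-∀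
    ... | no  _ = trans (≟-by _ z (+ hook μ (i , j)) (z ℤ.+ + g) (e₂ (+ hook μ (i , j)) (+ g) z)) (lemma _ (𝟙 (+ hook μ (i , j) ℤ.≟ z ℤ.- + g)))
      where
      lemma : ∀ a b → a ≡ a ℤ.* 1ℤ ℤ.+ b ℤ.* 0ℤ
      lemma = ℤ-Solver.solve-∀

  -- Cross-multiplied: numerators of one side with denominators of the other. At 0 nothing occurs,
  -- and at positive `z` this is `hookDefect≡`. At `z = -m` with `m > 0` only `h - g` with ε = 1 and
  -- `h = g - m` contributes, which is the number recorded by α at `m`.
  balance : ∀ z →
    hooks⁺ (z ℤ.+ + g) ℤ.+ hooks⁻ (z ℤ.- + g) ℤ.+ (αMultiplicity z ℤ.+ pairMultiplicity g v∅ z) ≡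
    αMultiplicity (ℤ.- z) ℤ.+ pairMultiplicity g v z ℤ.+ (hooks⁺ z ℤ.+ hooks⁻ z)
  balance = by-sign
    where
    sums : ∀ {a a′ b b′ c c′ d d′ : ℤ} → a ≡ a′ → b ≡ b′ → c ≡ c′ → d ≡ d′ →
      a ℤ.+ b ℤ.+ (c ℤ.+ d) ≡ a′ ℤ.+ b′ ℤ.+ (c′ ℤ.+ d′)
    sums refl refl refl refl = refl
    no-pairs : ∀ {z} → z ℤ.≤ 0ℤ → pairMultiplicity g v z ≡ 0ℤ
    no-pairs = Differences.pairMultiplicity-nonpositive t μ dd core v coding _
    no-pairs∅ : ∀ {z} → z ℤ.≤ 0ℤ → pairMultiplicity g v∅ z ≡ 0ℤ
    no-pairs∅ = Differences.pairMultiplicity-nonpositive t ∅ ∅-doubledDistinct (∅-core g) v∅ (∅-IsVCoding t) _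
    lemma₁ : ∀ a b c q d e → a ℤ.+ b ℤ.+ (c ℤ.+ q) ≡ a ℤ.+ b ℤ.+ c ℤ.- d ℤ.- e ℤ.+ q ℤ.+ (d ℤ.+ e)
    lemma₁ = ℤ-Solver.solve-∀
    lemma₂ : ∀ p q s → p ℤ.- q ℤ.+ q ℤ.+ s ≡ 0ℤ ℤ.+ p ℤ.+ s
    lemma₂ = ℤ-Solver.solve-∀
    by-sign : ∀ z → hooks⁺ (z ℤ.+ + g) ℤ.+ hooks⁻ (z ℤ.- + g) ℤ.+ (αMultiplicity z ℤ.+ pairMultiplicity g v∅ z) ≡
      αMultiplicity (ℤ.- z) ℤ.+ pairMultiplicity g v z ℤ.+ (hooks⁺ z ℤ.+ hooks⁻ z)
    by-sign (+ zero) = trans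
      (sums hooks⁺-g (hooks⁻-nonpositive (0ℤ ℤ.- + g) ℤ.-≤+) (αMultiplicity-nonpositive 0ℤ ℤ.≤-refl) (no-pairs∅ {0ℤ} ℤ.≤-refl))
      (sym (sums (αMultiplicity-nonpositive 0ℤ ℤ.≤-refl) (no-pairs {0ℤ} ℤ.≤-refl) (hooks⁺-nonpositive 0ℤ ℤ.≤-refl) (hooks⁻-nonpositive 0ℤ ℤ.≤-refl)))
    by-sign z@(+ suc n) = begin
      hooks⁺ (z ℤ.+ + g) ℤ.+ hooks⁻ (z ℤ.- + g) ℤ.+ (αMultiplicity z ℤ.+ pairMultiplicity g v∅ z)
        ≡⟨ cong (λ s → hooks⁺ (z ℤ.+ + g) ℤ.+ hooks⁻ (z ℤ.- + g) ℤ.+ (s ℤ.+ pairMultiplicity g v∅ z)) (αMultiplicity-positive n) ⟩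
      hooks⁺ (z ℤ.+ + g) ℤ.+ hooks⁻ (z ℤ.- + g) ℤ.+ (hooks⁺ (+ g ℤ.- z) ℤ.+ pairMultiplicity g v∅ z)
        ≡⟨ lemma₁ (hooks⁺ (z ℤ.+ + g)) (hooks⁻ (z ℤ.- + g)) (hooks⁺ (+ g ℤ.- z)) (pairMultiplicity g v∅ z) (hooks⁺ z) (hooks⁻ z) ⟩
      hookDefect g z ℤ.+ pairMultiplicity g v∅ z ℤ.+ (hooks⁺ z ℤ.+ hooks⁻ z)
        ≡⟨ cong (λ s → s ℤ.+ pairMultiplicity g v∅ z ℤ.+ (hooks⁺ z ℤ.+ hooks⁻ z)) (hookDefect≡ n) ⟩
      pairMultiplicity g v z ℤ.- pairMultiplicity g v∅ z ℤ.+ pairMultiplicity g v∅ z ℤ.+ (hooks⁺ z ℤ.+ hooks⁻ z)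
        ≡⟨ lemma₂ (pairMultiplicity g v z) (pairMultiplicity g v∅ z) (hooks⁺ z ℤ.+ hooks⁻ z) ⟩
      0ℤ ℤ.+ pairMultiplicity g v z ℤ.+ (hooks⁺ z ℤ.+ hooks⁻ z)
        ≡⟨ cong (λ s → s ℤ.+ pairMultiplicity g v z ℤ.+ (hooks⁺ z ℤ.+ hooks⁻ z)) (αMultiplicity-nonpositive -[1+ n ] ℤ.-≤+) ⟨
      αMultiplicity (ℤ.- z) ℤ.+ pairMultiplicity g v z ℤ.+ (hooks⁺ z ℤ.+ hooks⁻ z) ∎
      where open ≡-Reasoning
    by-sign z@(-[1+ n ]) = trans
      (sums (cong hooks⁺ (ℤ.+-comm z (+ g))) (hooks⁻-nonpositive (z ℤ.- + g) ℤ.-≤+) (αMultiplicity-nonpositive z ℤ.-≤+) (no-pairs∅ {z} ℤ.-≤+))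
      (sym (sums (αMultiplicity-positive n) (no-pairs {z} ℤ.-≤+) (hooks⁺-nonpositive z ℤ.-≤+) (hooks⁻-nonpositive z ℤ.-≤+)))

  -- The arguments of τ in the numerators and denominators of the quotients.
  hookRatios αRatios pairRatios : List (ℤ × ℤ)
  hookRatios = map (λ s → + hook μ s ℤ.- ε s ℤ.* + g , + hook μ s) (boxes μ)
  αRatios    = concatMap (λ i → replicate (α g μ i) (ℤ.- + i , + i)) [1… g ∸ 1 ]
  pairRatios = concatMap (λ (i , j) → (r-diff g v i j , idx j ℤ.- idx i) ∷ (r-sum g v i j , + g ℤ.- idx i ℤ.- idx j) ∷ []) (pairs< t)

  ratios↭ : map proj₁ hookRatios ++ map proj₂ (αRatios ++ pairRatios) ↭ map proj₁ (αRatios ++ pairRatios) ++ map proj₂ hookRatios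
  ratios↭ = multiplicity⇒↭ ℤ._≟_ _ _ λ z → begin
    multiplicity ℤ._≟_ z (map proj₁ hookRatios ++ map proj₂ (αRatios ++ pairRatios))
      ≡⟨ ⅀-++ (map proj₁ hookRatios) _ _ ⟩
    multiplicity ℤ._≟_ z (map proj₁ hookRatios) ℤ.+ multiplicity ℤ._≟_ z (map proj₂ (αRatios ++ pairRatios))
      ≡⟨ cong₂ ℤ._+_
         (trans (of-hooks proj₁ z) (shiftedHookMultiplicity z))
         (trans (of-ratios proj₂ z) (cong (ℤ._+_ (αMultiplicity z)) (trans (of-pairs proj₂ z) (sym (pairMultiplicity-∅ z))))) ⟩
    hooks⁺ (z ℤ.+ + g) ℤ.+ hooks⁻ (z ℤ.- + g) ℤ.+ (αMultiplicity z ℤ.+ pairMultiplicity g v∅ z)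
      ≡⟨ balance z ⟩
    αMultiplicity (ℤ.- z) ℤ.+ pairMultiplicity g v z ℤ.+ (hooks⁺ z ℤ.+ hooks⁻ z)
      ≡⟨ cong₂ ℤ._+_
         (trans (of-ratios proj₁ z) (cong₂ ℤ._+_ (⅀-ext [1… g ∸ 1 ] (λ i → cong (ℤ._*_ (+ α g μ i)) (flip i z))) (of-pairs proj₁ z)))
         (trans (of-hooks proj₂ z) (hookMultiplicity z)) ⟨
    multiplicity ℤ._≟_ z (map proj₁ (αRatios ++ pairRatios)) ℤ.+ multiplicity ℤ._≟_ z (map proj₂ hookRatios)
      ≡⟨ ⅀-++ (map proj₁ (αRatios ++ pairRatios)) _ _ ⟨
    multiplicity ℤ._≟_ z (map proj₁ (αRatios ++ pairRatios) ++ map proj₂ hookRatios) ∎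
    where
    open ≡-Reasoning
    flip : ∀ i z → 𝟙 (ℤ.- + i ℤ.≟ z) ≡ 𝟙 (+ i ℤ.≟ ℤ.- z)
    flip i z = ≟-sym-by (ℤ.- + i) z (+ i) (ℤ.- z) (lemma (+ i) z)
      where
      lemma : ∀ i z → z ℤ.- ℤ.- i ≡ i ℤ.- ℤ.- z
      lemma = ℤ-Solver.solve-∀
    of-hooks : ∀ (π : ℤ × ℤ → ℤ) z → multiplicity ℤ._≟_ z (map π hookRatios) ≡
      ⅀[ s ∈ boxes μ ] 𝟙 (π (+ hook μ s ℤ.- ε s ℤ.* + g , + hook μ s) ℤ.≟ z)
    of-hooks π z = trans (⅀-map hookRatios π (λ x → 𝟙 (x ℤ.≟ z))) (⅀-map (boxes μ) _ _)
    of-pairs : ∀ (π : ℤ × ℤ → ℤ) z → ⅀[ p ∈ pairRatios ] 𝟙 (π p ℤ.≟ z) ≡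
      ⅀[ (i , j) ∈ pairs< t ] 𝟙 (π (r-diff g v i j , idx j ℤ.- idx i) ℤ.≟ z) ℤ.+ 𝟙 (π (r-sum g v i j , + g ℤ.- idx i ℤ.- idx j) ℤ.≟ z)
    of-pairs π z = trans (⅀-concatMap (pairs< t) _ _) (⅀-ext (pairs< t) λ (i , j) →
      cong (ℤ._+_ (𝟙 (π (r-diff g v i j , idx j ℤ.- idx i) ℤ.≟ z))) (ℤ.+-identityʳ _))
    of-ratios : ∀ (π : ℤ × ℤ → ℤ) z → multiplicity ℤ._≟_ z (map π (αRatios ++ pairRatios)) ≡
      (⅀[ i ∈ [1… g ∸ 1 ] ] + α g μ i ℤ.* 𝟙 (π (ℤ.- + i , + i) ℤ.≟ z)) ℤ.+ (⅀[ p ∈ pairRatios ] 𝟙 (π p ℤ.≟ z))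
    of-ratios π z = trans (⅀-map (αRatios ++ pairRatios) π (λ x → 𝟙 (x ℤ.≟ z)))
      (trans (⅀-++ αRatios pairRatios _) (cong (λ s → s ℤ.+ (⅀[ p ∈ pairRatios ] 𝟙 (π p ℤ.≟ z)))
        (trans (⅀-concatMap [1… g ∸ 1 ] _ _) (⅀-ext [1… g ∸ 1 ] (λ i → ⅀-replicate (α g μ i) _ _)))))

-- Products of quotients in a field.

module Ratios {c ℓ₁ ℓ₂} (F : HeytingField c ℓ₁ ℓ₂) where

  open FieldProducts F
  open CommutativeRing (HeytingCommutativeRing.commutativeRing heytingCommutativeRing)
    using (*-cong; *-congˡ; *-congʳ; *-assoc; *-identityˡ; *-identityʳ; *-commutativeMonoid; +-congˡ; +-identityʳ; ring)
    renaming (setoid to ≈-setoid; refl to ≈-refl; sym to ≈-sym; trans to ≈-trans)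
  open CommutativeSemigroup (CommutativeMonoid.commutativeSemigroup *-commutativeMonoid) using (interchange; x∙yz≈y∙xz)
  open ≈-Reasoning ≈-setoid

  ∏-cong : ∀ {a} {A : Set a} (xs : List A) {f h : A → Carrier} → (∀ x → f x ≈ h x) → ∏ xs f ≈ ∏ xs h
  ∏-cong []       e = ≈-refl
  ∏-cong (x ∷ xs) e = *-cong (e x) (∏-cong xs e)

  ∏-map : ∀ {a b} {A : Set a} {B : Set b} (xs : List A) (k : A → B) (f : B → Carrier) →
    ∏ (map k xs) f ≈ ∏[ x ∈ xs ] f (k x)
  ∏-map []       k f = ≈-refl
  ∏-map (x ∷ xs) k f = *-congˡ (∏-map xs k f)

  ∏-++ : ∀ {a} {A : Set a} (xs ys : List A) (f : A → Carrier) → ∏ (xs ++ ys) f ≈ ∏ xs f · ∏ ys f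
  ∏-++ []       ys f = ≈-sym (*-identityˡ _)
  ∏-++ (x ∷ xs) ys f = ≈-trans (*-congˡ (∏-++ xs ys f)) (≈-sym (*-assoc _ _ _))

  ∏-concatMap : ∀ {a b} {A : Set a} {B : Set b} (xs : List A) (k : A → List B) (f : B → Carrier) →
    ∏ (concatMap k xs) f ≈ ∏[ x ∈ xs ] ∏ (k x) f
  ∏-concatMap []       k f = ≈-refl
  ∏-concatMap (x ∷ xs) k f = ≈-trans (∏-++ (k x) _ f) (*-congˡ (∏-concatMap xs k f))

  ∏-replicate : ∀ {a} {A : Set a} n (x : A) (f : A → Carrier) → ∏ (replicate n x) f ≈ f x ^ n
  ∏-replicate zero    x f = ≈-refl
  ∏-replicate (suc n) x f = *-congˡ (∏-replicate n x f)

  ∏-· : ∀ {a} {A : Set a} (xs : List A) (f h : A → Carrier) → ∏[ x ∈ xs ] (f x · h x) ≈ ∏ xs f · ∏ xs h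
  ∏-· []       f h = ≈-sym (*-identityˡ 1#)
  ∏-· (x ∷ xs) f h = ≈-trans (*-congˡ (∏-· xs f h)) (interchange _ _ _ _)

  ∏-one : ∀ {a} {A : Set a} (xs : List A) {f : A → Carrier} → (∀ x → f x ≈ 1#) → ∏ xs f ≈ 1#
  ∏-one []       e = ≈-refl
  ∏-one (x ∷ xs) e = ≈-trans (*-cong (e x) (∏-one xs e)) (*-identityˡ 1#)

  ∏-↭ : ∀ {a} {A : Set a} {xs ys : List A} (f : A → Carrier) → xs ↭ ys → ∏ xs f ≈ ∏ ys f
  ∏-↭ f ↭.refl         = ≈-refl
  ∏-↭ f (↭.prep x π)   = *-congˡ (∏-↭ f π)
  ∏-↭ f (↭.swap x y π) = ≈-trans (*-congˡ (*-congˡ (∏-↭ f π))) (x∙yz≈y∙xz _ _ _)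
  ∏-↭ f (↭.trans π ρ)  = ≈-trans (∏-↭ f π) (∏-↭ f ρ)

  module _ (τ : ℤ → Fˣ) where

    num inv : ℤ → Carrier
    num z = proj₁ (τ z)
    inv z = proj₁ (#⇒invertible (proj₂ (τ z)))

    num·inv≈1 : ∀ z → num z · inv z ≈ 1#
    num·inv≈1 z = ≈-trans (*-congʳ (≈-sym (≈-trans (+-congˡ (Ring.-0#≈0# ring)) (+-identityʳ (num z)))))
      (proj₂ (proj₂ (#⇒invertible (proj₂ (τ z)))))

    ratio : ℤ × ℤ → Carrier
    ratio (a , b) = τ a ÷ τ b

    ∏-ratio : ∀ ps → ∏ ps ratio ≈ ∏ (map proj₁ ps) num · ∏ (map proj₂ ps) inv
    ∏-ratio ps = ≈-trans (∏-· ps (λ p → num (proj₁ p)) (λ p → inv (proj₂ p)))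
      (≈-sym (*-cong (∏-map ps proj₁ num) (∏-map ps proj₂ inv)))

    ∏-num·∏-inv≈1 : ∀ zs → ∏ zs num · ∏ zs inv ≈ 1#
    ∏-num·∏-inv≈1 zs = ≈-trans (≈-sym (∏-· zs num inv)) (∏-one zs num·inv≈1)

    -- Inserting `∏ ds num · ∏ ds inv`, which is 1, completes `as` to `as ++ ds`; once the factors
    -- are rearranged, `bs` cancels against its inverses.
    cross-multiply : ∀ as bs cs ds → as ++ ds ↭ cs ++ bs → ∏ as num · ∏ bs inv ≈ ∏ cs num · ∏ ds inv
    cross-multiply as bs cs ds π = begin
      ∏ as num · ∏ bs inv                                ≈⟨ *-identityʳ _ ⟨
      (∏ as num · ∏ bs inv) · 1#                         ≈⟨ *-congˡ (∏-num·∏-inv≈1 ds) ⟨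
      (∏ as num · ∏ bs inv) · (∏ ds num · ∏ ds inv)      ≈⟨ interchange _ _ _ _ ⟩
      (∏ as num · ∏ ds num) · (∏ bs inv · ∏ ds inv)      ≈⟨ *-congʳ (∏-++ as ds num) ⟨
      ∏ (as ++ ds) num · (∏ bs inv · ∏ ds inv)           ≈⟨ *-congʳ (∏-↭ num π) ⟩
      ∏ (cs ++ bs) num · (∏ bs inv · ∏ ds inv)           ≈⟨ *-congʳ (∏-++ cs bs num) ⟩
      (∏ cs num · ∏ bs num) · (∏ bs inv · ∏ ds inv)      ≈⟨ *-assoc _ _ _ ⟩
      ∏ cs num · (∏ bs num · (∏ bs inv · ∏ ds inv))      ≈⟨ *-congˡ (*-assoc _ _ _) ⟨
      ∏ cs num · ((∏ bs num · ∏ bs inv) · ∏ ds inv)      ≈⟨ *-congˡ (*-congʳ (∏-num·∏-inv≈1 bs)) ⟩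
      ∏ cs num · (1# · ∏ ds inv)                         ≈⟨ *-congˡ (*-identityˡ _) ⟩
      ∏ cs num · ∏ ds inv                                ∎

  module ProductFormula (τ : ℤ → Fˣ) (t : ℕ)
    (μ : Partition) (dd : DoubledDistinct μ) (core : Core (1 ℕ.+ 2 ℕ.* t) μ)
    (v : Vector ℤ t) (coding : IsVCoding (1 ℕ.+ 2 ℕ.* t) t μ v) where

    private
      g : ℕ
      g = 1 ℕ.+ 2 ℕ.* t

    open Identity t μ dd core v coding

    product-formula :
      (∏[ s ∈ boxes μ ] (τ (+ hook μ s ℤ.- ε s ℤ.* + g) ÷ τ (+ hook μ s)))
      ≈ (∏[ i ∈ [1… g ∸ 1 ] ] ((τ (ℤ.- + i) ÷ τ (+ i)) ^ α g μ i))
        · (∏[ ij ∈ pairs< t ] (let (i , j) = ij in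
              (τ (r-diff g v i j) ÷ τ (idx j ℤ.- idx i))
              · (τ (r-sum g v i j) ÷ τ (+ g ℤ.- idx i ℤ.- idx j))))
    product-formula = begin
      ∏[ s ∈ boxes μ ] (τ (+ hook μ s ℤ.- ε s ℤ.* + g) ÷ τ (+ hook μ s))
        ≈⟨ ∏-map (boxes μ) _ (ratio τ) ⟨
      ∏ hookRatios (ratio τ)
        ≈⟨ ∏-ratio τ hookRatios ⟩
      ∏ (map proj₁ hookRatios) (num τ) · ∏ (map proj₂ hookRatios) (inv τ)
        ≈⟨ cross-multiply τ (map proj₁ hookRatios) (map proj₂ hookRatios) (map proj₁ (αRatios ++ pairRatios)) (map proj₂ (αRatios ++ pairRatios)) ratios↭ ⟩
      ∏ (map proj₁ (αRatios ++ pairRatios)) (num τ) · ∏ (map proj₂ (αRatios ++ pairRatios)) (inv τ)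
        ≈⟨ ∏-ratio τ (αRatios ++ pairRatios) ⟨
      ∏ (αRatios ++ pairRatios) (ratio τ)
        ≈⟨ ∏-++ αRatios pairRatios (ratio τ) ⟩
      ∏ αRatios (ratio τ) · ∏ pairRatios (ratio τ)
        ≈⟨ *-cong
           (≈-trans (∏-concatMap [1… g ∸ 1 ] _ (ratio τ)) (∏-cong [1… g ∸ 1 ] (λ i → ∏-replicate (α g μ i) _ (ratio τ))))
           (≈-trans (∏-concatMap (pairs< t) _ (ratio τ)) (∏-cong (pairs< t) (λ _ → *-congˡ (*-identityʳ _)))) ⟩
      _ ∎

-- The size of the core as a quadratic form in its coding.

-- z² - g z = (z - g/2)² - g²/4.
quad : ℕ → ℤ → ℤ
quad g z = z ℤ.* z ℤ.- + g ℤ.* z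

module Size (t : ℕ)
  (μ : Partition) (dd : DoubledDistinct μ) (core : Core (1 ℕ.+ 2 ℕ.* t) μ)
  (v : Vector ℤ t) (coding : IsVCoding (1 ℕ.+ 2 ℕ.* t) t μ v) where

  private
    g : ℕ
    g = 1 ℕ.+ 2 ℕ.* t

  private
    module M = Diagram μ
    module E = Diagram ∅

    v∅ : Vector ℤ t
    v∅ = ∅-coding g t

    K W : ℕ
    K = M.bound
    W = K ℕ.+ g

    bound≤W : M.bound ℕ.≤ W
    bound≤W = ℕ.m≤m+n K g

    ρ : ℤ → ℤ
    ρ z = M.χ z ℤ.- E.χ z

    ρ-supported : ∀ (F : ℤ → ℤ) → Supported K (λ z → ρ z ℤ.* F z)
    ρ-supported F z (above K≤z) = cong (ℤ._* F z) (cong₂ ℤ._-_ (M.χ-above ℕ.≤-refl z K≤z) (E.χ-above (s≤s z≤n) z K≤z))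
    ρ-supported F z (below z≤)  = cong (ℤ._* F z) (cong₂ ℤ._-_ (M.χ-below ℕ.≤-refl z z≤) (E.χ-below (s≤s z≤n) z z≤))

    size≡⅀ρ : + size μ ≡ ⅀[ z ∈ window W ] ρ z ℤ.* z
    size≡⅀ρ = begin
      + size μ                                ≡⟨ trans (M.size-χ bound≤W) (lemma₁ a b c) ⟩
      a ℤ.- b ℤ.+ (b ℤ.+ c)                   ≡⟨ cong (ℤ._+_ (a ℤ.- b)) (E.size-χ (s≤s z≤n)) ⟨
      a ℤ.- b ℤ.+ 0ℤ                          ≡⟨ ℤ.+-identityʳ (a ℤ.- b) ⟩
      a ℤ.- b                                 ≡⟨ ⅀-- (window W) (λ z → M.χ z ℤ.* z) (λ z → E.χ z ℤ.* z) ⟨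
      ⅀[ z ∈ window W ] (M.χ z ℤ.* z ℤ.- E.χ z ℤ.* z) ≡⟨ ⅀-ext (window W) (λ z → lemma₂ (M.χ z) (E.χ z) z) ⟩
      ⅀[ z ∈ window W ] ρ z ℤ.* z             ∎
      where
      open ≡-Reasoning
      a b c : ℤ
      a = ⅀[ z ∈ window W ] M.χ z ℤ.* z
      b = ⅀[ z ∈ window W ] E.χ z ℤ.* z
      c = ⅀[ i ∈ upTo W ] + suc i
      lemma₁ : ∀ a b c → a ℤ.+ c ≡ a ℤ.- b ℤ.+ (b ℤ.+ c)
      lemma₁ = ℤ-Solver.solve-∀
      lemma₂ : ∀ a b z → a ℤ.* z ℤ.- b ℤ.* z ≡ (a ℤ.- b) ℤ.* z
      lemma₂ = ℤ-Solver.solve-∀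

    -- `quad g` vanishes at 0 and is invariant under `z ↦ g - z`, so `vᵢ` and `g - vᵢ` contribute
    -- equally.
    ⅀-quad : ∀ (ν : Partition) (dd : DoubledDistinct ν) (core : Core g ν) (w : Vector ℤ t) (coding : IsVCoding g t ν w) →
      Diagram.bound ν ℕ.≤ K →
      ⅀[ z ∈ window W ] Doubled.D ν dd g z ℤ.* quad g z ≡ + 2 ℤ.* (⅀[ i ∈ allFin t ] quad g (w i))
    ⅀-quad ν dd core w coding bound≤K = begin
      ⅀[ z ∈ window W ] Doubled.D ν dd g z ℤ.* quad g z
        ≡⟨ Coding.⅀-D t ν dd core w coding bound≤K ℕ.≤-refl (quad g) ⟩
      ⅀ (Coding.letters t ν dd core w coding) (quad g)
        ≡⟨ Differences.⅀-letters t ν dd core w coding (quad g) ⟩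
      quad g 0ℤ ℤ.+ (⅀[ i ∈ allFin t ] quad g (w i) ℤ.+ quad g (+ g ℤ.- w i))
        ≡⟨ cong₂ ℤ._+_ (lemma₀ (+ g)) (trans (⅀-ext (allFin t) (λ i → lemma (w i) (+ g))) (⅀-*ˡ (allFin t) (+ 2) (λ i → quad g (w i)))) ⟩
      0ℤ ℤ.+ + 2 ℤ.* (⅀[ i ∈ allFin t ] quad g (w i))
        ≡⟨ ℤ.+-identityˡ (+ 2 ℤ.* (⅀[ i ∈ allFin t ] quad g (w i))) ⟩
      + 2 ℤ.* (⅀[ i ∈ allFin t ] quad g (w i)) ∎
      where
      open ≡-Reasoning
      lemma₀ : ∀ g → 0ℤ ℤ.* 0ℤ ℤ.- g ℤ.* 0ℤ ≡ 0ℤ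
      lemma₀ = ℤ-Solver.solve-∀
      lemma : ∀ v g → v ℤ.* v ℤ.- g ℤ.* v ℤ.+ ((g ℤ.- v) ℤ.* (g ℤ.- v) ℤ.- g ℤ.* (g ℤ.- v)) ≡ + 2 ℤ.* (v ℤ.* v ℤ.- g ℤ.* v)
      lemma = ℤ-Solver.solve-∀

  -- Subtracting the indicator of the empty partition leaves a finitely supported `ρ`, so the
  -- difference of `quad g` with step `g` can be moved onto `ρ`, where it becomes the difference of
  -- the two `D`.
  g*size : + g ℤ.* + size μ ≡ (⅀[ i ∈ allFin t ] quad g (v i)) ℤ.- (⅀[ i ∈ allFin t ] quad g (v∅ i))
  g*size = ℤ.*-cancelˡ-≡ (+ 2) _ _ (begin
    + 2 ℤ.* (+ g ℤ.* + size μ)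
      ≡⟨ trans (cong (λ s → + 2 ℤ.* (+ g ℤ.* s)) size≡⅀ρ) (trans (sym (ℤ.*-assoc (+ 2) (+ g) (⅀[ z ∈ window W ] ρ z ℤ.* z))) (sym (⅀-*ˡ (window W) (+ 2 ℤ.* + g) (λ z → ρ z ℤ.* z)))) ⟩
    ⅀[ z ∈ window W ] + 2 ℤ.* + g ℤ.* (ρ z ℤ.* z)
      ≡⟨ ⅀-ext (window W) (λ z → lemma₁ (ρ z) z (+ g)) ⟩
    ⅀[ z ∈ window W ] (ρ z ℤ.* quad g (z ℤ.+ + g) ℤ.- ρ z ℤ.* quad g z)
      ≡⟨ ⅀-- (window W) (λ z → ρ z ℤ.* quad g (z ℤ.+ + g)) (λ z → ρ z ℤ.* quad g z) ⟩
    (⅀[ z ∈ window W ] ρ z ℤ.* quad g (z ℤ.+ + g)) ℤ.- (⅀[ z ∈ window W ] ρ z ℤ.* quad g z)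
      ≡⟨ cong (λ s → s ℤ.- (⅀[ z ∈ window W ] ρ z ℤ.* quad g z)) (⅀-shift⁻ (λ z → ρ z ℤ.* quad g (z ℤ.+ + g)) (ρ-supported (λ z → quad g (z ℤ.+ + g))) g ℕ.≤-refl) ⟨
    (⅀[ z ∈ window W ] ρ (z ℤ.- + g) ℤ.* quad g (z ℤ.- + g ℤ.+ + g)) ℤ.- (⅀[ z ∈ window W ] ρ z ℤ.* quad g z)
      ≡⟨ ⅀-- (window W) (λ z → ρ (z ℤ.- + g) ℤ.* quad g (z ℤ.- + g ℤ.+ + g)) (λ z → ρ z ℤ.* quad g z) ⟨
    ⅀[ z ∈ window W ] (ρ (z ℤ.- + g) ℤ.* quad g (z ℤ.- + g ℤ.+ + g) ℤ.- ρ z ℤ.* quad g z)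
      ≡⟨ ⅀-ext (window W) (λ z → trans (cong (λ w → ρ (z ℤ.- + g) ℤ.* quad g w ℤ.- ρ z ℤ.* quad g z) (lemma₂ z (+ g)))
           (lemma₃ (M.χ (z ℤ.- + g)) (E.χ (z ℤ.- + g)) (M.χ z) (E.χ z) (quad g z))) ⟩
    ⅀[ z ∈ window W ] (Doubled.D μ dd g z ℤ.* quad g z ℤ.- Doubled.D ∅ ∅-doubledDistinct g z ℤ.* quad g z)
      ≡⟨ ⅀-- (window W) (λ z → Doubled.D μ dd g z ℤ.* quad g z) (λ z → Doubled.D ∅ ∅-doubledDistinct g z ℤ.* quad g z) ⟩
    (⅀[ z ∈ window W ] Doubled.D μ dd g z ℤ.* quad g z) ℤ.- (⅀[ z ∈ window W ] Doubled.D ∅ ∅-doubledDistinct g z ℤ.* quad g z)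
      ≡⟨ cong₂ ℤ._-_ (⅀-quad μ dd core v coding ℕ.≤-refl) (⅀-quad ∅ ∅-doubledDistinct (∅-core g) v∅ (∅-IsVCoding t) (s≤s z≤n)) ⟩
    + 2 ℤ.* a ℤ.- + 2 ℤ.* b
      ≡⟨ lemma₄ a b ⟩
    + 2 ℤ.* (a ℤ.- b) ∎)
    where
    open ≡-Reasoning
    a b : ℤ
    a = ⅀[ i ∈ allFin t ] quad g (v i)
    b = ⅀[ i ∈ allFin t ] quad g (v∅ i)
    lemma₁ : ∀ r z g → + 2 ℤ.* g ℤ.* (r ℤ.* z) ≡ r ℤ.* ((z ℤ.+ g) ℤ.* (z ℤ.+ g) ℤ.- g ℤ.* (z ℤ.+ g)) ℤ.- r ℤ.* (z ℤ.* z ℤ.- g ℤ.* z)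
    lemma₁ = ℤ-Solver.solve-∀
    lemma₂ : ∀ z g → z ℤ.- g ℤ.+ g ≡ z
    lemma₂ = ℤ-Solver.solve-∀
    lemma₃ : ∀ a b c d q → (a ℤ.- b) ℤ.* q ℤ.- (c ℤ.- d) ℤ.* q ≡ (a ℤ.- c) ℤ.* q ℤ.- (b ℤ.- d) ℤ.* q
    lemma₃ = ℤ-Solver.solve-∀
    lemma₄ : ∀ a b → + 2 ℤ.* a ℤ.- + 2 ℤ.* b ≡ + 2 ℤ.* (a ℤ.- b)
    lemma₄ = ℤ-Solver.solve-∀

⅀-allFin-toℕ : ∀ n (f : ℕ → ℤ) → ⅀[ i ∈ allFin n ] f (toℕ i) ≡ ⅀ (upTo n) f
⅀-allFin-toℕ n f = go n id id f (λ _ → refl)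
  where
  go : ∀ {A B : Set} n (h : Fin n → A) (k : ℕ → B) {f : A → ℤ} (f′ : B → ℤ) → (∀ i → f (h i) ≡ f′ (k (toℕ i))) →
    ⅀ (tabulate h) f ≡ ⅀ (applyUpTo k n) f′
  go zero    h k f′ e = refl
  go (suc n) h k f′ e = cong₂ ℤ._+_ (e Fin.zero) (go n (h ∘ Fin.suc) (k ∘ suc) f′ (e ∘ Fin.suc))

-- `quad g (g - k)` is `k² - g k`, so the sum is evaluated by the formulas for sums of squares and
-- of integers; the factor 6 clears their denominators.
⅀-quad-∅ : ∀ g n → + 6 ℤ.* (⅀[ i ∈ upTo n ] quad g (+ g ℤ.- + suc i)) ≡
  + n ℤ.* (+ n ℤ.+ 1ℤ) ℤ.* (+ 2 ℤ.* + n ℤ.+ 1ℤ) ℤ.- + 3 ℤ.* + g ℤ.* + n ℤ.* (+ n ℤ.+ 1ℤ)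
⅀-quad-∅ g zero    = lemma (+ g)
  where
  lemma : ∀ g → + 6 ℤ.* 0ℤ ≡ 0ℤ ℤ.* (0ℤ ℤ.+ 1ℤ) ℤ.* (+ 2 ℤ.* 0ℤ ℤ.+ 1ℤ) ℤ.- + 3 ℤ.* g ℤ.* 0ℤ ℤ.* (0ℤ ℤ.+ 1ℤ)
  lemma = ℤ-Solver.solve-∀
⅀-quad-∅ g (suc n) = begin
  + 6 ℤ.* ⅀ (upTo (suc n)) f                    ≡⟨ cong (λ xs → + 6 ℤ.* ⅀ xs f) (List.upTo-∷ʳ n) ⟨
  + 6 ℤ.* ⅀ (upTo n ++ n ∷ []) f                ≡⟨ cong (ℤ._*_ (+ 6)) (⅀-++ (upTo n) (n ∷ []) f) ⟩
  + 6 ℤ.* (⅀ (upTo n) f ℤ.+ (f n ℤ.+ 0ℤ))       ≡⟨ ℤ.*-distribˡ-+ (+ 6) (⅀ (upTo n) f) (f n ℤ.+ 0ℤ) ⟩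
  + 6 ℤ.* ⅀ (upTo n) f ℤ.+ + 6 ℤ.* (f n ℤ.+ 0ℤ) ≡⟨ cong (λ s → s ℤ.+ + 6 ℤ.* (f n ℤ.+ 0ℤ)) (⅀-quad-∅ g n) ⟩
  _                                             ≡⟨ lemma (+ g) (+ n) ⟩
  _                                             ∎
  where
  open ≡-Reasoning
  f : ℕ → ℤ
  f i = quad g (+ g ℤ.- + suc i)
  lemma : ∀ g n → n ℤ.* (n ℤ.+ 1ℤ) ℤ.* (+ 2 ℤ.* n ℤ.+ 1ℤ) ℤ.- + 3 ℤ.* g ℤ.* n ℤ.* (n ℤ.+ 1ℤ)
      ℤ.+ + 6 ℤ.* ((g ℤ.- (1ℤ ℤ.+ n)) ℤ.* (g ℤ.- (1ℤ ℤ.+ n)) ℤ.- g ℤ.* (g ℤ.- (1ℤ ℤ.+ n)) ℤ.+ 0ℤ) ≡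
    (1ℤ ℤ.+ n) ℤ.* (1ℤ ℤ.+ n ℤ.+ 1ℤ) ℤ.* (+ 2 ℤ.* (1ℤ ℤ.+ n) ℤ.+ 1ℤ) ℤ.- + 3 ℤ.* g ℤ.* (1ℤ ℤ.+ n) ℤ.* (1ℤ ℤ.+ n ℤ.+ 1ℤ)
  lemma = ℤ-Solver.solve-∀

private
  /≃ : ∀ n d → toℚᵘ (n ℚ./ suc d) ℚᵘ.≃ mkℚᵘ n d
  /≃ n d = ℚ.toℚᵘ-fromℚᵘ (mkℚᵘ n d)

  toℚᵘ-homo-- : ∀ p q → toℚᵘ (p ℚ.- q) ℚᵘ.≃ toℚᵘ p ℚᵘ.- toℚᵘ q
  toℚᵘ-homo-- p q = ℚᵘ.≃-trans (ℚ.toℚᵘ-homo-+ p (ℚ.- q)) (ℚᵘ.+-congʳ (toℚᵘ p) (ℚ.toℚᵘ-homo‿- q))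

  r≃ : ∀ g z → toℚᵘ (z ℚ./ 1 ℚ.- + g ℚ./ 2) ℚᵘ.≃ mkℚᵘ z 0 ℚᵘ.- mkℚᵘ (+ g) 1
  r≃ g z = ℚᵘ.≃-trans (toℚᵘ-homo-- (z ℚ./ 1) (+ g ℚ./ 2)) (ℚᵘ.+-cong (/≃ z 0) (ℚᵘ.-‿cong (/≃ (+ g) 1)))

-- Each `rᵢ²` is `quad g wᵢ + g²/4`. The second argument of `mkℚᵘ` is the denominator minus one, so
-- `3` means quarters.
∑r²≃ : ∀ g n (w : Vector ℤ n) → toℚᵘ (∑ (λ i → r g w i ℚ.* r g w i)) ℚᵘ.≃
  mkℚᵘ (+ 4 ℤ.* (⅀[ i ∈ allFin n ] quad g (w i)) ℤ.+ + n ℤ.* (+ g ℤ.* + g)) 3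
∑r²≃ g zero    w = *≡* refl
∑r²≃ g (suc n) w = ℚᵘ.≃-trans
  (ℚ.toℚᵘ-homo-+ (r g w Fin.zero ℚ.* r g w Fin.zero) (∑ (λ i → r g (w ∘ Fin.suc) i ℚ.* r g (w ∘ Fin.suc) i)))
  (ℚᵘ.≃-trans
    (ℚᵘ.+-cong (ℚᵘ.≃-trans (ℚ.toℚᵘ-homo-* (r g w Fin.zero) (r g w Fin.zero)) (ℚᵘ.*-cong (r≃ g (w Fin.zero)) (r≃ g (w Fin.zero))))
               (∑r²≃ g n (w ∘ Fin.suc)))
    (*≡* (trans (lemma (w Fin.zero) (+ g) (⅀[ i ∈ allFin n ] quad g (w (Fin.suc i))) (+ n))
      (cong (λ s → (+ 4 ℤ.* (quad g (w Fin.zero) ℤ.+ s) ℤ.+ + suc n ℤ.* (+ g ℤ.* + g)) ℤ.* + 16)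
        (sym (⅀-tabulate Fin.suc (λ i → quad g (w i))))))))
  where
  lemma : ∀ v g s n →
    ((v ℤ.* + 2 ℤ.+ ℤ.- g ℤ.* + 1) ℤ.* (v ℤ.* + 2 ℤ.+ ℤ.- g ℤ.* + 1) ℤ.* + 4 ℤ.+ (+ 4 ℤ.* s ℤ.+ n ℤ.* (g ℤ.* g)) ℤ.* + 4) ℤ.* + 4 ≡
    (+ 4 ℤ.* (v ℤ.* v ℤ.- g ℤ.* v ℤ.+ s) ℤ.+ (1ℤ ℤ.+ n) ℤ.* (g ℤ.* g)) ℤ.* + 16
  lemma = ℤ-Solver.solve-∀

⌊1+2t/2⌋≡t : ∀ t → ⌊ 1 ℕ.+ 2 ℕ.* t /2⌋ ≡ t
⌊1+2t/2⌋≡t t = trans (cong (λ s → ⌊ 1 ℕ.+ (t ℕ.+ s) /2⌋) (ℕ.+-identityʳ t)) (sym (ℕ.n≡⌈n+n/2⌉ t))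

module SizeFormula (t : ℕ)
  (μ : Partition) (dd : DoubledDistinct μ) (core : Core (1 ℕ.+ 2 ℕ.* t) μ)
  (v : Vector ℤ t) (coding : IsVCoding (1 ℕ.+ 2 ℕ.* t) t μ v) where

  private
    g : ℕ
    g = 1 ℕ.+ 2 ℕ.* t

  size-formula : + size μ ℚ./ 1
    ≡ (+ 1 ℚ./ g) ℚ.* ∑ (λ i → r g v i ℚ.* r g v i)
      ℚ.- ((+ g ℤ.- + 2) ℤ.* + ⌊ g /2⌋ ℚ./ 12)
  size-formula = ℚ.toℚᵘ-injective (ℚᵘ.≃-trans (/≃ (+ size μ) 0) (ℚᵘ.≃-trans (*≡* cleared) (ℚᵘ.≃-sym
    (ℚᵘ.≃-trans (toℚᵘ-homo-- ((+ 1 ℚ./ g) ℚ.* ∑ (λ i → r g v i ℚ.* r g v i)) (((+ g ℤ.- + 2) ℤ.* + ⌊ g /2⌋) ℚ./ 12))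
      (ℚᵘ.+-cong
        (ℚᵘ.≃-trans (ℚ.toℚᵘ-homo-* (+ 1 ℚ./ g) (∑ (λ i → r g v i ℚ.* r g v i))) (ℚᵘ.*-cong (/≃ (+ 1) (2 ℕ.* t)) (∑r²≃ g t v)))
        (ℚᵘ.-‿cong (/≃ ((+ g ℤ.- + 2) ℤ.* + ⌊ g /2⌋) 11)))))))
    where
    open ≡-Reasoning
    S a b : ℤ
    S = + size μ
    a = ⅀[ i ∈ allFin t ] quad g (v i)
    b = ⅀[ i ∈ upTo t ] quad g (+ g ℤ.- + suc i)
    gS≡ : + g ℤ.* S ≡ a ℤ.- b
    gS≡ = trans (Size.g*size t μ dd core v coding) (cong (ℤ._-_ a) (⅀-allFin-toℕ t (λ i → quad g (+ g ℤ.- + suc i))))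
    lemma₁ : ∀ s g → s ℤ.* (g ℤ.* + 4 ℤ.* + 12) ≡ + 48 ℤ.* (g ℤ.* s)
    lemma₁ = ℤ-Solver.solve-∀
    lemma₂ : ∀ a b → + 48 ℤ.* (a ℤ.- b) ≡ + 48 ℤ.* a ℤ.- + 8 ℤ.* (+ 6 ℤ.* b)
    lemma₂ = ℤ-Solver.solve-∀
    -- This is where the constant arises: for `g = 2t + 1`, the sum of `(g/2 - i)²` over
    -- `1 ≤ i ≤ t`, divided by `g`, is `(g - 2) t / 12`. The factor 48 clears the denominators 4 and
    -- 12.
    lemma₃ : ∀ a t → let g = 1ℤ ℤ.+ (t ℤ.+ (t ℤ.+ 0ℤ)) in
      + 48 ℤ.* a ℤ.- + 8 ℤ.* (t ℤ.* (t ℤ.+ 1ℤ) ℤ.* (+ 2 ℤ.* t ℤ.+ 1ℤ) ℤ.- + 3 ℤ.* g ℤ.* t ℤ.* (t ℤ.+ 1ℤ)) ≡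
      (+ 1 ℤ.* (+ 4 ℤ.* a ℤ.+ t ℤ.* (g ℤ.* g)) ℤ.* + 12 ℤ.+ ℤ.- ((g ℤ.- + 2) ℤ.* t) ℤ.* (g ℤ.* + 4)) ℤ.* + 1
    lemma₃ = ℤ-Solver.solve-∀
    cleared : S ℤ.* + (g ℕ.* 4 ℕ.* 12) ≡
      (+ 1 ℤ.* (+ 4 ℤ.* a ℤ.+ + t ℤ.* (+ g ℤ.* + g)) ℤ.* + 12 ℤ.+ ℤ.- ((+ g ℤ.- + 2) ℤ.* + ⌊ g /2⌋) ℤ.* + (g ℕ.* 4)) ℤ.* + 1
    cleared = begin
      S ℤ.* + (g ℕ.* 4 ℕ.* 12)
        ≡⟨ cong (ℤ._*_ S) (trans (ℤ.pos-* (g ℕ.* 4) 12) (cong (ℤ._* + 12) (ℤ.pos-* g 4))) ⟩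
      S ℤ.* (+ g ℤ.* + 4 ℤ.* + 12)
        ≡⟨ trans (lemma₁ S (+ g)) (cong (ℤ._*_ (+ 48)) gS≡) ⟩
      + 48 ℤ.* (a ℤ.- b)
        ≡⟨ trans (lemma₂ a b) (cong (λ s → + 48 ℤ.* a ℤ.- + 8 ℤ.* s) (⅀-quad-∅ g t)) ⟩
      _ ≡⟨ lemma₃ a (+ t) ⟩
      _ ≡⟨ cong₂ (λ s u → (+ 1 ℤ.* (+ 4 ℤ.* a ℤ.+ + t ℤ.* (+ g ℤ.* + g)) ℤ.* + 12 ℤ.+ ℤ.- ((+ g ℤ.- + 2) ℤ.* + s) ℤ.* u) ℤ.* + 1)
           (⌊1+2t/2⌋≡t t) (ℤ.pos-* g 4) ⟨
      _ ∎

open import Data.Nat.Base using (_+_; _*_; _≤_)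

theorem4p25 :
  {c ℓ₁ ℓ₂ : Level} (t : ℕ) → 1 ≤ t →
  let g = 1 + 2 * t in
  (ω : Partition) → DoubledDistinct ω → Core g ω →
  (v : Vector ℤ t) → IsVCoding g t ω v →
  (+ size ω ℚ./ 1
     ≡ (+ 1 ℚ./ g) ℚ.* ∑ (λ i → r g v i ℚ.* r g v i)
         ℚ.- ((+ g ℤ.- + 2) ℤ.* + ⌊ g /2⌋ ℚ./ 12))
  ×
  ((F : HeytingField c ℓ₁ ℓ₂) →
    let open FieldProducts F in
    (τ : ℤ → Fˣ) →
    (∏[ s ∈ boxes ω ] (τ (+ hook ω s ℤ.- ε s ℤ.* + g) ÷ τ (+ hook ω s)))
    ≈ (∏[ i ∈ [1… g ∸ 1 ] ] ((τ (ℤ.- + i) ÷ τ (+ i)) ^ α g ω i))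
      · (∏[ ij ∈ pairs< t ] (let (i , j) = ij in
            (τ (r-diff g v i j) ÷ τ (idx j ℤ.- idx i))
            · (τ (r-sum g v i j) ÷ τ (+ g ℤ.- idx i ℤ.- idx j)))))
theorem4p25 t _ ω dd core v coding =
  SizeFormula.size-formula t ω dd core v coding , λ F τ → Ratios.ProductFormula.product-formula F τ t ω dd core v coding
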